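{- Let $C$ be the random output of the procedure SampleOneCluster run on an optimal solution $\{y_S^s\}$ of the bounded sub-cluster LP. Then $$\sum_{uv\in\binom V2}w_{uv}\left|\mathbb P[u,v\in C]-\frac{y_{uv}}{y_\emptyset}\right|\le\frac{\varepsilon\,\mathrm{OPT}}{y_\emptyset}.$$
   Context: Instance: a set $V$ of $n\ge2$ vertices; $\binom V2=E^+\uplus E^-$ (positive/negative pairs, arbitrary); weights $w_{uv}=w_{vu}\ge0$, $w_{uu}=0$, $w_{uv}\le w_{ua}+w_{av}$ for all $u,v,a\in V$. For a partition (clustering) $\mathcal C$ of $V$, $\operatorname{obj}(\mathcal C)$ is the total weight of positive pairs whose endpoints lie in different parts plus the total weight of negative pairs whose endpoints lie in the same part; $\mathrm{OPT}=\min_{\mathcal C}\operatorname{obj}(\mathcal C)$. For $A,B\subseteq V$, $w(A,B)=\sum_{a\in A}\sum_{b\in B}w_{ab}$; $w^+(A,B)$ is the same sum restricted to positive pairs; $w(u,A)=w(\{u\},A)$. $N_u^+=\{v\ne u:uv\in E^+\}$. Fix $\varepsilon\in(0,1]$. Atoms. Fix an absolute constant $\beta$ with $0<\beta\le\frac{2\sqrt7-5}{6}$ and a clustering $\mathcal C^0$ with $\operatorname{obj}(\mathcal C^0)\le\frac{20}3\mathrm{OPT}$. For $u\in C\in\mathcal C^0$ put $d_C(u)=w(u,N_u^+\triangle C)$ and $M_C=\{u\in C:d_C(u)>\frac\beta2w(u,C)\}$. The atom partition $\mathcal K$ is obtained by processing each $C\in\mathcal C^0$: if $\sum_{u\in M_C}d_C(u)>\frac{\beta^2}{20}w(C,C)$,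 put every singleton $\{u\}$, $u\in C$, in $\mathcal K$; otherwise put $\{u\}$ in $\mathcal K$ for each $u\in M_C$, and also $C\setminus M_C$ if nonempty. $\alpha\ge1$ is a fixed absolute constant (depending only on $\beta$) such that $\operatorname{obj}(\mathcal K)\le\alpha\,\mathrm{OPT}$ always holds. Admissible pairs. For an atom $K$ let $d(K)=\sum_{L\in\mathcal K,L\ne K}w^+(K,L)$; $\mathcal K_+=\{K:d(K)>0\}$. On $\mathcal K_+$ let $D=\operatorname{diag}(d(K))$, $P(K,L)=w^+(K,L)/d(K)$ for $K\ne L$, $P(K,K)=0$, $t_0=297$, $Q=P((I+P)/2)^{t_0}$, $\Gamma=DQD^{ -1}Q^\top D$, extended by zeros to $\mathcal K$. With $\tau=\varepsilon/(2\alpha)$, a pair $uv$ with $u,v$ in distinct atoms $K_u,K_v$ is in $E_{\mathrm{adm}}$ iff $w(K_u,K_v)<64\tau^{ -(2t_0+1)}\Gamma_{K_u,K_v}$. Pairs inside one atom are not in $E_{\mathrm{adm}}$. It is known that $\sum_{uv\in E_{\mathrm{adm}}}w_{uv}\le R_\varepsilon\mathrm{OPT}$, where $R_\varepsilon=\max\{1,\alpha,128\alpha(2\alpha/\varepsilon)^{2t_0+1}\}$. Bounded sub-cluster LP. Let $r=2+\lceil 2\ln2\,R_\varepsilon^2/\varepsilon^2\rceil$. Variables $y_S^s$ for $s\in[n]$, $S\subseteq V$, $|S|\le r$; write $y_S=\sum_{s=1}^ny_S^s$, $Su=S\cup\{u\}$, $y_u=y_{\{u\}}$, $y_{uv}=y_{\{u,v\}}$.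 Minimize $\sum_{uv\in E^+}w_{uv}(1-y_{uv})+\sum_{uv\in E^- }w_{uv}y_{uv}$ subject to: $y_u=1$ for all $u$; $\frac1s\sum_{u\in V}y_{Su}^s=y_S^s$ for $s\in[n]$, $|S|\le r-1$; $y_S^s\ge0$; $y_{uv}=1$ for distinct $u,v$ in one atom; $y_{uv}=0$ for $u,v$ in distinct atoms with $uv\notin E_{\mathrm{adm}}$; $0\le\sum_{T'\subseteq T}(-1)^{|T'|}y_{S\cup T'}^s\le y_S^s$ for $s\in[n]$, $S\cap T=\emptyset$, $|S\cup T|\le r$. Its optimum is at most $(1+\varepsilon)\mathrm{OPT}$. Fix an optimal solution; $1\le y_\emptyset\le n$. SampleOneCluster. Sample $s\in[n]$ with probability $y_\emptyset^s/y_\emptyset$; sample $T$ uniformly from $\{1,\dots,r-2\}$ (independently of $s$). Set $U=\emptyset$; for $t=1,\dots,T$ sample $u_t\in V$ with probability $y_{Uu_t}^s/(s\,y_U^s)$ and replace $U$ by $U\cup\{u_t\}$. Then, independently for each atom $K\in\mathcal K$, include all of $K$ in $C$ with probability $y_{Uv}^s/y_U^s$, where $v\in K$ is any representative (the value does not depend on the choice). Output $C$. -}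

module Defs where

open import Algebra.Bundles using (CommutativeRing)
open import Algebra.Structures using (IsCommutativeRing)
open import Data.Bool.Base using (Bool; true; false; if_then_else_)
open import Data.Fin.Base as Fin using (Fin; zero; suc; toℕ)
import Data.Fin.Properties as Fin
open import Data.Fin.Subset
  using (Subset; inside; outside; ⊥; ⁅_⁆; _∪_; _∩_; _─_; _∈_; ∣_∣; Empty)
open import Data.Fin.Subset.Properties using (_∈?_; _⊆?_)
open import Data.Nat.Base as ℕ using (ℕ; zero; suc; _!)
open import Data.Product.Base using (_×_; _,_; proj₁; ∃)
open import Data.Sum.Base using (_⊎_)
open import Data.Vec.Base using ([]; _∷_; tabulate; lookup)
open import Function.Bundles using (_⇔_)
open import Function.Definitions using (StrictlySurjective)
open import Relation.Binary.Bundles using (TotalOrder)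
open import Relation.Binary.PropositionalEquality using (_≡_; _≢_)
open import Relation.Binary.Structures using (IsDecTotalOrder)
import Relation.Binary.Construct.NonStrictToStrict as NonStrictToStrict
import Algebra.Construct.NaturalChoice.Max as Max
import Algebra.Definitions.RawMonoid as Multiple
import Algebra.Properties.Semiring.Exp as Exp
import Algebra.Properties.Semiring.Sum as Sum
import Data.Bool.Properties as Bool
open import Relation.Nullary using (¬_; Dec; does; ¬?; _×-dec_)

-- The classical real line, axiomatised up to isomorphism.  The order is
-- decidable, and the value of 0# ⁻¹ is left unspecified.
record CompleteOrderedField : Set₁ where
  infix  4 _≤_
  infixl 6 _+_
  infixl 7 _*_
  infix  8 -_
  infixl 9 _⁻¹
  field
    ℝ     : Set
    _+_   : ℝ → ℝ → ℝ
    _*_   : ℝ → ℝ → ℝ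
    -_    : ℝ → ℝ
    0#    : ℝ
    1#    : ℝ
    _⁻¹   : ℝ → ℝ
    _≤_   : ℝ → ℝ → Set
    isCommutativeRing : IsCommutativeRing _≡_ _+_ _*_ -_ 0# 1#
    isDecTotalOrder   : IsDecTotalOrder _≡_ _≤_
    0≢1       : 0# ≢ 1#
    *-inverse : ∀ {x} → x ≢ 0# → x * x ⁻¹ ≡ 1#
    +-mono-≤  : ∀ {x y} z → x ≤ y → x + z ≤ y + z
    *-nonneg  : ∀ {x y} → 0# ≤ x → 0# ≤ y → 0# ≤ x * y
    complete  : (P : ℝ → Set) → ∃ P → (∃ λ b → ∀ x → P x → x ≤ b) →
                ∃ λ s → (∀ x → P x → x ≤ s) ×
                        (∀ b → (∀ x → P x → x ≤ b) → s ≤ b)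

  commutativeRing : CommutativeRing _ _
  commutativeRing = record { isCommutativeRing = isCommutativeRing }

  totalOrder : TotalOrder _ _ _
  totalOrder = record
    { isTotalOrder = IsDecTotalOrder.isTotalOrder isDecTotalOrder }

  open CommutativeRing commutativeRing public using (_-_; semiring)
  open IsDecTotalOrder isDecTotalOrder public using (_≟_; _≤?_)
  open NonStrictToStrict _≡_ _≤_ public using (_<_; <-decidable)
  open Max totalOrder public using (_⊔_)
  open Exp semiring public using (_^_)
  open Sum semiring public using (sum)
  open Multiple (CommutativeRing.+-rawMonoid commutativeRing) public
    using () renaming (_×_ to _·_)

  infix  4 _<?_
  infixl 7 _/_

  _<?_ : ∀ x y → Dec (x < y)
  _<?_ = <-decidable _≟_ _≤?_

  _/_ : ℝ → ℝ → ℝ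
  x / y = x * y ⁻¹

  abs : ℝ → ℝ
  abs x = x ⊔ (- x)

  ι : ℕ → ℝ
  ι n = n · 1#

  _⟶_ : (ℕ → ℝ) → ℝ → Set
  a ⟶ l = ∀ δ → 0# < δ → ∃ λ N → ∀ m → N ℕ.≤ m → abs (a m - l) < δ

  IsExp : ℝ → ℝ → Set
  IsExp x z = (λ m → sum {m} λ k → x ^ toℕ k / ι (toℕ k !)) ⟶ z

  IsLn : ℝ → ℝ → Set
  IsLn x l = IsExp l x

  IsSqrt : ℝ → ℝ → Set
  IsSqrt x s = 0# ≤ s × s * s ≡ x

  IsCeiling : ℝ → ℕ → Set
  IsCeiling x c = x ≤ ι c × ι c < x + 1#

  infix 5 _when_

  _when_ : ∀ {P : Set} → ℝ → Dec P → ℝ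
  x when P? = if does P? then x else 0#

  sumOver : ∀ {n} → Subset n → (Fin n → ℝ) → ℝ
  sumOver A f = sum λ a → f a when (a ∈? A)

  sumPairs : ∀ {n} → (Fin n → Fin n → ℝ) → ℝ
  sumPairs f = sum λ u → sum λ v → f u v when (u Fin.<? v)

  sumSubsets : ∀ {n} → (Subset n → ℝ) → ℝ
  sumSubsets {zero}  f = f []
  sumSubsets {suc n} f =
    sumSubsets (λ A → f (inside ∷ A)) + sumSubsets (λ A → f (outside ∷ A))

module CorrelationClustering (𝓡 : CompleteOrderedField) where
  open CompleteOrderedField 𝓡

  -- positive u v is irrelevant when u ≡ v: E⁺ and E⁻ below are restricted to
  -- u ≢ v.
  record Instance : Set where
    field
      n            : ℕ
      2≤n          : 2 ℕ.≤ n
      positive     : Fin n → Fin n → Bool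
      positive-sym : ∀ u v → positive u v ≡ positive v u
      w            : Fin n → Fin n → ℝ
      w-sym        : ∀ u v → w u v ≡ w v u
      w-nonneg     : ∀ u v → 0# ≤ w u v
      w-diag       : ∀ u → w u u ≡ 0#
      w-triangle   : ∀ u v a → w u v ≤ w u a + w a v

    E⁺ E⁻ : Fin n → Fin n → Set
    E⁺ u v = u ≢ v × positive u v ≡ true
    E⁻ u v = u ≢ v × positive u v ≡ false

    E⁺? : ∀ u v → Dec (E⁺ u v)
    E⁺? u v = ¬? (u Fin.≟ v) ×-dec (positive u v Bool.≟ true)

    E⁻? : ∀ u v → Dec (E⁻ u v)
    E⁻? u v = ¬? (u Fin.≟ v) ×-dec (positive u v Bool.≟ false)

    W W⁺ : Subset n → Subset n → ℝ
    W  A B = sumOver A λ a → sumOver B λ b → w a b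
    W⁺ A B = sumOver A λ a → sumOver B λ b → w a b when E⁺? a b

    N⁺ : Fin n → Subset n
    N⁺ u = tabulate λ v → does (E⁺? u v)

  -- A partition as its quotient map onto an index set of parts; part-onto
  -- makes every part nonempty and chooses a representative of each.
  record Clustering (n : ℕ) : Set where
    field
      parts     : ℕ
      part      : Fin n → Fin parts
      part-onto : StrictlySurjective _≡_ part

    block : Fin parts → Subset n
    block p = tabulate λ u → does (part u Fin.≟ p)

    rep : Fin parts → Fin n
    rep p = proj₁ (part-onto p)

  module _ (I : Instance) where
    open Instance I

    obj : Clustering n → ℝ
    obj 𝒞 =
      sumPairs (λ u v → w u v when (E⁺? u v ×-dec ¬? (part u Fin.≟ part v)))
      + sumPairs (λ u v → w u v when (E⁻? u v ×-dec (part u Fin.≟ part v)))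
      where open Clustering 𝒞

    IsOPT : ℝ → Set
    IsOPT opt = (∃ λ 𝒞 → obj 𝒞 ≡ opt) × (∀ 𝒞 → opt ≤ obj 𝒞)

    module Atoms (β : ℝ) (𝒞⁰ : Clustering n) where
      open Clustering 𝒞⁰

      _△_ : Subset n → Subset n → Subset n
      A △ B = (A ─ B) ∪ (B ─ A)

      d : Fin parts → Fin n → ℝ
      d p u = W ⁅ u ⁆ (N⁺ u △ block p)

      M : Fin parts → Subset n
      M p = tabulate λ u →
        does ((u ∈? block p) ×-dec (β / ι 2 * W ⁅ u ⁆ (block p) <? d p u))

      Split : Fin parts → Set
      Split p = β * β / ι 20 * W (block p) (block p) < sumOver (M p) (d p)

      Kept : Fin n → Set
      Kept u = ¬ Split (part u) × ¬ (u ∈ M (part u))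

    -- Every vertex that is not kept is a singleton atom; the kept vertices of
    -- each C ∈ 𝒞⁰ form one atom, namely C ∖ M_C.
    IsAtomPartition : ℝ → Clustering n → Clustering n → Set
    IsAtomPartition β 𝒞⁰ 𝒦 = ∀ u v →
      Clustering.part 𝒦 u ≡ Clustering.part 𝒦 v ⇔
      (u ≡ v ⊎ (Clustering.part 𝒞⁰ u ≡ Clustering.part 𝒞⁰ v × Kept u × Kept v))
      where open Atoms β 𝒞⁰

  IsAtomConstant : ℝ → ℝ → Set
  IsAtomConstant β α =
    ∀ (I : Instance) (𝒞⁰ 𝒦 : Clustering (Instance.n I)) (opt : ℝ) →
    IsOPT I opt → obj I 𝒞⁰ ≤ ι 20 / ι 3 * opt → IsAtomPartition I β 𝒞⁰ 𝒦 →
    obj I 𝒦 ≤ α * opt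

  t₀ : ℕ
  t₀ = 297

  R : ℝ → ℝ → ℝ
  R α ε = (1# ⊔ α) ⊔ (ι 128 * α * (ι 2 * α / ε) ^ (2 ℕ.* t₀ ℕ.+ 1))

  module Admissible (I : Instance) (𝒦 : Clustering (Instance.n I)) where
    open Instance I
    open Clustering 𝒦

    d : Fin parts → ℝ
    d K = sum λ L → W⁺ (block K) (block L) when ¬? (L Fin.≟ K)

    InK₊? : ∀ K → Dec (0# < d K)
    InK₊? K = 0# <? d K

    Matrix : Set
    Matrix = Fin parts → Fin parts → ℝ

    infixl 7 _⊗_

    -- Matrices over 𝒦₊: products sum over 𝒦₊ only, so that entries with an
    -- index outside 𝒦₊ are never used.
    _⊗_ : Matrix → Matrix → Matrix
    (A ⊗ B) K L = sum λ J → A K J * B J L when InK₊? J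

    𝕀 : Matrix
    𝕀 K L = 1# when (K Fin.≟ L)

    diag : (Fin parts → ℝ) → Matrix
    diag f K L = f K when (K Fin.≟ L)

    _ᵀ : Matrix → Matrix
    (A ᵀ) K L = A L K

    power : Matrix → ℕ → Matrix
    power A zero    = 𝕀
    power A (suc t) = A ⊗ power A t

    P : Matrix
    P K L = W⁺ (block K) (block L) / d K when ¬? (K Fin.≟ L)

    Q : ℕ → Matrix
    Q t = P ⊗ power (λ K L → (𝕀 K L + P K L) / ι 2) t

    Γ : ℕ → Matrix
    Γ t K L =
      (diag d ⊗ Q t ⊗ diag (λ J → d J ⁻¹) ⊗ (Q t) ᵀ ⊗ diag d) K L
        when (InK₊? K ×-dec InK₊? L)

    Adm : (α ε : ℝ) → Fin n → Fin n → Set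
    Adm α ε u v =
      part u ≢ part v ×
      W (block (part u)) (block (part v)) <
        ι 64 * (τ ^ (2 ℕ.* t₀ ℕ.+ 1)) ⁻¹ * Γ t₀ (part u) (part v)
      where
      τ : ℝ
      τ = ε / (ι 2 * α)

  size : ∀ {n} → Fin n → ℕ
  size s = suc (toℕ s)

  -- y s S stands for the LP variable with cluster size  size s ∈ {1,…,n}.
  -- Values at sets S with ∣ S ∣ > r are unconstrained and never used.
  LPVars : ℕ → Set
  LPVars n = Fin n → Subset n → ℝ

  total : ∀ {n} → LPVars n → Subset n → ℝ
  total y S = sum λ s → y s S

  module LP (I : Instance) (𝒦 : Clustering (Instance.n I))
            (α ε : ℝ) (r : ℕ) where
    open Instance I
    open Clustering 𝒦
    open Admissible I 𝒦 using (Adm)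

    value : LPVars n → ℝ
    value y =
      sumPairs (λ u v → w u v * (1# - total y (⁅ u ⁆ ∪ ⁅ v ⁆)) when E⁺? u v)
      + sumPairs (λ u v → w u v * total y (⁅ u ⁆ ∪ ⁅ v ⁆) when E⁻? u v)

    alternating : LPVars n → Fin n → Subset n → Subset n → ℝ
    alternating y s S T =
      sumSubsets λ T′ → (- 1#) ^ ∣ T′ ∣ * y s (S ∪ T′) when (T′ ⊆? T)

    record Feasible (y : LPVars n) : Set where
      field
        singleton : ∀ u → total y ⁅ u ⁆ ≡ 1#
        size-s    : ∀ s S → suc ∣ S ∣ ℕ.≤ r →
                    1# / ι (size s) * sum (λ u → y s (S ∪ ⁅ u ⁆)) ≡ y s S
        nonneg    : ∀ s S → ∣ S ∣ ℕ.≤ r → 0# ≤ y s S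
        together  : ∀ u v → u ≢ v → part u ≡ part v →
                    total y (⁅ u ⁆ ∪ ⁅ v ⁆) ≡ 1#
        apart     : ∀ u v → part u ≢ part v → ¬ Adm α ε u v →
                    total y (⁅ u ⁆ ∪ ⁅ v ⁆) ≡ 0#
        sieve     : ∀ s S T → Empty (S ∩ T) → ∣ S ∪ T ∣ ℕ.≤ r →
                    0# ≤ alternating y s S T × alternating y s S T ≤ y s S

    IsOptimal : LPVars n → Set
    IsOptimal y = Feasible y × (∀ y′ → Feasible y′ → value y ≤ value y′)

  -- Randomised procedures: `draw k p f` continues with f i with probability
  -- p i.  Where the procedure below divides by zero, the branch concerned is
  -- reached with probability zero.
  data Random (A : Set) : Set where
    return : A → Random A
    draw   : (k : ℕ) → (Fin k → ℝ) → (Fin k → Random A) → Random A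

  infixl 1 _>>=_

  _>>=_ : ∀ {A B : Set} → Random A → (A → Random B) → Random B
  return a   >>= g = g a
  draw k p f >>= g = draw k p λ i → f i >>= g

  ℙ : ∀ {A : Set} {E : A → Set} → (∀ a → Dec (E a)) → Random A → ℝ
  ℙ E? (return a)   = 1# when E? a
  ℙ E? (draw k p f) = sum λ i → p i * ℙ E? (f i)

  coin : ℝ → Random Bool
  coin p = draw 2 (λ { zero → p ; (suc _) → 1# - p })
                  (λ { zero → return true ; (suc _) → return false })

  independentCoins : ∀ k → (Fin k → ℝ) → Random (Subset k)
  independentCoins zero    p = return []
  independentCoins (suc k) p =
    coin (p zero) >>= λ b →
    independentCoins k (λ i → p (suc i)) >>= λ bs →
    return (b ∷ bs)

  module Sampling {n : ℕ} (𝒦 : Clustering n) (y : LPVars n) where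
    open Clustering 𝒦

    grow : Fin n → ℕ → Subset n → Random (Subset n)
    grow s zero    U = return U
    grow s (suc t) U =
      draw n (λ u → y s (U ∪ ⁅ u ⁆) / (ι (size s) * y s U))
             (λ u → grow s t (U ∪ ⁅ u ⁆))

    includeAtoms : Fin n → Subset n → Random (Subset n)
    includeAtoms s U =
      independentCoins parts (λ K → y s (U ∪ ⁅ rep K ⁆) / y s U) >>= λ B →
      return (tabulate λ u → lookup B (part u))

    sampleOneCluster : ℕ → Random (Subset n)
    sampleOneCluster r =
      draw n (λ s → y s ⊥ / total y ⊥) λ s →
      draw (r ℕ.∸ 2) (λ _ → 1# / ι (r ℕ.∸ 2)) λ i →
      grow s (suc (toℕ i)) ⊥ >>= λ U →
      includeAtoms s U

{-# OPTIONS --safe #-}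

-- For a cluster size s and a set U of pivots, the numbers y (U ∪ S) / y U behave like the
-- conditional probabilities that S ⊆ C given U ⊆ C.  Multiplying everything by y U avoids
-- conditioning: adding a random pivot becomes the linear operator
-- f ↦ (U ↦ (1/s) Σₓ f (U ∪ {x})), which fixes y.  The error at a pair uv is then at most
-- the mean, over the final pivot set U, of the covariance of u and v given U.
--
-- Let x be the first pivot.  The triangle inequality w u v ≤ w u x + w x v charges the
-- covariances to single vertices u, with weight w u x; if ux is not admissible, then u is
-- in C with probability 0 or 1 given x, so its covariances vanish, and the total weight
-- left is that of the admissible pairs, at most R OPT (the entries of Γ sum to at most
-- Σ d(K), as Q fixes 𝟏 and Qᵀ fixes d).
--
-- Adding a pivot v raises the expected second moment of the conditional probability of u
-- by the v-average of (p′ - p)², where p′ and p are the probabilities of u given U ∪ {v}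
-- and given U.  These increments telescope to at most 1/4 over all rounds, so over a
-- random round they are small, and |p′ - p| ≤ θ (p′ - p)² + 1/(4θ) with θ = R/ε bounds
-- the covariances.  Using variances in place of entropies, only ln 2 ≥ 1/4 is needed.
module Submission where

open import Defs
open import Algebra.Bundles using (CommutativeRing)
open import Algebra.Solver.Ring.AlmostCommutativeRing
  using (AlmostCommutativeRing; fromCommutativeRing; _-Raw-AlmostCommutative⟶_)
open import Data.Bool.Base using (Bool; true; false; if_then_else_; _∧_)
open import Data.Fin.Base as Fin using (Fin; zero; suc; toℕ; fromℕ<)
import Data.Fin.Properties as Fin
open import Data.Fin.Subset
  using (Subset; inside; outside; ⊥; ⁅_⁆; _∪_; _∩_; _∈_; _∉_; _⊆_; ∣_∣; Empty)
open import Data.Fin.Subset.Properties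
  using (_∈?_; _⊆?_; ⊆-refl; ⊆-antisym; p⊆p∪q; q⊆p∪q; x∈p∪q⁺; x∈p∪q⁻; x∈p∩q⁻; x∈⁅x⁆;
         x∈⁅y⁆⇒x≡y; x≢y⇒x∉⁅y⁆; ∉⊥; ∣⊥∣≡0; ∣⁅x⁆∣≡1; p⊆q⇒∣p∣≤∣q∣; s⊆s; out⊆; drop-∷-⊆;
         ∪-assoc; ∪-comm; ∪-identityˡ; ∪-identityʳ)
open import Data.Integer.Base as ℤ using (ℤ; -[1+_])
import Data.Integer.Properties as ℤ
import Data.Maybe.Base as Maybe
open import Data.Nat.Base as ℕ using (ℕ; zero; suc; _!)
import Data.Nat.Properties as ℕ
open import Data.Product.Base using (_×_; _,_; proj₁; proj₂)
open import Data.Sum.Base using (inj₁; inj₂; [_,_])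
open import Data.Vec.Base using ([]; _∷_; tabulate; lookup; here; there)
open import Data.Vec.Properties using (lookup∘tabulate)
open import Function.Base using (_∘_)
open import Relation.Binary.Bundles using (Poset)
open import Relation.Binary.Definitions using (tri<; tri≈; tri>)
open import Relation.Binary.PropositionalEquality
  using (_≡_; _≢_; refl; sym; trans; cong; cong₂; subst; ≢-sym; module ≡-Reasoning)
open import Relation.Binary.Structures using (IsDecTotalOrder)
open import Relation.Nullary using (¬_; Dec; yes; no; does; contradiction; ¬?; _×-dec_)
open import Relation.Nullary.Decidable using (dec-true; dec-false; dec⇒maybe)
import Algebra.Construct.NaturalChoice.Max as Max
import Algebra.Properties.Ring as RingProperties
import Algebra.Properties.Semiring.Mult as Mult
import Algebra.Properties.Semiring.Sum as Sum
import Algebra.Solver.Ring as RingSolver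
import Relation.Binary.Reasoning.PartialOrder as PartialOrderReasoning


-- The covariance of `u` and `v` is read as the effect on `u` of pivoting on `v`. What can be
-- bounded is therefore its mean over `v`, taken as the next pivot, and not its value at a single
-- pair. The weight of the pair has to be detached from `v`, and the triangle inequality can do this
-- only once some pivot `x` is known; hence one round is set aside in advance. The factor `1/s` of
-- that round is spent on the mean over `v`; the sum over `x` stays bare and is normalised at the
-- end by the constraint that the totals of singletons are one.
--
-- The size bound `r = 2 + c` is used up exactly: at most `c` pivots, and room for `u` and `v`. A
-- run with `1, ..., c` pivots has `0, ..., c - 1` of them after the first, and these are the `c`
-- terms of the telescoping sum.
--
-- The charged weight is at most `R OPT`, so the mean error per unit of weight may be `ε/R`. The
-- squares cost `θ/4` in all and the remainders `η = 1/(4θ)` in each of the `c` rounds. With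
-- `θ = R/ε` this fits as soon as `θ² ≤ 2c`, which `c ≥ 2 ln 2 θ²` gives from `ln 2 ≥ 1/4`.

-- Ordered-field arithmetic and finite sums

module RealArithmetic (𝓡 : CompleteOrderedField) where
  open CompleteOrderedField 𝓡
  open CommutativeRing commutativeRing public
    using (ring; +-assoc; +-comm; +-identityˡ; +-identityʳ; -‿inverseʳ; -‿inverseˡ;
           *-assoc; *-comm; *-identityˡ; *-identityʳ; zeroˡ; zeroʳ; distribˡ; distribʳ)
  open RingProperties ring public using (-‿distribˡ-*; -‿involutive; -0#≈0#; -‿+-comm; -1*x≈-x)
  open Mult semiring public using (×-homo-+; ×1-homo-*)
  open Sum semiring public
    using (sum-cong-≗; ∑-distrib-+; ∑-comm; *-distribˡ-sum; *-distribʳ-sum;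
           sum-replicate-zero)

  -- The ring solver gets integer coefficients because their equality computes, unlike that of the
  -- abstract field. `con (ℤ.+ k)` evaluates to `ι k`; in particular `con (ℤ.+ 1)` is `1# + 0#`,
  -- hence the conversions by `ι1≡1`.
  fromℤ : ℤ → ℝ
  fromℤ (ℤ.+ n)  = ι n
  fromℤ -[1+ n ] = - ι (suc n)

  fromℤ-⊖ : ∀ m n → fromℤ (m ℤ.⊖ n) ≡ ι m - ι n
  fromℤ-⊖ m       zero    = sym (trans (cong (ι m +_) -0#≈0#) (+-identityʳ (ι m)))
  fromℤ-⊖ zero    (suc n) = sym (+-identityˡ _)
  fromℤ-⊖ (suc m) (suc n) = begin
    fromℤ (suc m ℤ.⊖ suc n)          ≡⟨ cong fromℤ (ℤ.[1+m]⊖[1+n]≡m⊖n m n) ⟩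
    fromℤ (m ℤ.⊖ n)                  ≡⟨ fromℤ-⊖ m n ⟩
    ι m - ι n                        ≡⟨ cong (_- ι n) (+-identityˡ (ι m)) ⟨
    0# + ι m - ι n                   ≡⟨ cong (λ z → z + ι m - ι n) (-‿inverseʳ 1#) ⟨
    1# - 1# + ι m - ι n              ≡⟨ cong (_- ι n) (+-assoc 1# (- 1#) (ι m)) ⟩
    1# + (- 1# + ι m) - ι n          ≡⟨ cong (λ z → 1# + z - ι n) (+-comm (- 1#) (ι m)) ⟩
    1# + (ι m - 1#) - ι n            ≡⟨ cong (_- ι n) (+-assoc 1# (ι m) (- 1#)) ⟨
    1# + ι m - 1# - ι n              ≡⟨ +-assoc (1# + ι m) (- 1#) (- ι n) ⟩
    1# + ι m + (- 1# - ι n)          ≡⟨ cong (1# + ι m +_) (-‿+-comm 1# (ι n)) ⟩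
    ι (suc m) - ι (suc n)            ∎
    where open ≡-Reasoning

  fromℤ-+ : ∀ i j → fromℤ (i ℤ.+ j) ≡ fromℤ i + fromℤ j
  fromℤ-+ (ℤ.+ m)  (ℤ.+ n)  = ×-homo-+ 1# m n
  fromℤ-+ (ℤ.+ m)  -[1+ n ] = fromℤ-⊖ m (suc n)
  fromℤ-+ -[1+ m ] (ℤ.+ n)  = trans (fromℤ-⊖ n (suc m)) (+-comm _ _)
  fromℤ-+ -[1+ m ] -[1+ n ] = begin
    - ι (suc (suc (m ℕ.+ n)))    ≡⟨ cong (λ k → - ι (suc k)) (ℕ.+-suc m n) ⟨
    - ι (suc m ℕ.+ suc n)        ≡⟨ cong -_ (×-homo-+ 1# (suc m) (suc n)) ⟩
    - (ι (suc m) + ι (suc n))    ≡⟨ -‿+-comm _ _ ⟨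
    - ι (suc m) - ι (suc n)      ∎
    where open ≡-Reasoning

  fromℤ-neg : ∀ i → fromℤ (ℤ.- i) ≡ - fromℤ i
  fromℤ-neg (ℤ.+ zero)  = sym -0#≈0#
  fromℤ-neg (ℤ.+ suc n) = refl
  fromℤ-neg -[1+ n ]    = sym (-‿involutive _)

  fromℤ-*-pos : ∀ m j → fromℤ ((ℤ.+ m) ℤ.* j) ≡ ι m * fromℤ j
  fromℤ-*-pos m (ℤ.+ n)  = trans (cong fromℤ (sym (ℤ.pos-* m n))) (×1-homo-* m n)
  fromℤ-*-pos m -[1+ n ] = begin
    fromℤ (ℤ.+ m ℤ.* -[1+ n ])           ≡⟨ cong fromℤ (ℤ.neg-distribʳ-* (ℤ.+ m) (ℤ.+ suc n)) ⟨
    fromℤ (ℤ.- (ℤ.+ m ℤ.* ℤ.+ suc n))    ≡⟨ fromℤ-neg (ℤ.+ m ℤ.* ℤ.+ suc n) ⟩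
    - fromℤ (ℤ.+ m ℤ.* ℤ.+ suc n)        ≡⟨ cong -_ (fromℤ-*-pos m (ℤ.+ suc n)) ⟩
    - (ι m * ι (suc n))                  ≡⟨ cong -_ (*-comm _ _) ⟩
    - (ι (suc n) * ι m)                  ≡⟨ -‿distribˡ-* _ _ ⟩
    - ι (suc n) * ι m                    ≡⟨ *-comm _ _ ⟩
    ι m * - ι (suc n)                    ∎
    where open ≡-Reasoning

  fromℤ-* : ∀ i j → fromℤ (i ℤ.* j) ≡ fromℤ i * fromℤ j
  fromℤ-* (ℤ.+ m)  j = fromℤ-*-pos m j
  fromℤ-* -[1+ m ] j = begin
    fromℤ (-[1+ m ] ℤ.* j)           ≡⟨ cong fromℤ (ℤ.neg-distribˡ-* (ℤ.+ suc m) j) ⟨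
    fromℤ (ℤ.- (ℤ.+ suc m ℤ.* j))    ≡⟨ fromℤ-neg (ℤ.+ suc m ℤ.* j) ⟩
    - fromℤ (ℤ.+ suc m ℤ.* j)        ≡⟨ cong -_ (fromℤ-*-pos (suc m) j) ⟩
    - (ι (suc m) * fromℤ j)          ≡⟨ -‿distribˡ-* _ _ ⟩
    - ι (suc m) * fromℤ j            ∎
    where open ≡-Reasoning

  private
    almostCommutativeRing : AlmostCommutativeRing _ _
    almostCommutativeRing = fromCommutativeRing commutativeRing

    fromℤ-morphism : ℤ.+-*-rawRing -Raw-AlmostCommutative⟶ almostCommutativeRing
    fromℤ-morphism = record
      { ⟦_⟧ = fromℤ ; +-homo = fromℤ-+ ; *-homo = fromℤ-* ; -‿homo = fromℤ-neg
      ; 0-homo = refl ; 1-homo = +-identityʳ 1# }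

  module Solver = RingSolver ℤ.+-*-rawRing almostCommutativeRing fromℤ-morphism
    (λ i j → Maybe.map (cong fromℤ) (dec⇒maybe (i ℤ.≟ j)))
  open Solver public using (solve; con; _:=_; _:+_; _:*_; _:-_; :-_)

  private
    poset : Poset _ _ _
    poset = record { isPartialOrder = IsDecTotalOrder.isPartialOrder isDecTotalOrder }

  module ≤-Reasoning = PartialOrderReasoning poset
  open IsDecTotalOrder isDecTotalOrder public
    using () renaming (refl to ≤-refl; trans to ≤-trans; antisym to ≤-antisym;
                       total to ≤-total; reflexive to ≤-reflexive)
  open Max totalOrder public using (⊔-lub; x≤x⊔y; x≤y⊔x)

  +-monoʳ : ∀ {x y} z → x ≤ y → z + x ≤ z + y
  +-monoʳ {x} {y} z x≤y = begin
    z + x ≡⟨ +-comm z x ⟩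
    x + z ≤⟨ +-mono-≤ z x≤y ⟩
    y + z ≡⟨ +-comm y z ⟩
    z + y ∎
    where open ≤-Reasoning

  +-mono : ∀ {x y u v} → x ≤ y → u ≤ v → x + u ≤ y + v
  +-mono {u = u} x≤y u≤v = ≤-trans (+-mono-≤ u x≤y) (+-monoʳ _ u≤v)

  +-nonneg : ∀ {x y} → 0# ≤ x → 0# ≤ y → 0# ≤ x + y
  +-nonneg 0≤x 0≤y = ≤-trans (≤-reflexive (sym (+-identityˡ 0#))) (+-mono 0≤x 0≤y)

  x≤y⇒0≤y-x : ∀ {x y} → x ≤ y → 0# ≤ y - x
  x≤y⇒0≤y-x {x} x≤y = ≤-trans (≤-reflexive (sym (-‿inverseʳ x))) (+-mono-≤ (- x) x≤y)

  0≤y-x⇒x≤y : ∀ {x y} → 0# ≤ y - x → x ≤ y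
  0≤y-x⇒x≤y {x} {y} 0≤y-x = begin
    x          ≡⟨ +-identityˡ x ⟨
    0# + x     ≤⟨ +-mono-≤ x 0≤y-x ⟩
    y - x + x  ≡⟨ solve 2 (λ x y → y :- x :+ x := y) refl x y ⟩
    y          ∎
    where open ≤-Reasoning

  neg-mono : ∀ {x y} → x ≤ y → - y ≤ - x
  neg-mono {x} {y} x≤y = 0≤y-x⇒x≤y (≤-trans (x≤y⇒0≤y-x x≤y)
    (≤-reflexive (solve 2 (λ x y → y :- x := :- x :- :- y) refl x y)))

  *-monoˡ : ∀ {x y} z → 0# ≤ z → x ≤ y → z * x ≤ z * y
  *-monoˡ {x} {y} z 0≤z x≤y = 0≤y-x⇒x≤y (≤-trans (*-nonneg 0≤z (x≤y⇒0≤y-x x≤y))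
    (≤-reflexive (solve 3 (λ x y z → z :* (y :- x) := z :* y :- z :* x) refl x y z)))

  *-monoʳ : ∀ {x y} z → 0# ≤ z → x ≤ y → x * z ≤ y * z
  *-monoʳ {x} {y} z 0≤z x≤y = begin
    x * z ≡⟨ *-comm x z ⟩
    z * x ≤⟨ *-monoˡ z 0≤z x≤y ⟩
    z * y ≡⟨ *-comm z y ⟩
    y * z ∎
    where open ≤-Reasoning

  *-mono : ∀ {x y u v} → 0# ≤ x → 0# ≤ u → x ≤ y → u ≤ v → x * u ≤ y * v
  *-mono {x} {y} {u} {v} 0≤x 0≤u x≤y u≤v =
    ≤-trans (*-monoʳ u 0≤u x≤y) (*-monoˡ y (≤-trans 0≤x x≤y) u≤v)

  square-nonneg : ∀ x → 0# ≤ x * x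
  square-nonneg x with ≤-total 0# x
  ... | inj₁ 0≤x = *-nonneg 0≤x 0≤x
  ... | inj₂ x≤0 = ≤-trans (*-nonneg 0≤-x 0≤-x)
                     (≤-reflexive (solve 1 (λ x → :- x :* :- x := x :* x) refl x))
    where
    0≤-x : 0# ≤ - x
    0≤-x = ≤-trans (≤-reflexive (sym -0#≈0#)) (neg-mono x≤0)

  0≤1 : 0# ≤ 1#
  0≤1 = ≤-trans (square-nonneg 1#) (≤-reflexive (*-identityˡ 1#))

  ι-nonneg : ∀ n → 0# ≤ ι n
  ι-nonneg zero    = ≤-refl
  ι-nonneg (suc n) = +-nonneg 0≤1 (ι-nonneg n)

  ι-mono : ∀ {m n} → m ℕ.≤ n → ι m ≤ ι n
  ι-mono {n = n} ℕ.z≤n = ι-nonneg n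
  ι-mono (ℕ.s≤s m≤n)   = +-monoʳ 1# (ι-mono m≤n)

  ι1≡1 : ι 1 ≡ 1#
  ι1≡1 = +-identityʳ 1#

  1≤ι : ∀ n → 1# ≤ ι (suc n)
  1≤ι n = ≤-trans (≤-reflexive (sym ι1≡1)) (ι-mono {1} {suc n} (ℕ.s≤s ℕ.z≤n))

  0<1 : 0# < 1#
  0<1 = 0≤1 , 0≢1

  <-≤-trans : ∀ {x y z} → x < y → y ≤ z → x < z
  <-≤-trans {x} (x≤y , x≢y) y≤z =
    ≤-trans x≤y y≤z , λ x≡z → x≢y (≤-antisym x≤y (subst (_ ≤_) (sym x≡z) y≤z))

  <⇒≱ : ∀ {x y} → x < y → ¬ y ≤ x
  <⇒≱ (x≤y , x≢y) y≤x = x≢y (≤-antisym x≤y y≤x)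

  ≰⇒≥ : ∀ {x y} → ¬ x ≤ y → y ≤ x
  ≰⇒≥ {x} {y} x≰y with ≤-total x y
  ... | inj₁ x≤y = contradiction x≤y x≰y
  ... | inj₂ y≤x = y≤x

  ≰⇒> : ∀ {x y} → ¬ x ≤ y → y < x
  ≰⇒> x≰y = ≰⇒≥ x≰y , λ { refl → x≰y ≤-refl }

  >⇒≢0 : ∀ {x} → 0# < x → x ≢ 0#
  >⇒≢0 (_ , 0≢x) x≡0 = 0≢x (sym x≡0)

  0<ι : ∀ n → 0# < ι (suc n)
  0<ι n = <-≤-trans 0<1 (1≤ι n)

  *-inverseˡ : ∀ {x} → x ≢ 0# → x ⁻¹ * x ≡ 1#
  *-inverseˡ {x} x≢0 = trans (*-comm _ x) (*-inverse x≢0)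

  ⁻¹-nonneg : ∀ {x} → 0# < x → 0# ≤ x ⁻¹
  ⁻¹-nonneg {x} 0<x with ≤-total 0# (x ⁻¹)
  ... | inj₁ 0≤x⁻¹ = 0≤x⁻¹
  ... | inj₂ x⁻¹≤0 = contradiction
    (≤-trans (≤-reflexive (sym (*-inverse (>⇒≢0 0<x))))
      (≤-trans (*-monoˡ x (proj₁ 0<x) x⁻¹≤0) (≤-reflexive (zeroʳ x))))
    (<⇒≱ 0<1)

  *-cancelˡ-≤ : ∀ {x y} z → 0# < z → z * x ≤ z * y → x ≤ y
  *-cancelˡ-≤ {x} {y} z 0<z zx≤zy = begin
    x              ≡⟨ cancel x ⟨
    z ⁻¹ * (z * x) ≤⟨ *-monoˡ (z ⁻¹) (⁻¹-nonneg 0<z) zx≤zy ⟩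
    z ⁻¹ * (z * y) ≡⟨ cancel y ⟩
    y              ∎
    where
    open ≤-Reasoning
    cancel : ∀ x → z ⁻¹ * (z * x) ≡ x
    cancel x = trans (sym (*-assoc (z ⁻¹) z x))
      (trans (cong (_* x) (*-inverseˡ (>⇒≢0 0<z))) (*-identityˡ x))

  *-cancelˡ-≡ : ∀ {x y} z → z ≢ 0# → z * x ≡ z * y → x ≡ y
  *-cancelˡ-≡ {x} {y} z z≢0 zx≡zy = begin
    x              ≡⟨ cancel x ⟨
    z ⁻¹ * (z * x) ≡⟨ cong (z ⁻¹ *_) zx≡zy ⟩
    z ⁻¹ * (z * y) ≡⟨ cancel y ⟩
    y              ∎
    where
    open ≡-Reasoning
    cancel : ∀ x → z ⁻¹ * (z * x) ≡ x
    cancel x = trans (sym (*-assoc (z ⁻¹) z x))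
      (trans (cong (_* x) (*-inverseˡ z≢0)) (*-identityˡ x))

  *-pos : ∀ {x y} → 0# < x → 0# < y → 0# < x * y
  *-pos {x} {y} (0≤x , 0≢x) (0≤y , 0≢y) = *-nonneg 0≤x 0≤y , λ 0≡xy →
    0≢y (*-cancelˡ-≡ x (λ x≡0 → 0≢x (sym x≡0)) (trans (zeroʳ x) 0≡xy))

  ⁻¹-pos : ∀ {x} → 0# < x → 0# < x ⁻¹
  ⁻¹-pos {x} 0<x = ⁻¹-nonneg 0<x , λ 0≡x⁻¹ →
    0≢1 (trans (sym (zeroʳ x)) (trans (cong (x *_) 0≡x⁻¹) (*-inverse (>⇒≢0 0<x))))

  ^-nonneg : ∀ {x} n → 0# ≤ x → 0# ≤ x ^ n
  ^-nonneg zero    0≤x = 0≤1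
  ^-nonneg (suc n) 0≤x = *-nonneg 0≤x (^-nonneg n 0≤x)

  ^-pos : ∀ {x} n → 0# < x → 0# < x ^ n
  ^-pos zero    0<x = 0<1
  ^-pos (suc n) 0<x = *-pos 0<x (^-pos n 0<x)

  1≤^ : ∀ {x} n → 1# ≤ x → 1# ≤ x ^ n
  1≤^ zero    1≤x = ≤-refl
  1≤^ (suc n) 1≤x = ≤-trans (≤-reflexive (sym (*-identityˡ 1#)))
    (*-mono 0≤1 0≤1 1≤x (1≤^ n 1≤x))

  x≤abs : ∀ x → x ≤ abs x
  x≤abs x = x≤x⊔y x (- x)

  -x≤abs : ∀ x → - x ≤ abs x
  -x≤abs x = x≤y⊔x x (- x)

  abs-≤ : ∀ {x b} → x ≤ b → - x ≤ b → abs x ≤ b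
  abs-≤ = ⊔-lub

  abs-nonneg : ∀ x → 0# ≤ abs x
  abs-nonneg x with ≤-total 0# x
  ... | inj₁ 0≤x = ≤-trans 0≤x (x≤abs x)
  ... | inj₂ x≤0 = ≤-trans (≤-reflexive (sym -0#≈0#)) (≤-trans (neg-mono x≤0) (-x≤abs x))

  abs-*-≤ : ∀ {c b} x → 0# ≤ c → abs x ≤ b → abs (c * x) ≤ c * b
  abs-*-≤ {c} x 0≤c ∣x∣≤b = abs-≤
    (*-monoˡ c 0≤c (≤-trans (x≤abs x) ∣x∣≤b))
    (≤-trans (≤-reflexive (solve 2 (λ c x → :- (c :* x) := c :* :- x) refl c x))
      (*-monoˡ c 0≤c (≤-trans (-x≤abs x) ∣x∣≤b)))

  sum-mono : ∀ {n} {f g : Fin n → ℝ} → (∀ i → f i ≤ g i) → sum f ≤ sum g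
  sum-mono {zero}  f≤g = ≤-refl
  sum-mono {suc n} f≤g = +-mono (f≤g zero) (sum-mono (λ i → f≤g (suc i)))

  sum-zero : ∀ {n} {f : Fin n → ℝ} → (∀ i → f i ≡ 0#) → sum f ≡ 0#
  sum-zero {n} f≡0 = trans (sum-cong-≗ f≡0) (sum-replicate-zero n)

  sum-nonneg : ∀ {n} {f : Fin n → ℝ} → (∀ i → 0# ≤ f i) → 0# ≤ sum f
  sum-nonneg {n} 0≤f = ≤-trans (≤-reflexive (sym (sum-replicate-zero n))) (sum-mono 0≤f)

  term≤sum : ∀ {n} {f : Fin n → ℝ} → (∀ i → 0# ≤ f i) → ∀ i → f i ≤ sum f
  term≤sum {f = f} 0≤f zero = ≤-trans (≤-reflexive (sym (+-identityʳ (f zero))))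
    (+-monoʳ (f zero) (sum-nonneg (λ i → 0≤f (suc i))))
  term≤sum {f = f} 0≤f (suc i) = ≤-trans (term≤sum (λ i → 0≤f (suc i)) i)
    (≤-trans (≤-reflexive (sym (+-identityˡ _))) (+-mono-≤ _ (0≤f zero)))

  sum-const : ∀ n x → sum {n} (λ _ → x) ≡ ι n * x
  sum-const zero    x = sym (zeroˡ x)
  sum-const (suc n) x = begin
    x + sum {n} (λ _ → x)  ≡⟨ cong₂ _+_ (sym (*-identityˡ x)) (sum-const n x) ⟩
    1# * x + ι n * x       ≡⟨ distribʳ x 1# (ι n) ⟨
    ι (suc n) * x          ∎
    where open ≡-Reasoning

  sum-neg : ∀ {n} (f : Fin n → ℝ) → sum (λ i → - f i) ≡ - sum f
  sum-neg {zero}  f = sym -0#≈0#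
  sum-neg {suc n} f = trans (cong (- f zero +_) (sum-neg (λ i → f (suc i)))) (-‿+-comm _ _)

  sum-sub : ∀ {n} (f g : Fin n → ℝ) → sum (λ i → f i - g i) ≡ sum f - sum g
  sum-sub f g = trans (∑-distrib-+ f (λ i → - g i)) (cong (sum f +_) (sum-neg g))

  -- Each slack `g i - f i` is nonnegative and at most the total slack, which is zero. This turns
  -- equations between totals over all cluster sizes into equations for each size.
  sum-≡⇒≡ : ∀ {n} {f g : Fin n → ℝ} → (∀ i → f i ≤ g i) → sum f ≡ sum g → ∀ i → f i ≡ g i
  sum-≡⇒≡ {f = f} {g} f≤g Σf≡Σg i = ≤-antisym (f≤g i) (0≤y-x⇒x≤y (begin
    0#                       ≡⟨ -0#≈0# ⟨
    - 0#                     ≡⟨ cong -_ (trans (cong (_- sum f) (sym Σf≡Σg)) (-‿inverseʳ _)) ⟨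
    - (sum g - sum f)        ≡⟨ cong -_ (sum-sub g f) ⟨
    - sum (λ i → g i - f i)  ≤⟨ neg-mono (term≤sum (λ i → x≤y⇒0≤y-x (f≤g i)) i) ⟩
    - (g i - f i)            ≡⟨ solve 2 (λ x y → :- (y :- x) := x :- y) refl (f i) (g i) ⟩
    f i - g i                ∎))
    where open ≤-Reasoning

  abs-sum-≤ : ∀ {n} {f g : Fin n → ℝ} → (∀ i → abs (f i) ≤ g i) → abs (sum f) ≤ sum g
  abs-sum-≤ {f = f} ∣f∣≤g = abs-≤
    (sum-mono (λ i → ≤-trans (x≤abs (f i)) (∣f∣≤g i)))
    (≤-trans (≤-reflexive (sym (sum-neg f)))
      (sum-mono (λ i → ≤-trans (-x≤abs (f i)) (∣f∣≤g i))))

  when-true : ∀ {P : Set} {x} (P? : Dec P) → P → (x when P?) ≡ x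
  when-true {x = x} P? p rewrite dec-true P? p = refl

  when-false : ∀ {P : Set} {x} (P? : Dec P) → ¬ P → (x when P?) ≡ 0#
  when-false {x = x} P? ¬p rewrite dec-false P? ¬p = refl

  when-nonneg : ∀ {P : Set} {x} (P? : Dec P) → (P → 0# ≤ x) → 0# ≤ (x when P?)
  when-nonneg P? 0≤x with P?
  ... | yes p = 0≤x p
  ... | no ¬p = ≤-refl

  when-≤ : ∀ {P : Set} {x y} (P? : Dec P) → (P → x ≤ y) → 0# ≤ y → (x when P?) ≤ y
  when-≤ P? x≤y 0≤y with P?
  ... | yes p = x≤y p
  ... | no ¬p = 0≤y

  sum-when-≡ : ∀ {n} (f : Fin n → ℝ) k → sum (λ i → f i when (k Fin.≟ i)) ≡ f k
  sum-when-≡ {suc n} f zero    = trans (cong (f zero +_) (sum-zero {n} (λ i → refl))) (+-identityʳ _)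
  sum-when-≡ {suc n} f (suc k) = trans (+-identityˡ _)
    (trans (sum-cong-≗ (λ i → lemma i)) (sum-when-≡ (λ i → f (suc i)) k))
    where
    lemma : ∀ i → (f (suc i) when (suc k Fin.≟ suc i)) ≡ (f (suc i) when (k Fin.≟ i))
    lemma i with k Fin.≟ i
    ... | yes _ = refl
    ... | no _  = refl

-- Expectations over random procedures and independent coins

does-∈? : ∀ {n} (u : Fin n) (A : Subset n) → does (u ∈? A) ≡ lookup A u
does-∈? zero    (true  ∷ A) = refl
does-∈? zero    (false ∷ A) = refl
does-∈? (suc u) (_     ∷ A) = does-∈? u A

module Expectation (𝓡 : CompleteOrderedField) where
  open CompleteOrderedField 𝓡
  open CorrelationClustering 𝓡
  open RealArithmetic 𝓡

  private
    variable
      A B : Set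

  -- The weights of a `draw` are arbitrary reals, so this is a weighted sum: linear, but it
  -- preserves constants only where the weights add up to one, as they do for coins.
  𝔼 : (A → ℝ) → Random A → ℝ
  𝔼 f (return a)   = f a
  𝔼 f (draw k p g) = sum λ i → p i * 𝔼 f (g i)

  ℙ≡𝔼 : {E : A → Set} (E? : ∀ a → Dec (E a)) (X : Random A) →
        ℙ E? X ≡ 𝔼 (λ a → 1# when E? a) X
  ℙ≡𝔼 E? (return a)   = refl
  ℙ≡𝔼 E? (draw k p g) = sum-cong-≗ λ i → cong (p i *_) (ℙ≡𝔼 E? (g i))

  𝔼->>= : (f : B → ℝ) (X : Random A) (g : A → Random B) →
          𝔼 f (X >>= g) ≡ 𝔼 (λ a → 𝔼 f (g a)) X
  𝔼->>= f (return a)   g = refl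
  𝔼->>= f (draw k p h) g = sum-cong-≗ λ i → cong (p i *_) (𝔼->>= f (h i) g)

  𝔼-cong : {f g : A → ℝ} → (∀ a → f a ≡ g a) → (X : Random A) → 𝔼 f X ≡ 𝔼 g X
  𝔼-cong f≡g (return a)   = f≡g a
  𝔼-cong f≡g (draw k p h) = sum-cong-≗ λ i → cong (p i *_) (𝔼-cong f≡g (h i))

  𝔼-* : ∀ c (f : A → ℝ) (X : Random A) → 𝔼 (λ a → c * f a) X ≡ c * 𝔼 f X
  𝔼-* c f (return a)   = refl
  𝔼-* c f (draw k p h) = begin
    (sum λ i → p i * 𝔼 (λ a → c * f a) (h i))
      ≡⟨ sum-cong-≗ (λ i → cong (p i *_) (𝔼-* c f (h i))) ⟩
    (sum λ i → p i * (c * 𝔼 f (h i)))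
      ≡⟨ sum-cong-≗ (λ i → solve 3 (λ p c e → p :* (c :* e) := c :* (p :* e)) refl
           (p i) c (𝔼 f (h i))) ⟩
    (sum λ i → c * (p i * 𝔼 f (h i)))
      ≡⟨ *-distribˡ-sum c (λ i → p i * 𝔼 f (h i)) ⟨
    c * (sum λ i → p i * 𝔼 f (h i)) ∎
    where open ≡-Reasoning

  χ : Bool → ℝ
  χ b = if b then 1# else 0#

  χ-∧ : ∀ a b → χ (a ∧ b) ≡ χ a * χ b
  χ-∧ true  b = sym (*-identityˡ _)
  χ-∧ false b = sym (zeroˡ _)

  𝔼-coin : ∀ f p → 𝔼 f (coin p) ≡ p * f true + (1# - p) * f false
  𝔼-coin f p = cong (p * f true +_) (+-identityʳ _)

  𝔼-independentCoins-suc : ∀ k (p : Fin (suc k) → ℝ) f → let ps = λ i → p (suc i) in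
    𝔼 f (independentCoins (suc k) p) ≡
      p zero * 𝔼 (λ B → f (true ∷ B)) (independentCoins k ps)
      + (1# - p zero) * 𝔼 (λ B → f (false ∷ B)) (independentCoins k ps)
  𝔼-independentCoins-suc k p f = begin
    𝔼 f (independentCoins (suc k) p)
      ≡⟨ 𝔼->>= f (coin (p zero)) (λ b → independentCoins k ps >>= λ bs → return (b ∷ bs)) ⟩
    𝔼 (λ b → 𝔼 f (independentCoins k ps >>= λ bs → return (b ∷ bs))) (coin (p zero))
      ≡⟨ 𝔼-cong (λ b → 𝔼->>= f (independentCoins k ps) (λ bs → return (b ∷ bs)))
           (coin (p zero)) ⟩
    𝔼 (λ b → 𝔼 (λ B → f (b ∷ B)) (independentCoins k ps)) (coin (p zero))
      ≡⟨ 𝔼-coin (λ b → 𝔼 (λ B → f (b ∷ B)) (independentCoins k ps)) (p zero) ⟩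
    _ ∎
    where
    open ≡-Reasoning
    ps = λ i → p (suc i)

  -- The two weights `p` and `1# - p` of a coin add up to one for every real `p`, also where `p` is
  -- a quotient by zero.
  𝔼-independentCoins-const : ∀ k (p : Fin k → ℝ) c → 𝔼 (λ _ → c) (independentCoins k p) ≡ c
  𝔼-independentCoins-const zero    p c = refl
  𝔼-independentCoins-const (suc k) p c = begin
    𝔼 (λ _ → c) (independentCoins (suc k) p)
      ≡⟨ 𝔼-independentCoins-suc k p (λ _ → c) ⟩
    p zero * 𝔼 (λ _ → c) X + (1# - p zero) * 𝔼 (λ _ → c) X
      ≡⟨ cong (λ z → p zero * z + (1# - p zero) * z) (𝔼-independentCoins-const k _ c) ⟩
    p zero * c + (1# - p zero) * c
      ≡⟨ distribʳ c (p zero) (1# - p zero) ⟨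
    (p zero + (1# - p zero)) * c
      ≡⟨ cong (_* c) (trans (+-comm _ _) (trans (+-assoc _ _ _)
           (trans (cong (1# +_) (-‿inverseˡ (p zero))) (+-identityʳ 1#)))) ⟩
    1# * c
      ≡⟨ *-identityˡ c ⟩
    c ∎
    where
    open ≡-Reasoning
    X = independentCoins k (λ i → p (suc i))

  𝔼-independentCoins-lookup : ∀ k (p : Fin k → ℝ) K →
    𝔼 (λ B → χ (lookup B K)) (independentCoins k p) ≡ p K
  𝔼-independentCoins-lookup (suc k) p zero = begin
    𝔼 (λ B → χ (lookup B zero)) (independentCoins (suc k) p)
      ≡⟨ 𝔼-independentCoins-suc k p (λ B → χ (lookup B zero)) ⟩
    p zero * 𝔼 (λ _ → 1#) X + (1# - p zero) * 𝔼 (λ _ → 0#) X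
      ≡⟨ cong₂ (λ a b → p zero * a + (1# - p zero) * b)
           (𝔼-independentCoins-const k _ 1#) (𝔼-independentCoins-const k _ 0#) ⟩
    p zero * 1# + (1# - p zero) * 0#
      ≡⟨ cong₂ _+_ (*-identityʳ _) (zeroʳ _) ⟩
    p zero + 0#
      ≡⟨ +-identityʳ _ ⟩
    p zero ∎
    where
    open ≡-Reasoning
    X = independentCoins k (λ i → p (suc i))
  𝔼-independentCoins-lookup (suc k) p (suc K) = begin
    𝔼 (λ B → χ (lookup B (suc K))) (independentCoins (suc k) p)
      ≡⟨ 𝔼-independentCoins-suc k p (λ B → χ (lookup B (suc K))) ⟩
    p zero * 𝔼 (λ B → χ (lookup B K)) X + (1# - p zero) * 𝔼 (λ B → χ (lookup B K)) X
      ≡⟨ distribʳ (𝔼 (λ B → χ (lookup B K)) X) (p zero) (1# - p zero) ⟨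
    (p zero + (1# - p zero)) * 𝔼 (λ B → χ (lookup B K)) X
      ≡⟨ cong₂ _*_ (trans (+-comm _ _) (trans (+-assoc _ _ _)
           (trans (cong (1# +_) (-‿inverseˡ (p zero))) (+-identityʳ 1#))))
           (𝔼-independentCoins-lookup k _ K) ⟩
    1# * p (suc K)
      ≡⟨ *-identityˡ _ ⟩
    p (suc K) ∎
    where
    open ≡-Reasoning
    X = independentCoins k (λ i → p (suc i))

  𝔼-independentCoins-zero-suc : ∀ k (p : Fin (suc k) → ℝ) L →
    𝔼 (λ B → χ (lookup B zero) * χ (lookup B (suc L))) (independentCoins (suc k) p)
      ≡ p zero * p (suc L)
  𝔼-independentCoins-zero-suc k p L = begin
    𝔼 (λ B → χ (lookup B zero) * χ (lookup B (suc L))) (independentCoins (suc k) p)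
      ≡⟨ 𝔼-independentCoins-suc k p _ ⟩
    p zero * 𝔼 (λ B → 1# * χ (lookup B L)) X + (1# - p zero) * 𝔼 (λ B → 0# * χ (lookup B L)) X
      ≡⟨ cong₂ (λ a b → p zero * a + (1# - p zero) * b) (𝔼-* 1# _ X) (𝔼-* 0# _ X) ⟩
    p zero * (1# * e) + (1# - p zero) * (0# * e)
      ≡⟨ cong₂ (λ a b → p zero * a + (1# - p zero) * b)
           (trans (*-identityˡ e) (𝔼-independentCoins-lookup k _ L)) (zeroˡ e) ⟩
    p zero * p (suc L) + (1# - p zero) * 0#
      ≡⟨ cong (p zero * p (suc L) +_) (zeroʳ _) ⟩
    p zero * p (suc L) + 0#
      ≡⟨ +-identityʳ _ ⟩
    p zero * p (suc L) ∎
    where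
    open ≡-Reasoning
    X = independentCoins k (λ i → p (suc i))
    e = 𝔼 (λ B → χ (lookup B L)) X

  -- Induction on the coins: a first coin different from both factors out with total weight one; a
  -- first coin that is one of the two leaves the other among the remaining coins.
  𝔼-independentCoins-lookup₂ : ∀ k (p : Fin k → ℝ) K L → K ≢ L →
    𝔼 (λ B → χ (lookup B K) * χ (lookup B L)) (independentCoins k p) ≡ p K * p L
  𝔼-independentCoins-lookup₂ (suc k) p zero    zero    K≢L = contradiction refl K≢L
  𝔼-independentCoins-lookup₂ (suc k) p zero    (suc L) K≢L = 𝔼-independentCoins-zero-suc k p L
  𝔼-independentCoins-lookup₂ (suc k) p (suc K) zero    K≢L =
    trans (𝔼-cong (λ B → *-comm (χ (lookup B (suc K))) _) (independentCoins (suc k) p))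
      (trans (𝔼-independentCoins-zero-suc k p K) (*-comm _ _))
  𝔼-independentCoins-lookup₂ (suc k) p (suc K) (suc L) K≢L = begin
    𝔼 (λ B → χ (lookup B (suc K)) * χ (lookup B (suc L))) (independentCoins (suc k) p)
      ≡⟨ 𝔼-independentCoins-suc k p _ ⟩
    p zero * e + (1# - p zero) * e
      ≡⟨ distribʳ e (p zero) (1# - p zero) ⟨
    (p zero + (1# - p zero)) * e
      ≡⟨ cong₂ _*_ (trans (+-comm _ _) (trans (+-assoc _ _ _)
           (trans (cong (1# +_) (-‿inverseˡ (p zero))) (+-identityʳ 1#))))
           (𝔼-independentCoins-lookup₂ k _ K L (λ K≡L → K≢L (cong suc K≡L))) ⟩
    1# * (p (suc K) * p (suc L))
      ≡⟨ *-identityˡ _ ⟩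
    p (suc K) * p (suc L) ∎
    where
    open ≡-Reasoning
    e = 𝔼 (λ B → χ (lookup B K) * χ (lookup B L)) (independentCoins k (λ i → p (suc i)))

  module _ {n} (𝒦 : Clustering n) (y : LPVars n) (s : Fin n) (U : Subset n) where
    open Clustering 𝒦
    open Sampling 𝒦 y

    private
      q : Fin parts → ℝ
      q K = y s (U ∪ ⁅ rep K ⁆) / y s U

      together? : ∀ u v (C : Subset n) → Dec _
      together? u v C = (u ∈? C) ×-dec (v ∈? C)

      ℙ-includeAtoms : ∀ u v → 𝔼 (λ C → 1# when together? u v C) (includeAtoms s U) ≡
        𝔼 (λ B → χ (lookup B (part u)) * χ (lookup B (part v))) (independentCoins parts q)
      ℙ-includeAtoms u v = trans
        (𝔼->>= (λ C → 1# when together? u v C) (independentCoins parts q) _)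
        (𝔼-cong (λ B → trans (cong χ (cong₂ _∧_ (∈-atoms u B) (∈-atoms v B))) (χ-∧ _ _))
          (independentCoins parts q))
        where
        ∈-atoms : ∀ u B → does (u ∈? tabulate (λ u → lookup B (part u))) ≡ lookup B (part u)
        ∈-atoms u B = trans (does-∈? u _) (lookup∘tabulate _ u)

    ℙ-includeAtoms-≢ : ∀ u v → part u ≢ part v →
      𝔼 (λ C → 1# when ((u ∈? C) ×-dec (v ∈? C))) (includeAtoms s U) ≡
        y s (U ∪ ⁅ rep (part u) ⁆) / y s U * (y s (U ∪ ⁅ rep (part v) ⁆) / y s U)
    ℙ-includeAtoms-≢ u v pu≢pv = trans (ℙ-includeAtoms u v)
      (𝔼-independentCoins-lookup₂ parts q (part u) (part v) pu≢pv)

    -- One coin decides both vertices, and an indicator is idempotent.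
    ℙ-includeAtoms-≡ : ∀ u v → part u ≡ part v →
      𝔼 (λ C → 1# when ((u ∈? C) ×-dec (v ∈? C))) (includeAtoms s U) ≡
        y s (U ∪ ⁅ rep (part u) ⁆) / y s U
    ℙ-includeAtoms-≡ u v pu≡pv = trans (ℙ-includeAtoms u v) (trans
      (𝔼-cong (λ B → trans (cong (λ K → χ (lookup B (part u)) * χ (lookup B K)) (sym pu≡pv))
        (idem (lookup B (part u)))) (independentCoins parts q))
      (𝔼-independentCoins-lookup parts q (part u)))
      where
      idem : ∀ b → χ b * χ b ≡ χ b
      idem true  = *-identityˡ 1#
      idem false = zeroˡ 0#

-- Cardinalities and inclusions of subsets

∣p∪q∣≤∣p∣+∣q∣ : ∀ {n} (p q : Subset n) → ∣ p ∪ q ∣ ℕ.≤ ∣ p ∣ ℕ.+ ∣ q ∣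
∣p∪q∣≤∣p∣+∣q∣ []            []            = ℕ.z≤n
∣p∪q∣≤∣p∣+∣q∣ (outside ∷ p) (outside ∷ q) = ∣p∪q∣≤∣p∣+∣q∣ p q
∣p∪q∣≤∣p∣+∣q∣ (outside ∷ p) (inside  ∷ q) =
  ℕ.≤-trans (ℕ.s≤s (∣p∪q∣≤∣p∣+∣q∣ p q)) (ℕ.≤-reflexive (sym (ℕ.+-suc ∣ p ∣ ∣ q ∣)))
∣p∪q∣≤∣p∣+∣q∣ (inside  ∷ p) (outside ∷ q) = ℕ.s≤s (∣p∪q∣≤∣p∣+∣q∣ p q)
∣p∪q∣≤∣p∣+∣q∣ (inside  ∷ p) (inside  ∷ q) = ℕ.s≤s
  (ℕ.≤-trans (∣p∪q∣≤∣p∣+∣q∣ p q) (ℕ.+-monoʳ-≤ ∣ p ∣ (ℕ.n≤1+n ∣ q ∣)))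

∣p∪⁅x⁆∣≤1+∣p∣ : ∀ {n} (p : Subset n) x → ∣ p ∪ ⁅ x ⁆ ∣ ℕ.≤ suc ∣ p ∣
∣p∪⁅x⁆∣≤1+∣p∣ p x = ℕ.≤-trans (∣p∪q∣≤∣p∣+∣q∣ p ⁅ x ⁆)
  (ℕ.≤-reflexive (trans (cong (∣ p ∣ ℕ.+_) (∣⁅x⁆∣≡1 x)) (ℕ.+-comm ∣ p ∣ 1)))

x∈p⇒p∪⁅x⁆≡p : ∀ {n} {p : Subset n} {x} → x ∈ p → p ∪ ⁅ x ⁆ ≡ p
x∈p⇒p∪⁅x⁆≡p {p = p} {x} x∈p = ⊆-antisym
  (λ z∈ → [ (λ z∈p → z∈p) , (λ z∈⁅x⁆ → subst (_∈ p) (sym (x∈⁅y⁆⇒x≡y x z∈⁅x⁆)) x∈p) ]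
    (x∈p∪q⁻ p ⁅ x ⁆ z∈))
  (p⊆p∪q ⁅ x ⁆)

∣p∪⁅x⁆∣≡1+∣p∣ : ∀ {n} (p : Subset n) x → x ∉ p → ∣ p ∪ ⁅ x ⁆ ∣ ≡ suc ∣ p ∣
∣p∪⁅x⁆∣≡1+∣p∣ (inside  ∷ p) zero    x∉p = contradiction here x∉p
∣p∪⁅x⁆∣≡1+∣p∣ (outside ∷ p) zero    x∉p = cong (λ q → suc ∣ q ∣) (∪-identityʳ p)
∣p∪⁅x⁆∣≡1+∣p∣ (inside  ∷ p) (suc x) x∉p =
  cong suc (∣p∪⁅x⁆∣≡1+∣p∣ p x (λ x∈p → x∉p (there x∈p)))
∣p∪⁅x⁆∣≡1+∣p∣ (outside ∷ p) (suc x) x∉p = ∣p∪⁅x⁆∣≡1+∣p∣ p x (λ x∈p → x∉p (there x∈p))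

∪-swap : ∀ {n} (p : Subset n) q r → (p ∪ q) ∪ r ≡ (p ∪ r) ∪ q
∪-swap p q r = trans (∪-assoc p q r) (trans (cong (p ∪_) (∪-comm q r)) (sym (∪-assoc p r q)))

∣p∪r∣≤∣q∪r∣ : ∀ {n} (p q r : Subset n) → p ⊆ q → ∣ p ∪ r ∣ ℕ.≤ ∣ q ∪ r ∣
∣p∪r∣≤∣q∪r∣ p q r p⊆q = p⊆q⇒∣p∣≤∣q∣ {p = p ∪ r} {q = q ∪ r}
  (λ x∈ → x∈p∪q⁺ ([ (λ x∈p → inj₁ (p⊆q x∈p)) , inj₂ ] (x∈p∪q⁻ p r x∈)))

∪-least : ∀ {n} {p q r : Subset n} → p ⊆ r → q ⊆ r → p ∪ q ⊆ r
∪-least {p = p} {q} p⊆r q⊆r x∈ = [ (λ x∈p → p⊆r x∈p) , (λ x∈q → q⊆r x∈q) ] (x∈p∪q⁻ p q x∈)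

⁅x⁆⊆p : ∀ {n} {p : Subset n} {x} → x ∈ p → ⁅ x ⁆ ⊆ p
⁅x⁆⊆p {p = p} {x} x∈p z∈ = subst (_∈ p) (sym (x∈⁅y⁆⇒x≡y x z∈)) x∈p

-- Monotone set functions and alternating sums over subsets

module SubsetSums (𝓡 : CompleteOrderedField) where
  open CompleteOrderedField 𝓡
  open RealArithmetic 𝓡

  -- Induction on the ground set: a coordinate that belongs to `B` only is removed from `B` by one
  -- step, after which the two heads agree. The down-closed `D` carries the size bound, beyond which
  -- the LP says nothing.
  antitone-from-steps : ∀ {n} (D : Subset n → Set) (f : Subset n → ℝ) →
    (∀ {A B} → A ⊆ B → D B → D A) →
    (∀ S x → D (S ∪ ⁅ x ⁆) → f (S ∪ ⁅ x ⁆) ≤ f S) →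
    ∀ {A B} → A ⊆ B → D B → f B ≤ f A
  antitone-from-steps {zero}  D f down step {[]} {[]} _ _ = ≤-refl
  antitone-from-steps {suc n} D f down step {inside ∷ A} {outside ∷ B} A⊆B _ =
    contradiction (A⊆B here) λ ()
  antitone-from-steps {suc n} D f down step {inside ∷ A} {inside ∷ B} A⊆B =
    antitone-from-steps (λ S → D (inside ∷ S)) (λ S → f (inside ∷ S))
      (λ S⊆T → down (s⊆s S⊆T)) (λ S x → step (inside ∷ S) (suc x)) (drop-∷-⊆ A⊆B)
  antitone-from-steps {suc n} D f down step {outside ∷ A} {outside ∷ B} A⊆B =
    antitone-from-steps (λ S → D (outside ∷ S)) (λ S → f (outside ∷ S))
      (λ S⊆T → down (s⊆s S⊆T)) (λ S x → step (outside ∷ S) (suc x)) (drop-∷-⊆ A⊆B)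
  antitone-from-steps {suc n} D f down step {outside ∷ A} {inside ∷ B} A⊆B DB = ≤-trans
    (subst (λ S → f (inside ∷ S) ≤ f (outside ∷ B)) (∪-identityʳ B)
      (step (outside ∷ B) zero (subst (λ S → D (inside ∷ S)) (sym (∪-identityʳ B)) DB)))
    (antitone-from-steps (λ S → D (outside ∷ S)) (λ S → f (outside ∷ S))
      (λ S⊆T → down (s⊆s S⊆T)) (λ S x → step (outside ∷ S) (suc x)) (drop-∷-⊆ A⊆B)
      (down (out⊆ ⊆-refl) DB))

  sumSubsets-cong : ∀ {n} {f g : Subset n → ℝ} → (∀ A → f A ≡ g A) → sumSubsets f ≡ sumSubsets g
  sumSubsets-cong {zero}  f≡g = f≡g []
  sumSubsets-cong {suc n} f≡g =
    cong₂ _+_ (sumSubsets-cong (λ A → f≡g (inside ∷ A))) (sumSubsets-cong (λ A → f≡g (outside ∷ A)))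

  sumSubsets-0 : ∀ n → sumSubsets {n} (λ _ → 0#) ≡ 0#
  sumSubsets-0 zero    = refl
  sumSubsets-0 (suc n) = trans (cong₂ _+_ (sumSubsets-0 n) (sumSubsets-0 n)) (+-identityˡ 0#)

  sumSubsets-⊆⊥ : ∀ {n} (f : Subset n → ℝ) → sumSubsets (λ A → f A when (A ⊆? ⊥)) ≡ f ⊥
  sumSubsets-⊆⊥ {zero}  f = refl
  sumSubsets-⊆⊥ {suc n} f =
    trans (cong₂ _+_ (sumSubsets-0 n) (sumSubsets-⊆⊥ (λ A → f (outside ∷ A)))) (+-identityˡ _)

  -- The subsets of `T ∪ ⁅ x ⁆` are split by whether they contain `x`. Sieve sums are expanded one
  -- element at a time in this way.
  sumSubsets-⊆∪ : ∀ {n} (f : Subset n → ℝ) T x → x ∉ T →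
    sumSubsets (λ A → f A when (A ⊆? (T ∪ ⁅ x ⁆))) ≡
      sumSubsets (λ A → f A when (A ⊆? T)) + sumSubsets (λ A → f (A ∪ ⁅ x ⁆) when (A ⊆? T))
  sumSubsets-⊆∪ f (inside ∷ T) zero x∉T = contradiction here x∉T
  sumSubsets-⊆∪ {suc n} f (outside ∷ T) zero x∉T = begin
    sumSubsets (λ A → f (inside ∷ A) when (A ⊆? (T ∪ ⊥)))
      + sumSubsets (λ A → f (outside ∷ A) when (A ⊆? (T ∪ ⊥)))
      ≡⟨ cong (λ T → sumSubsets (λ A → f (inside ∷ A) when (A ⊆? T))
           + sumSubsets (λ A → f (outside ∷ A) when (A ⊆? T))) (∪-identityʳ T) ⟩
    sumSubsets (λ A → f (inside ∷ A) when (A ⊆? T)) + out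
      ≡⟨ cong (_+ out) (sumSubsets-cong (λ A →
           cong (λ S → f (inside ∷ S) when (A ⊆? T)) (sym (∪-identityʳ A)))) ⟩
    into + out
      ≡⟨ solve 2 (λ i o → i :+ o := con (ℤ.+ 0) :+ o :+ (con (ℤ.+ 0) :+ i)) refl into out ⟩
    0# + out + (0# + into)
      ≡⟨ cong (λ z → z + out + (z + into)) (sumSubsets-0 n) ⟨
    sumSubsets {n} (λ _ → 0#) + out + (sumSubsets {n} (λ _ → 0#) + into) ∎
    where
    open ≡-Reasoning
    out  = sumSubsets (λ A → f (outside ∷ A) when (A ⊆? T))
    into = sumSubsets (λ A → f (inside ∷ (A ∪ ⊥)) when (A ⊆? T))
  sumSubsets-⊆∪ {suc n} f (outside ∷ T) (suc x) x∉T = begin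
    Σ0 + sumSubsets (λ A → f (outside ∷ A) when (A ⊆? (T ∪ ⁅ x ⁆)))
      ≡⟨ cong (Σ0 +_) (sumSubsets-⊆∪ (λ A → f (outside ∷ A)) T x (λ x∈T → x∉T (there x∈T))) ⟩
    Σ0 + (p + q)
      ≡⟨ cong (_+ (p + q)) (sumSubsets-0 n) ⟩
    0# + (p + q)
      ≡⟨ solve 2 (λ p q → con (ℤ.+ 0) :+ (p :+ q) := con (ℤ.+ 0) :+ p :+ (con (ℤ.+ 0) :+ q))
           refl p q ⟩
    0# + p + (0# + q)
      ≡⟨ cong (λ z → z + p + (z + q)) (sumSubsets-0 n) ⟨
    Σ0 + p + (Σ0 + q) ∎
    where
    open ≡-Reasoning
    Σ0 = sumSubsets {n} (λ _ → 0#)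
    p = sumSubsets (λ A → f (outside ∷ A) when (A ⊆? T))
    q = sumSubsets (λ A → f (outside ∷ (A ∪ ⁅ x ⁆)) when (A ⊆? T))
  sumSubsets-⊆∪ f (inside ∷ T) (suc x) x∉T = trans
    (cong₂ _+_ (sumSubsets-⊆∪ (λ A → f (inside ∷ A)) T x (λ x∈T → x∉T (there x∈T)))
               (sumSubsets-⊆∪ (λ A → f (outside ∷ A)) T x (λ x∈T → x∉T (there x∈T))))
    (solve 4 (λ a b c d → a :+ b :+ (c :+ d) := a :+ c :+ (b :+ d)) refl _ _ _ _)

  sumSubsets-⊆⁅⁆ : ∀ {n} (f : Subset n → ℝ) x →
    sumSubsets (λ A → f A when (A ⊆? ⁅ x ⁆)) ≡ f ⊥ + f ⁅ x ⁆
  sumSubsets-⊆⁅⁆ f x = begin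
    sumSubsets (λ A → f A when (A ⊆? ⁅ x ⁆))
      ≡⟨ cong (λ T → sumSubsets (λ A → f A when (A ⊆? T))) (∪-identityˡ ⁅ x ⁆) ⟨
    sumSubsets (λ A → f A when (A ⊆? (⊥ ∪ ⁅ x ⁆)))
      ≡⟨ sumSubsets-⊆∪ f ⊥ x ∉⊥ ⟩
    sumSubsets (λ A → f A when (A ⊆? ⊥)) + sumSubsets (λ A → f (A ∪ ⁅ x ⁆) when (A ⊆? ⊥))
      ≡⟨ cong₂ _+_ (sumSubsets-⊆⊥ f) (sumSubsets-⊆⊥ (λ A → f (A ∪ ⁅ x ⁆))) ⟩
    f ⊥ + f (⊥ ∪ ⁅ x ⁆)
      ≡⟨ cong (λ T → f ⊥ + f T) (∪-identityˡ ⁅ x ⁆) ⟩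
    f ⊥ + f ⁅ x ⁆ ∎
    where open ≡-Reasoning

  module _ {n} (f : Subset n → ℝ) (S : Subset n) where

    private
      signed : Subset n → ℝ
      signed T = (- 1#) ^ ∣ T ∣ * f (S ∪ T)

      signed-⊥ : signed ⊥ ≡ f S
      signed-⊥ = trans (cong₂ _*_ (cong ((- 1#) ^_) (∣⊥∣≡0 n)) (cong f (∪-identityʳ S)))
        (*-identityˡ (f S))

      signed-⁅⁆ : ∀ x → signed ⁅ x ⁆ ≡ - f (S ∪ ⁅ x ⁆)
      signed-⁅⁆ x = trans (cong (λ k → (- 1#) ^ k * f (S ∪ ⁅ x ⁆)) (∣⁅x⁆∣≡1 x))
        (trans (cong (λ z → z * f (S ∪ ⁅ x ⁆)) (*-identityʳ (- 1#))) (-1*x≈-x _))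

    alternating-⁅⁆ : ∀ x → sumSubsets (λ T → signed T when (T ⊆? ⁅ x ⁆)) ≡ f S - f (S ∪ ⁅ x ⁆)
    alternating-⁅⁆ x = trans (sumSubsets-⊆⁅⁆ signed x) (cong₂ _+_ signed-⊥ (signed-⁅⁆ x))

    -- A second difference. Its nonnegativity, which is the lower sieve bound for two elements, says
    -- that `f S - f (S ∪ ⁅ v ⁆)` does not increase when `x` joins `S`.
    alternating-pair : ∀ x v → v ≢ x →
      sumSubsets (λ T → signed T when (T ⊆? (⁅ x ⁆ ∪ ⁅ v ⁆))) ≡
        (f S - f (S ∪ ⁅ x ⁆)) + (f ((S ∪ ⁅ x ⁆) ∪ ⁅ v ⁆) - f (S ∪ ⁅ v ⁆))
    alternating-pair x v v≢x = begin
      sumSubsets (λ T → signed T when (T ⊆? (⁅ x ⁆ ∪ ⁅ v ⁆)))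
        ≡⟨ sumSubsets-⊆∪ signed ⁅ x ⁆ v (x≢y⇒x∉⁅y⁆ v≢x) ⟩
      sumSubsets (λ T → signed T when (T ⊆? ⁅ x ⁆))
        + sumSubsets (λ T → signed (T ∪ ⁅ v ⁆) when (T ⊆? ⁅ x ⁆))
        ≡⟨ cong₂ _+_ (alternating-⁅⁆ x) (sumSubsets-⊆⁅⁆ (λ T → signed (T ∪ ⁅ v ⁆)) x) ⟩
      (f S - f (S ∪ ⁅ x ⁆)) + (signed (⊥ ∪ ⁅ v ⁆) + signed (⁅ x ⁆ ∪ ⁅ v ⁆))
        ≡⟨ cong (f S - f (S ∪ ⁅ x ⁆) +_) (trans (cong₂ _+_
             (trans (cong signed (∪-identityˡ ⁅ v ⁆)) (signed-⁅⁆ v)) signed-xv) (+-comm _ _)) ⟩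
      (f S - f (S ∪ ⁅ x ⁆)) + (f ((S ∪ ⁅ x ⁆) ∪ ⁅ v ⁆) - f (S ∪ ⁅ v ⁆)) ∎
      where
      open ≡-Reasoning
      signed-xv : signed (⁅ x ⁆ ∪ ⁅ v ⁆) ≡ f ((S ∪ ⁅ x ⁆) ∪ ⁅ v ⁆)
      signed-xv = begin
        (- 1#) ^ ∣ ⁅ x ⁆ ∪ ⁅ v ⁆ ∣ * f (S ∪ (⁅ x ⁆ ∪ ⁅ v ⁆))
          ≡⟨ cong₂ (λ k T → (- 1#) ^ k * f T)
               (trans (∣p∪⁅x⁆∣≡1+∣p∣ ⁅ x ⁆ v (x≢y⇒x∉⁅y⁆ v≢x)) (cong suc (∣⁅x⁆∣≡1 x)))
               (sym (∪-assoc S ⁅ x ⁆ ⁅ v ⁆)) ⟩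
        (- 1#) * ((- 1#) * 1#) * f ((S ∪ ⁅ x ⁆) ∪ ⁅ v ⁆)
          ≡⟨ cong (_* f ((S ∪ ⁅ x ⁆) ∪ ⁅ v ⁆))
               (trans (cong (- 1# *_) (*-identityʳ _)) (trans (-1*x≈-x _) (-‿involutive 1#))) ⟩
        1# * f ((S ∪ ⁅ x ⁆) ∪ ⁅ v ⁆)
          ≡⟨ *-identityˡ _ ⟩
        f ((S ∪ ⁅ x ⁆) ∪ ⁅ v ⁆) ∎

-- Consequences of LP feasibility for single cluster sizes

module FeasibleSolution (𝓡 : CompleteOrderedField) where
  open CompleteOrderedField 𝓡
  open CorrelationClustering 𝓡
  open RealArithmetic 𝓡
  open SubsetSums 𝓡

  module _ (I : Instance) (𝒦 : Clustering (Instance.n I)) (α ε : ℝ) (r : ℕ)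
           (y : LPVars (Instance.n I)) (feasible : LP.Feasible I 𝒦 α ε r y) (2≤r : 2 ℕ.≤ r) where
    open Instance I
    open Clustering 𝒦
    open Admissible I 𝒦 using (Adm)
    open LP.Feasible feasible

    ∪⁅⁆-≤ : ∀ s S x → ∣ S ∪ ⁅ x ⁆ ∣ ℕ.≤ r → y s (S ∪ ⁅ x ⁆) ≤ y s S
    ∪⁅⁆-≤ s S x ∣Sx∣≤r with x ∈? S
    ... | yes x∈S = ≤-reflexive (cong (y s) (x∈p⇒p∪⁅x⁆≡p x∈S))
    ... | no x∉S  = 0≤y-x⇒x≤y (≤-trans (proj₁ (sieve s S ⁅ x ⁆ disjoint ∣Sx∣≤r))
      (≤-reflexive (alternating-⁅⁆ (y s) S x)))
      where
      disjoint : Empty (S ∩ ⁅ x ⁆)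
      disjoint (z , z∈) with x∈p∩q⁻ S ⁅ x ⁆ z∈
      ... | z∈S , z∈⁅x⁆ = x∉S (subst (_∈ S) (x∈⁅y⁆⇒x≡y x z∈⁅x⁆) z∈S)

    antitone : ∀ s {A B} → A ⊆ B → ∣ B ∣ ℕ.≤ r → y s B ≤ y s A
    antitone s = antitone-from-steps (λ S → ∣ S ∣ ℕ.≤ r) (y s)
      (λ A⊆B ∣B∣≤r → ℕ.≤-trans (p⊆q⇒∣p∣≤∣q∣ A⊆B) ∣B∣≤r) (∪⁅⁆-≤ s)

    -- The unnormalised probability that `S` lies in the cluster and `v` does not.
    gap : Fin n → Fin n → Subset n → ℝ
    gap s v S = y s S - y s (S ∪ ⁅ v ⁆)

    gap-zero : ∀ s v S → v ∈ S → gap s v S ≡ 0#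
    gap-zero s v S v∈S = trans (cong (λ T → y s S - y s T) (x∈p⇒p∪⁅x⁆≡p v∈S)) (-‿inverseʳ _)

    -- The sieve speaks of disjoint sets only, so the cases where `x` or `v` is already present are
    -- settled first: the gap is then unchanged, or it drops to zero. What remains is the
    -- two-element sieve.
    gap-step : ∀ s v S x → ∣ (S ∪ ⁅ x ⁆) ∪ ⁅ v ⁆ ∣ ℕ.≤ r → gap s v (S ∪ ⁅ x ⁆) ≤ gap s v S
    gap-step s v S x ∣Sxv∣≤r with x ∈? S | v ∈? (S ∪ ⁅ x ⁆)
    ... | yes x∈S | _ = ≤-reflexive (cong (gap s v) (x∈p⇒p∪⁅x⁆≡p x∈S))
    ... | no x∉S | yes v∈Sx = ≤-trans (≤-reflexive (gap-zero s v _ v∈Sx))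
      (x≤y⇒0≤y-x (∪⁅⁆-≤ s S v (ℕ.≤-trans (∣p∪r∣≤∣q∪r∣ S (S ∪ ⁅ x ⁆) ⁅ v ⁆ (p⊆p∪q ⁅ x ⁆)) ∣Sxv∣≤r)))
    ... | no x∉S | no v∉Sx = 0≤y-x⇒x≤y (begin
      0#
        ≤⟨ proj₁ (sieve s S (⁅ x ⁆ ∪ ⁅ v ⁆) disjoint
             (subst (λ T → ∣ T ∣ ℕ.≤ r) (∪-assoc S ⁅ x ⁆ ⁅ v ⁆) ∣Sxv∣≤r)) ⟩
      LP.alternating I 𝒦 α ε r y s S (⁅ x ⁆ ∪ ⁅ v ⁆)
        ≡⟨ alternating-pair (y s) S x v (λ { refl → v∉Sx (q⊆p∪q S ⁅ x ⁆ (x∈⁅x⁆ x)) }) ⟩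
      (y s S - y s (S ∪ ⁅ x ⁆)) + (y s ((S ∪ ⁅ x ⁆) ∪ ⁅ v ⁆) - y s (S ∪ ⁅ v ⁆))
        ≡⟨ solve 4 (λ a b c d → (a :- b) :+ (c :- d) := (a :- d) :- (b :- c)) refl _ _ _ _ ⟩
      gap s v S - gap s v (S ∪ ⁅ x ⁆) ∎)
      where
      open ≤-Reasoning
      disjoint : Empty (S ∩ (⁅ x ⁆ ∪ ⁅ v ⁆))
      disjoint (z , z∈) with x∈p∩q⁻ S _ z∈
      ... | z∈S , z∈xv = [
          (λ z∈⁅x⁆ → x∉S (subst (_∈ S) (x∈⁅y⁆⇒x≡y x z∈⁅x⁆) z∈S)) ,
          (λ z∈⁅v⁆ → v∉Sx (p⊆p∪q ⁅ x ⁆ (subst (_∈ S) (x∈⁅y⁆⇒x≡y v z∈⁅v⁆) z∈S))) ]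
        (x∈p∪q⁻ ⁅ x ⁆ ⁅ v ⁆ z∈xv)

    gap-antitone : ∀ s v {A B} → A ⊆ B → ∣ B ∪ ⁅ v ⁆ ∣ ℕ.≤ r → gap s v B ≤ gap s v A
    gap-antitone s v = antitone-from-steps (λ S → ∣ S ∪ ⁅ v ⁆ ∣ ℕ.≤ r) (gap s v)
      (λ {A} {B} A⊆B ∣Bv∣≤r → ℕ.≤-trans (∣p∪r∣≤∣q∪r∣ A B ⁅ v ⁆ A⊆B) ∣Bv∣≤r) (gap-step s v)

    ∣pair∣≤r : ∀ (u v : Fin n) → ∣ ⁅ u ⁆ ∪ ⁅ v ⁆ ∣ ℕ.≤ r
    ∣pair∣≤r u v = ℕ.≤-trans (∣p∪⁅x⁆∣≤1+∣p∣ ⁅ u ⁆ v)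
      (ℕ.≤-trans (ℕ.≤-reflexive (cong suc (∣⁅x⁆∣≡1 u))) 2≤r)

    -- By `together`, the totals of `⁅ u ⁆ ∪ ⁅ v ⁆` and of `⁅ u ⁆` agree, hence so do the terms for
    -- each `s`, as they are ordered the same way. Thus the gap of `v` vanishes at `⁅ u ⁆`, and
    -- being antitone it is at most zero at every `S` containing `u`.
    same-atom : ∀ s {u v S} → part u ≡ part v → u ∈ S → ∣ S ∪ ⁅ v ⁆ ∣ ℕ.≤ r →
                y s (S ∪ ⁅ v ⁆) ≡ y s S
    same-atom s {u} {v} {S} pu≡pv u∈S ∣Sv∣≤r with u Fin.≟ v
    ... | yes refl = cong (y s) (x∈p⇒p∪⁅x⁆≡p u∈S)
    ... | no u≢v   = ≤-antisym (antitone s (p⊆p∪q ⁅ v ⁆) ∣Sv∣≤r) (0≤y-x⇒x≤y (begin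
      0#                                              ≡⟨ -‿inverseʳ (y s (S ∪ ⁅ v ⁆)) ⟨
      y s (S ∪ ⁅ v ⁆) - y s (S ∪ ⁅ v ⁆)               ≤⟨ S∪v-S ⟩
      y s (S ∪ ⁅ v ⁆) - y s S ∎))
      where
      open ≤-Reasoning
      pair≡single : y s (⁅ u ⁆ ∪ ⁅ v ⁆) ≡ y s ⁅ u ⁆
      pair≡single = sum-≡⇒≡ (λ s → antitone s {⁅ u ⁆} {⁅ u ⁆ ∪ ⁅ v ⁆} (p⊆p∪q ⁅ v ⁆) (∣pair∣≤r u v))
        (trans (together u v u≢v pu≡pv) (sym (singleton u))) s
      gap-S≤0 : gap s v S ≤ 0#
      gap-S≤0 = ≤-trans (gap-antitone s v (⁅x⁆⊆p u∈S) ∣Sv∣≤r)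
        (≤-reflexive (trans (cong (λ z → y s ⁅ u ⁆ - z) pair≡single) (-‿inverseʳ _)))
      S∪v-S : y s (S ∪ ⁅ v ⁆) - y s (S ∪ ⁅ v ⁆) ≤ y s (S ∪ ⁅ v ⁆) - y s S
      S∪v-S = ≤-trans (≤-reflexive (trans (-‿inverseʳ _) (sym -0#≈0#))) (≤-trans (neg-mono gap-S≤0)
        (≤-reflexive (solve 2 (λ a b → :- (a :- b) := b :- a) refl _ _)))

    -- Since `S` contains the pair, `y s S` is squeezed between zero and one term of a vanishing sum
    -- of nonnegative terms.
    non-adm-zero : ∀ s {u v S} → part u ≢ part v → ¬ Adm α ε u v →
                   u ∈ S → v ∈ S → ∣ S ∣ ℕ.≤ r → y s S ≡ 0#
    non-adm-zero s {u} {v} pu≢pv ¬adm u∈S v∈S ∣S∣≤r = ≤-antisym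
      (≤-trans (antitone s {⁅ u ⁆ ∪ ⁅ v ⁆} (∪-least (⁅x⁆⊆p u∈S) (⁅x⁆⊆p v∈S)) ∣S∣≤r)
        (≤-trans (term≤sum (λ s → nonneg s (⁅ u ⁆ ∪ ⁅ v ⁆) (∣pair∣≤r u v)) s)
          (≤-reflexive (apart u v pu≢pv ¬adm))))
      (nonneg s _ ∣S∣≤r)

-- The averaging operator of a random pivot

module Averaging (𝓡 : CompleteOrderedField) {n : ℕ}
                 (σ : CompleteOrderedField.ℝ 𝓡)
                 (0≤σ : CompleteOrderedField._≤_ 𝓡 (CompleteOrderedField.0# 𝓡) σ) where
  open CompleteOrderedField 𝓡
  open RealArithmetic 𝓡

  avg : (Subset n → ℝ) → Subset n → ℝ
  avg f U = σ * sum λ x → f (U ∪ ⁅ x ⁆)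

  -- The first of the `t` pivots is the outermost sum; this is what later exposes it for the
  -- triangle inequality.
  avg^ : ℕ → (Subset n → ℝ) → Subset n → ℝ
  avg^ zero    f = f
  avg^ (suc t) f = avg (avg^ t f)

  grown-size : ∀ {U : Subset n} {t b} x → ∣ U ∣ ℕ.+ suc t ℕ.≤ b → ∣ U ∪ ⁅ x ⁆ ∣ ℕ.+ t ℕ.≤ b
  grown-size {U} {t} x ∣U∣+1+t≤b = ℕ.≤-trans (ℕ.+-monoˡ-≤ t (∣p∪⁅x⁆∣≤1+∣p∣ U x))
    (ℕ.≤-trans (ℕ.≤-reflexive (sym (ℕ.+-suc ∣ U ∣ t))) ∣U∣+1+t≤b)

  -- Only the sets reached from `U` matter: they contain `U` and have at most `∣ U ∣ + t` elements.
  -- `A` later remembers the first pivot, and `b` is the size up to which the pointwise estimate is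
  -- available.
  avg^-mono : ∀ {A b} {f g : Subset n → ℝ} → (∀ U → A ⊆ U → ∣ U ∣ ℕ.≤ b → f U ≤ g U) →
              ∀ t U → A ⊆ U → ∣ U ∣ ℕ.+ t ℕ.≤ b → avg^ t f U ≤ avg^ t g U
  avg^-mono f≤g zero    U A⊆U ∣U∣≤b = 
    f≤g U A⊆U (ℕ.≤-trans (ℕ.≤-reflexive (sym (ℕ.+-identityʳ ∣ U ∣))) ∣U∣≤b)
  avg^-mono f≤g (suc t) U A⊆U ∣U∣≤b = *-monoˡ σ 0≤σ (sum-mono λ x →
    avg^-mono f≤g t (U ∪ ⁅ x ⁆) (λ z∈ → p⊆p∪q ⁅ x ⁆ (A⊆U z∈)) (grown-size {U} x ∣U∣≤b))

  avg^-cong : ∀ {f g : Subset n → ℝ} → (∀ U → f U ≡ g U) → ∀ t U → avg^ t f U ≡ avg^ t g U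
  avg^-cong f≡g zero    U = f≡g U
  avg^-cong f≡g (suc t) U = cong (σ *_) (sum-cong-≗ λ x → avg^-cong f≡g t (U ∪ ⁅ x ⁆))

  avg^-fixed : ∀ {b f} → (∀ U → ∣ U ∣ ℕ.< b → avg f U ≡ f U) →
               ∀ t U → ∣ U ∣ ℕ.+ t ℕ.≤ b → avg^ t f U ≡ f U
  avg^-fixed fixed zero    U ∣U∣≤b = refl
  avg^-fixed fixed (suc t) U ∣U∣+1+t≤b =
    trans (cong (σ *_) (sum-cong-≗ λ x →
            avg^-fixed fixed t (U ∪ ⁅ x ⁆) (grown-size {U} x ∣U∣+1+t≤b)))
          (fixed U (ℕ.≤-trans (ℕ.s≤s (ℕ.m≤m+n ∣ U ∣ t))
                   (ℕ.≤-trans (ℕ.≤-reflexive (sym (ℕ.+-suc ∣ U ∣ t))) ∣U∣+1+t≤b)))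

  avg^-0 : ∀ t U → avg^ t (λ _ → 0#) U ≡ 0#
  avg^-0 zero    U = refl
  avg^-0 (suc t) U =
    trans (cong (σ *_) (sum-zero λ x → avg^-0 t (U ∪ ⁅ x ⁆))) (zeroʳ σ)

  avg^-+ : ∀ t (f g : Subset n → ℝ) U → avg^ t (λ U → f U + g U) U ≡ avg^ t f U + avg^ t g U
  avg^-+ zero    f g U = refl
  avg^-+ (suc t) f g U = begin
    (σ * sum λ x → avg^ t (λ U → f U + g U) (U ∪ ⁅ x ⁆))
      ≡⟨ cong (σ *_) (trans (sum-cong-≗ λ x → avg^-+ t f g (U ∪ ⁅ x ⁆))
           (∑-distrib-+ (λ x → avg^ t f (U ∪ ⁅ x ⁆)) (λ x → avg^ t g (U ∪ ⁅ x ⁆)))) ⟩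
    σ * (sum (λ x → avg^ t f (U ∪ ⁅ x ⁆)) + sum (λ x → avg^ t g (U ∪ ⁅ x ⁆)))
      ≡⟨ distribˡ σ _ _ ⟩
    avg^ (suc t) f U + avg^ (suc t) g U ∎
    where open ≡-Reasoning

  avg^-* : ∀ t c (f : Subset n → ℝ) U → avg^ t (λ U → c * f U) U ≡ c * avg^ t f U
  avg^-* zero    c f U = refl
  avg^-* (suc t) c f U = begin
    (σ * sum λ x → avg^ t (λ U → c * f U) (U ∪ ⁅ x ⁆))
      ≡⟨ cong (σ *_) (trans (sum-cong-≗ λ x → avg^-* t c f (U ∪ ⁅ x ⁆))
           (sym (*-distribˡ-sum c (λ x → avg^ t f (U ∪ ⁅ x ⁆))))) ⟩
    σ * (c * sum (λ x → avg^ t f (U ∪ ⁅ x ⁆)))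
      ≡⟨ solve 3 (λ a b c → a :* (b :* c) := b :* (a :* c)) refl σ c _ ⟩
    c * avg^ (suc t) f U ∎
    where open ≡-Reasoning

  avg^-sub : ∀ t (f g : Subset n → ℝ) U → avg^ t (λ U → f U - g U) U ≡ avg^ t f U - avg^ t g U
  avg^-sub t f g U = trans (avg^-+ t f (λ U → - g U) U) (cong (avg^ t f U +_) (begin
    avg^ t (λ U → - g U) U         ≡⟨ avg^-cong (λ U → -1*x≈-x (g U)) t U ⟨
    avg^ t (λ U → - 1# * g U) U    ≡⟨ avg^-* t (- 1#) g U ⟩
    - 1# * avg^ t g U              ≡⟨ -1*x≈-x _ ⟩
    - avg^ t g U                   ∎))
    where open ≡-Reasoning

  avg^-sum : ∀ {k} t (f : Fin k → Subset n → ℝ) U →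
             avg^ t (λ U → sum λ i → f i U) U ≡ sum λ i → avg^ t (f i) U
  avg^-sum {zero}  t f U = avg^-0 t U
  avg^-sum {suc k} t f U = trans (avg^-+ t (f zero) (λ U → sum λ i → f (suc i) U) U)
    (cong (avg^ t (f zero) U +_) (avg^-sum t (λ i → f (suc i)) U))

  avg^-when : ∀ {P : Set} (P? : Dec P) t (f : Subset n → ℝ) U →
              avg^ t (λ U → f U when P?) U ≡ (avg^ t f U when P?)
  avg^-when (yes _) t f U = refl
  avg^-when (no _)  t f U = avg^-0 t U

  avg^-sumPairs : ∀ {k} t (f : Fin k → Fin k → Subset n → ℝ) U →
    avg^ t (λ U → sumPairs λ u v → f u v U) U ≡ sumPairs λ u v → avg^ t (f u v) U
  avg^-sumPairs t f U =
    trans (avg^-sum t (λ u U → sum λ v → f u v U when (u Fin.<? v)) U) (sum-cong-≗ λ u →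
    trans (avg^-sum t (λ v U → f u v U when (u Fin.<? v)) U) (sum-cong-≗ λ v →
    avg^-when (u Fin.<? v) t (f u v) U))

  avg^-abs-≤ : ∀ {A b} {f g h : Subset n → ℝ} →
    (∀ U → A ⊆ U → ∣ U ∣ ℕ.≤ b → abs (f U - g U) ≤ h U) →
    ∀ t U → A ⊆ U → ∣ U ∣ ℕ.+ t ℕ.≤ b → abs (avg^ t f U - avg^ t g U) ≤ avg^ t h U
  avg^-abs-≤ {f = f} {g} {h} bound t U A⊆U ∣U∣+t≤b = abs-≤
    (≤-trans (≤-reflexive (sym (avg^-sub t f g U)))
      (avg^-mono (λ V A⊆V ∣V∣≤b → ≤-trans (x≤abs _) (bound V A⊆V ∣V∣≤b)) t U A⊆U ∣U∣+t≤b))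
    (≤-trans (≤-reflexive (trans (solve 2 (λ a b → :- (a :- b) := b :- a) refl _ _)
        (sym (avg^-sub t g f U))))
      (avg^-mono (λ V A⊆V ∣V∣≤b → ≤-trans
        (≤-trans (≤-reflexive (solve 2 (λ a b → b :- a := :- (a :- b)) refl (f V) (g V)))
          (-x≤abs _)) (bound V A⊆V ∣V∣≤b)) t U A⊆U ∣U∣+t≤b))

  -- The summand of index `i` is `avg^ (i + 1) f - avg^ i f`. As `avg^` unfolds at its first pivot,
  -- the induction splits off `i = 0` and uses the hypothesis at each `U ∪ ⁅ x ⁆` beneath one
  -- average.
  telescope : ∀ m f U →
    (sum {m} λ i → avg^ (toℕ i) (λ V → avg f V - f V) U) ≡ avg^ m f U - f U
  telescope zero    f U = sym (-‿inverseʳ (f U))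
  telescope (suc m) f U = begin
    (avg f U - f U) + (sum {m} λ i → avg^ (suc (toℕ i)) (λ V → avg f V - f V) U)
      ≡⟨ cong (avg f U - f U +_) shifted ⟩
    (avg f U - f U) + (avg^ (suc m) f U - avg f U)
      ≡⟨ solve 3 (λ a b c → (a :- b) :+ (c :- a) := c :- b) refl (avg f U) (f U) _ ⟩
    avg^ (suc m) f U - f U ∎
    where
    open ≡-Reasoning
    g : Subset n → ℝ
    g V = avg f V - f V
    shifted : (sum {m} λ i → avg^ (suc (toℕ i)) g U) ≡ avg^ (suc m) f U - avg f U
    shifted = begin
      (sum {m} λ i → σ * (sum λ x → avg^ (toℕ i) g (U ∪ ⁅ x ⁆)))
        ≡⟨ *-distribˡ-sum {m} σ (λ i → sum λ x → avg^ (toℕ i) g (U ∪ ⁅ x ⁆)) ⟨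
      σ * (sum {m} λ i → sum λ x → avg^ (toℕ i) g (U ∪ ⁅ x ⁆))
        ≡⟨ cong (σ *_) (∑-comm {m} (λ i x → avg^ (toℕ i) g (U ∪ ⁅ x ⁆))) ⟩
      σ * (sum λ x → sum {m} λ i → avg^ (toℕ i) g (U ∪ ⁅ x ⁆))
        ≡⟨ cong (σ *_) (sum-cong-≗ λ x → telescope m f (U ∪ ⁅ x ⁆)) ⟩
      σ * (sum λ x → avg^ m f (U ∪ ⁅ x ⁆) - f (U ∪ ⁅ x ⁆))
        ≡⟨ cong (σ *_) (sum-sub (λ x → avg^ m f (U ∪ ⁅ x ⁆)) (λ x → f (U ∪ ⁅ x ⁆))) ⟩
      σ * (sum (λ x → avg^ m f (U ∪ ⁅ x ⁆)) - sum (λ x → f (U ∪ ⁅ x ⁆)))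
        ≡⟨ solve 3 (λ a b c → a :* (b :- c) := a :* b :- a :* c) refl σ _ _ ⟩
      avg^ (suc m) f U - avg f U ∎

-- Conditional covariances and the growth of second moments

module Conditioning (𝓡 : CompleteOrderedField) {n : ℕ}
                    (σ : CompleteOrderedField.ℝ 𝓡)
                    (0≤σ : CompleteOrderedField._≤_ 𝓡 (CompleteOrderedField.0# 𝓡) σ) where
  open CompleteOrderedField 𝓡
  open RealArithmetic 𝓡
  open Averaging 𝓡 {n} σ 0≤σ

  -- x ≤ θ x² + η is (2θx - 1)² ≥ 0 divided by 4θ.
  am-gm : ∀ {θ η} x → 0# < θ → ι 4 * θ * η ≡ 1# → x ≤ θ * (x * x) + η
  am-gm {θ} {η} x 0<θ 4θη≡1 = 0≤y-x⇒x≤y (*-cancelˡ-≤ (ι 4 * θ) (*-pos (0<ι 3) 0<θ) (begin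
    ι 4 * θ * 0#
      ≡⟨ zeroʳ _ ⟩
    0#
      ≤⟨ square-nonneg (ι 2 * θ * x - 1#) ⟩
    (ι 2 * θ * x - 1#) * (ι 2 * θ * x - 1#)
      ≡⟨ cong (λ o → (ι 2 * θ * x - o) * (ι 2 * θ * x - o)) (sym ι1≡1) ⟩
    (ι 2 * θ * x - ι 1) * (ι 2 * θ * x - ι 1)
      ≡⟨ solve 2 (λ θ x →
           (con (ℤ.+ 2) :* θ :* x :- con (ℤ.+ 1)) :* (con (ℤ.+ 2) :* θ :* x :- con (ℤ.+ 1)) :=
           con (ℤ.+ 4) :* θ :* (θ :* (x :* x)) :+ con (ℤ.+ 1) :- con (ℤ.+ 4) :* θ :* x)
           refl θ x ⟩
    ι 4 * θ * (θ * (x * x)) + ι 1 - ι 4 * θ * x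
      ≡⟨ cong (λ o → ι 4 * θ * (θ * (x * x)) + o - ι 4 * θ * x) (trans ι1≡1 (sym 4θη≡1)) ⟩
    ι 4 * θ * (θ * (x * x)) + ι 4 * θ * η - ι 4 * θ * x
      ≡⟨ solve 4 (λ c a b d → c :* a :+ c :* b :- c :* d := c :* (a :+ b :- d)) refl _ _ _ _ ⟩
    ι 4 * θ * (θ * (x * x) + η - x) ∎))
    where open ≤-Reasoning

  module _ (r : ℕ) (z : Subset n → ℝ)
           (nonneg   : ∀ S → ∣ S ∣ ℕ.≤ r → 0# ≤ z S)
           (shrinks  : ∀ S x → ∣ S ∪ ⁅ x ⁆ ∣ ℕ.≤ r → z (S ∪ ⁅ x ⁆) ≤ z S)
           (averages : ∀ S → ∣ S ∣ ℕ.< r → avg z S ≡ z S) where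

    -- This makes the unspecified value of `0# ⁻¹` harmless: where a denominator `z S` vanishes, so
    -- do the numerators over it.
    z-zero : ∀ S x → ∣ S ∪ ⁅ x ⁆ ∣ ℕ.≤ r → z S ≡ 0# → z (S ∪ ⁅ x ⁆) ≡ 0#
    z-zero S x ∣Sx∣≤r zS≡0 =
      ≤-antisym (≤-trans (shrinks S x ∣Sx∣≤r) (≤-reflexive zS≡0)) (nonneg _ ∣Sx∣≤r)

    -- The absolute covariance of u and v given U, times z U.
    discrepancy : Fin n → Fin n → Subset n → ℝ
    discrepancy u v U =
      abs (z (U ∪ ⁅ u ⁆) * z (U ∪ ⁅ v ⁆) * z U ⁻¹ - z ((U ∪ ⁅ u ⁆) ∪ ⁅ v ⁆))

    -- The second moment of the conditional probability of u, times z U.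
    moment : Fin n → Subset n → ℝ
    moment u U = z (U ∪ ⁅ u ⁆) * z (U ∪ ⁅ u ⁆) * z U ⁻¹

    discrepancy-sym : ∀ u v U → discrepancy u v U ≡ discrepancy v u U
    discrepancy-sym u v U = cong₂ (λ a S → abs (a * z U ⁻¹ - z S)) (*-comm _ _) (∪-swap U ⁅ u ⁆ ⁅ v ⁆)

    size-∪₁ : ∀ {U : Subset n} x → ∣ U ∣ ℕ.< r → ∣ U ∪ ⁅ x ⁆ ∣ ℕ.≤ r
    size-∪₁ {U} x ∣U∣<r = ℕ.≤-trans (∣p∪⁅x⁆∣≤1+∣p∣ U x) ∣U∣<r

    -- Adding `u` commutes with adding a pivot. In normalised terms, the conditional probability of
    -- `u` is a martingale over the rounds.
    averages-∪ : ∀ u U → suc ∣ U ∣ ℕ.< r → avg (λ V → z (V ∪ ⁅ u ⁆)) U ≡ z (U ∪ ⁅ u ⁆)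
    averages-∪ u U ∣U∣+1<r = trans
      (cong (σ *_) (sum-cong-≗ λ x → cong z (∪-swap U ⁅ x ⁆ ⁅ u ⁆)))
      (averages (U ∪ ⁅ u ⁆) (ℕ.≤-trans (ℕ.s≤s (∣p∪⁅x⁆∣≤1+∣p∣ U u)) ∣U∣+1<r))

    averages-∪∪ : ∀ u v U → suc (suc ∣ U ∣) ℕ.< r →
      avg (λ V → z ((V ∪ ⁅ u ⁆) ∪ ⁅ v ⁆)) U ≡ z ((U ∪ ⁅ u ⁆) ∪ ⁅ v ⁆)
    averages-∪∪ u v U ∣U∣+2<r = trans
      (cong (σ *_) (sum-cong-≗ λ x → cong (λ S → z (S ∪ ⁅ v ⁆)) (∪-swap U ⁅ x ⁆ ⁅ u ⁆)))
      (averages-∪ v (U ∪ ⁅ u ⁆) (ℕ.≤-trans (ℕ.s≤s (ℕ.s≤s (∣p∪⁅x⁆∣≤1+∣p∣ U u))) ∣U∣+2<r))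

    module _ {U : Subset n} (∣U∣<r : ∣ U ∣ ℕ.< r) (u : Fin n) where

      moment-*z : moment u U ≡ z (U ∪ ⁅ u ⁆) * z U ⁻¹ * (z (U ∪ ⁅ u ⁆) * z U ⁻¹) * z U
      moment-*z with z U ≟ 0#
      ... | no zU≢0  = begin
        a * a * ρ                ≡⟨ *-identityʳ _ ⟨
        a * a * ρ * 1#           ≡⟨ cong (a * a * ρ *_) (*-inverseˡ zU≢0) ⟨
        a * a * ρ * (ρ * z U)    ≡⟨ solve 3 (λ a ρ c → a :* a :* ρ :* (ρ :* c) :=
                                      a :* ρ :* (a :* ρ) :* c) refl a ρ (z U) ⟩
        a * ρ * (a * ρ) * z U    ∎
        where
        open ≡-Reasoning
        a = z (U ∪ ⁅ u ⁆)
        ρ = z U ⁻¹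
      ... | yes zU≡0 = begin
        a * a * ρ                ≡⟨ cong (λ a → a * a * ρ) (z-zero U u (size-∪₁ {U} u ∣U∣<r) zU≡0) ⟩
        0# * 0# * ρ              ≡⟨ trans (cong (_* ρ) (zeroˡ 0#)) (zeroˡ ρ) ⟩
        0#                       ≡⟨ zeroʳ _ ⟨
        a * ρ * (a * ρ) * 0#     ≡⟨ cong (a * ρ * (a * ρ) *_) zU≡0 ⟨
        a * ρ * (a * ρ) * z U    ∎
        where
        open ≡-Reasoning
        a = z (U ∪ ⁅ u ⁆)
        ρ = z U ⁻¹

      z-∪≡ : z (U ∪ ⁅ u ⁆) ≡ z (U ∪ ⁅ u ⁆) * z U ⁻¹ * z U
      z-∪≡ with z U ≟ 0#
      ... | no zU≢0  = trans (sym (*-identityʳ _)) (trans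
        (cong (z (U ∪ ⁅ u ⁆) *_) (sym (*-inverseˡ zU≢0))) (sym (*-assoc _ _ _)))
      ... | yes zU≡0 = trans (z-zero U u (size-∪₁ {U} u ∣U∣<r) zU≡0)
        (trans (sym (zeroʳ _)) (cong (z (U ∪ ⁅ u ⁆) * z U ⁻¹ *_) (sym zU≡0)))

      -- `am-gm` for the conditional probability `p` of `u`. With `θ = 1` and `η = 1/4` it reads
      -- `p - p² ≤ 1/4`, the bound on the variance of an indicator.
      z-∪≤moment : ∀ {θ η} → 0# < θ → ι 4 * θ * η ≡ 1# →
                   z (U ∪ ⁅ u ⁆) ≤ θ * moment u U + η * z U
      z-∪≤moment {θ} {η} 0<θ 4θη≡1 = begin
        z (U ∪ ⁅ u ⁆)               ≡⟨ z-∪≡ ⟩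
        p * z U                     ≤⟨ *-monoʳ (z U) (nonneg U (ℕ.<⇒≤ ∣U∣<r)) (am-gm p 0<θ 4θη≡1) ⟩
        (θ * (p * p) + η) * z U     ≡⟨ solve 4 (λ θ q η c → (θ :* q :+ η) :* c :=
                                         θ :* (q :* c) :+ η :* c) refl θ (p * p) η (z U) ⟩
        θ * (p * p * z U) + η * z U ≡⟨ cong (λ m → θ * m + η * z U) moment-*z ⟨
        θ * moment u U + η * z U    ∎
        where
        open ≤-Reasoning
        p = z (U ∪ ⁅ u ⁆) * z U ⁻¹

      moment≤z-∪ : moment u U ≤ z (U ∪ ⁅ u ⁆)
      moment≤z-∪ with z U ≟ 0#
      ... | yes zU≡0 = ≤-trans (≤-reflexive (trans moment-*z (trans
        (cong (z (U ∪ ⁅ u ⁆) * z U ⁻¹ * (z (U ∪ ⁅ u ⁆) * z U ⁻¹) *_) zU≡0) (zeroʳ _))))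
        (nonneg _ (size-∪₁ {U} u ∣U∣<r))
      ... | no zU≢0  = begin
        a * a * ρ     ≡⟨ *-assoc a a ρ ⟩
        a * (a * ρ)   ≤⟨ *-monoˡ a (nonneg _ (size-∪₁ {U} u ∣U∣<r))
                           (*-monoʳ ρ (⁻¹-nonneg 0<zU) (shrinks U u (size-∪₁ {U} u ∣U∣<r))) ⟩
        a * (z U * ρ) ≡⟨ cong (a *_) (*-inverse zU≢0) ⟩
        a * 1#        ≡⟨ *-identityʳ a ⟩
        a             ∎
        where
        open ≤-Reasoning
        a = z (U ∪ ⁅ u ⁆)
        ρ = z U ⁻¹
        0<zU : 0# < z U
        0<zU = nonneg U (ℕ.<⇒≤ ∣U∣<r) , λ 0≡zU → zU≢0 (sym 0≡zU)

    module _ {θ η : ℝ} (0<θ : 0# < θ) (4θη≡1 : ι 4 * θ * η ≡ 1#) where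

      -- With p the conditional probability of u given U, and p′ that given U ∪ {v},
      -- the discrepancy is z (U ∪ {v}) |p - p′|.
      discrepancy-≤ : ∀ {U} u v → suc ∣ U ∣ ℕ.< r → let p = z (U ∪ ⁅ u ⁆) * z U ⁻¹ in
        discrepancy u v U ≤
          θ * (moment u (U ∪ ⁅ v ⁆) - ι 2 * p * z ((U ∪ ⁅ v ⁆) ∪ ⁅ u ⁆) + p * p * z (U ∪ ⁅ v ⁆))
          + η * z (U ∪ ⁅ v ⁆)
      discrepancy-≤ {U} u v ∣U∣+1<r = abs-≤
        (≤-trans (≤-reflexive difference) (bound (p - p′)
          (solve 2 (λ p q → (p :- q) :* (p :- q) := q :* q :- con (ℤ.+ 2) :* p :* q :+ p :* p)
            refl p p′)))
        (≤-trans (≤-reflexive (trans (cong -_ difference)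
          (solve 3 (λ p q c → :- ((p :- q) :* c) := (q :- p) :* c) refl p p′ c)))
          (bound (p′ - p)
          (solve 2 (λ p q → (q :- p) :* (q :- p) := q :* q :- con (ℤ.+ 2) :* p :* q :+ p :* p)
            refl p p′)))
        where
        open ≤-Reasoning
        V = U ∪ ⁅ v ⁆
        c = z V
        p = z (U ∪ ⁅ u ⁆) * z U ⁻¹
        p′ = z (V ∪ ⁅ u ⁆) * z V ⁻¹
        ∣V∣<r : ∣ V ∣ ℕ.< r
        ∣V∣<r = ℕ.≤-trans (ℕ.s≤s (∣p∪⁅x⁆∣≤1+∣p∣ U v)) ∣U∣+1<r
        difference : z (U ∪ ⁅ u ⁆) * c * z U ⁻¹ - z ((U ∪ ⁅ u ⁆) ∪ ⁅ v ⁆) ≡ (p - p′) * c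
        difference = ≡-Reasoning.begin
          z (U ∪ ⁅ u ⁆) * c * z U ⁻¹ - z ((U ∪ ⁅ u ⁆) ∪ ⁅ v ⁆)
            ≡-Reasoning.≡⟨ cong (λ b → z (U ∪ ⁅ u ⁆) * c * z U ⁻¹ - b)
                 (trans (cong z (∪-swap U ⁅ u ⁆ ⁅ v ⁆)) (z-∪≡ {V} ∣V∣<r u)) ⟩
          z (U ∪ ⁅ u ⁆) * c * z U ⁻¹ - p′ * c
            ≡-Reasoning.≡⟨ solve 4 (λ a c ρ q → a :* c :* ρ :- q :* c := (a :* ρ :- q) :* c)
                 refl (z (U ∪ ⁅ u ⁆)) c (z U ⁻¹) p′ ⟩
          (p - p′) * c ≡-Reasoning.∎
        bound : ∀ x → x * x ≡ p′ * p′ - ι 2 * p * p′ + p * p →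
          x * c ≤ θ * (moment u V - ι 2 * p * z (V ∪ ⁅ u ⁆) + p * p * c) + η * c
        bound x x²≡ = begin
          x * c
            ≤⟨ *-monoʳ c (nonneg V (ℕ.<⇒≤ ∣V∣<r)) (am-gm x 0<θ 4θη≡1) ⟩
          (θ * (x * x) + η) * c
            ≡⟨ cong (λ q → (θ * q + η) * c) x²≡ ⟩
          (θ * (p′ * p′ - ι 2 * p * p′ + p * p) + η) * c
            ≡⟨ solve 5 (λ θ η c p q →
                 (θ :* (q :* q :- con (ℤ.+ 2) :* p :* q :+ p :* p) :+ η) :* c :=
                 θ :* (q :* q :* c :- con (ℤ.+ 2) :* p :* (q :* c) :+ p :* p :* c) :+ η :* c)
                 refl θ η c p p′ ⟩
          θ * (p′ * p′ * c - ι 2 * p * (p′ * c) + p * p * c) + η * c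
            ≡⟨ cong₂ (λ a b → θ * (a - ι 2 * p * b + p * p * c) + η * c)
                 (moment-*z {V} ∣V∣<r u) (z-∪≡ {V} ∣V∣<r u) ⟨
          θ * (moment u V - ι 2 * p * z (V ∪ ⁅ u ⁆) + p * p * c) + η * c ∎

      -- The mean of `(p′ - p)²` over the pivot `v` is the gain in second moment: `p` depends on `U`
      -- alone and is the mean of `p′` by `averages-∪`, so `-2pp′ + p²` averages to `-p²`.
      mean-discrepancy-≤ : ∀ {U} u → suc ∣ U ∣ ℕ.< r →
        (σ * sum λ v → discrepancy u v U) ≤ θ * (avg (moment u) U - moment u U) + η * z U
      mean-discrepancy-≤ {U} u ∣U∣+1<r = begin
        (σ * sum λ v → discrepancy u v U)
          ≤⟨ *-monoˡ σ 0≤σ (sum-mono λ v → discrepancy-≤ {U} u v ∣U∣+1<r) ⟩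
        avg F U
          ≡⟨ linear ⟩
        θ * (avg (moment u) U - ι 2 * p * avg (λ V → z (V ∪ ⁅ u ⁆)) U + p * p * avg z U) + η * avg z U
          ≡⟨ cong₂ (λ a b → θ * (avg (moment u) U - ι 2 * p * a + p * p * b) + η * b)
               (trans (averages-∪ u U ∣U∣+1<r) (z-∪≡ {U} ∣U∣<r u)) (averages U ∣U∣<r) ⟩
        θ * (avg (moment u) U - ι 2 * p * (p * z U) + p * p * z U) + η * z U
          ≡⟨ solve 5 (λ θ a p c η →
               θ :* (a :- con (ℤ.+ 2) :* p :* (p :* c) :+ p :* p :* c) :+ η :* c :=
               θ :* (a :- p :* p :* c) :+ η :* c) refl θ (avg (moment u) U) p (z U) η ⟩
        θ * (avg (moment u) U - p * p * z U) + η * z U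
          ≡⟨ cong (λ m → θ * (avg (moment u) U - m) + η * z U) (moment-*z {U} ∣U∣<r u) ⟨
        θ * (avg (moment u) U - moment u U) + η * z U ∎
        where
        open ≤-Reasoning
        ∣U∣<r : ∣ U ∣ ℕ.< r
        ∣U∣<r = ℕ.<⇒≤ ∣U∣+1<r
        p = z (U ∪ ⁅ u ⁆) * z U ⁻¹
        F G : Subset n → ℝ
        F V = θ * (moment u V - ι 2 * p * z (V ∪ ⁅ u ⁆) + p * p * z V) + η * z V
        G V = moment u V - ι 2 * p * z (V ∪ ⁅ u ⁆)
        linear : avg F U ≡ θ * (avg (moment u) U - ι 2 * p * avg (λ V → z (V ∪ ⁅ u ⁆)) U
                   + p * p * avg z U) + η * avg z U
        linear = trans (avg^-+ 1 (λ V → θ * (G V + p * p * z V)) (λ V → η * z V) U) (cong₂ _+_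
          (trans (avg^-* 1 θ (λ V → G V + p * p * z V) U) (cong (θ *_)
            (trans (avg^-+ 1 G (λ V → p * p * z V) U) (cong₂ _+_
              (trans (avg^-sub 1 (moment u) (λ V → ι 2 * p * z (V ∪ ⁅ u ⁆)) U)
                (cong (λ b → avg (moment u) U - b) (avg^-* 1 (ι 2 * p) (λ V → z (V ∪ ⁅ u ⁆)) U)))
              (avg^-* 1 (p * p) z U)))))
          (avg^-* 1 η z U))

      -- The gains telescope to the last second moment minus the first. The last is at most the mean
      -- `z (U ∪ ⁅ u ⁆)`, which the rounds preserve, and the mean minus the first second moment is a
      -- variance, hence at most a quarter of `z U`.
      total-discrepancy-≤ : ∀ {U} u m b → ∣ U ∣ ℕ.+ m ℕ.≤ suc b → suc (suc b) ℕ.≤ r →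
        (sum {m} λ i → avg^ (toℕ i) (λ V → σ * sum λ v → discrepancy u v V) U) ≤
          (θ * ι 4 ⁻¹ + ι m * η) * z U
      total-discrepancy-≤ {U} u m b ∣U∣+m≤1+b 2+b≤r = begin
        (sum {m} λ i → avg^ (toℕ i) (λ V → σ * sum λ v → discrepancy u v V) U)
          ≤⟨ sum-mono (λ i → avg^-mono {U} {b} {g = λ V → θ * drop V + η * z V}
               (λ V _ ∣V∣≤b → mean-discrepancy-≤ {V} u (ℕ.≤-trans (ℕ.s≤s (ℕ.s≤s ∣V∣≤b)) 2+b≤r))
               (toℕ i) U ⊆-refl (early i)) ⟩
        (sum {m} λ i → avg^ (toℕ i) (λ V → θ * drop V + η * z V) U)
          ≡⟨ sum-cong-≗ (λ i → trans (avg^-+ (toℕ i) (λ V → θ * drop V) (λ V → η * z V) U)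
               (cong₂ _+_ (avg^-* (toℕ i) θ drop U) (trans (avg^-* (toℕ i) η z U)
                 (cong (η *_) (avg^-fixed averages (toℕ i) U (stays i)))))) ⟩
        (sum {m} λ i → θ * avg^ (toℕ i) drop U + η * z U)
          ≡⟨ ∑-distrib-+ {m} (λ i → θ * avg^ (toℕ i) drop U) (λ _ → η * z U) ⟩
        (sum {m} λ i → θ * avg^ (toℕ i) drop U) + sum {m} (λ _ → η * z U)
          ≡⟨ cong₂ _+_ (sym (*-distribˡ-sum {m} θ (λ i → avg^ (toℕ i) drop U)))
               (sum-const m (η * z U)) ⟩
        θ * (sum {m} λ i → avg^ (toℕ i) drop U) + ι m * (η * z U)
          ≡⟨ cong (λ a → θ * a + ι m * (η * z U)) (telescope m (moment u) U) ⟩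
        θ * (avg^ m (moment u) U - moment u U) + ι m * (η * z U)
          ≤⟨ +-mono-≤ _ (*-monoˡ θ (proj₁ 0<θ) (+-mono-≤ (- moment u U) last-moment)) ⟩
        θ * (z (U ∪ ⁅ u ⁆) - moment u U) + ι m * (η * z U)
          ≤⟨ +-mono-≤ _ (*-monoˡ θ (proj₁ 0<θ) (+-mono-≤ (- moment u U)
               (z-∪≤moment {U} ∣U∣<r u 0<1 4·1·¼≡1))) ⟩
        θ * (1# * moment u U + ι 4 ⁻¹ * z U - moment u U) + ι m * (η * z U)
          ≡⟨ cong (λ a → θ * (a + ι 4 ⁻¹ * z U - moment u U) + ι m * (η * z U)) (*-identityˡ _) ⟩
        θ * (moment u U + ι 4 ⁻¹ * z U - moment u U) + ι m * (η * z U)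
          ≡⟨ solve 6 (λ θ a q c k η → θ :* (a :+ q :* c :- a) :+ k :* (η :* c) :=
               (θ :* q :+ k :* η) :* c) refl θ (moment u U) (ι 4 ⁻¹) (z U) (ι m) η ⟩
        (θ * ι 4 ⁻¹ + ι m * η) * z U ∎
        where
        open ≤-Reasoning
        drop : Subset n → ℝ
        drop V = avg (moment u) V - moment u V
        ∣U∣<r : ∣ U ∣ ℕ.< r
        ∣U∣<r = ℕ.≤-trans (ℕ.s≤s (ℕ.≤-trans (ℕ.m≤m+n ∣ U ∣ m) ∣U∣+m≤1+b)) 2+b≤r
        4·1·¼≡1 : ι 4 * 1# * ι 4 ⁻¹ ≡ 1#
        4·1·¼≡1 = trans (cong (_* ι 4 ⁻¹) (*-identityʳ (ι 4))) (*-inverse (>⇒≢0 (0<ι 3)))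
        -- Discrepancies are taken at sets of at most `b` elements, which leaves room for both `u`
        -- and `v` below `r`. The last moment is taken at up to `b + 1` elements, but it adds only
        -- `u`.
        early : ∀ (i : Fin m) → ∣ U ∣ ℕ.+ toℕ i ℕ.≤ b
        early i = ℕ.s≤s⁻¹ (ℕ.≤-trans (ℕ.≤-reflexive (sym (ℕ.+-suc ∣ U ∣ (toℕ i))))
          (ℕ.≤-trans (ℕ.+-monoʳ-≤ ∣ U ∣ (Fin.toℕ<n i)) ∣U∣+m≤1+b))
        stays : ∀ (i : Fin m) → ∣ U ∣ ℕ.+ toℕ i ℕ.≤ r
        stays i = ℕ.≤-trans (early i) (ℕ.≤-trans (ℕ.m≤n+m b 2) 2+b≤r)
        last-moment : avg^ m (moment u) U ≤ z (U ∪ ⁅ u ⁆)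
        last-moment = ≤-trans
          (avg^-mono {U} {suc b}
            (λ V _ ∣V∣≤1+b → moment≤z-∪ {V} (ℕ.≤-trans (ℕ.s≤s ∣V∣≤1+b) 2+b≤r) u)
            m U ⊆-refl ∣U∣+m≤1+b)
          (≤-reflexive (avg^-fixed {suc b}
            (λ V ∣V∣≤b → averages-∪ u V (ℕ.≤-trans (ℕ.s≤s ∣V∣≤b) 2+b≤r)) m U ∣U∣+m≤1+b))

-- Sums over pairs of vertices and over atoms

module PairSums (𝓡 : CompleteOrderedField) where
  open CompleteOrderedField 𝓡
  open CorrelationClustering 𝓡
  open RealArithmetic 𝓡

  when-cong : ∀ {P Q : Set} {x y} (P? : Dec P) (Q? : Dec Q) → does P? ≡ does Q? → x ≡ y →
              (x when P?) ≡ (y when Q?)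
  when-cong P? Q? eq refl rewrite eq = refl

  when-⇔ : ∀ {P Q : Set} {x y} (P? : Dec P) (Q? : Dec Q) → (P → Q) → (Q → P) → (P → x ≡ y) →
           (x when P?) ≡ (y when Q?)
  when-⇔ (yes p) Q? P⇒Q Q⇒P x≡y = trans (x≡y p) (sym (when-true Q? (P⇒Q p)))
  when-⇔ (no ¬p) Q? P⇒Q Q⇒P x≡y = sym (when-false Q? (λ q → ¬p (Q⇒P q)))

  when-* : ∀ {P : Set} x (P? : Dec P) → (x when P?) ≡ x * (1# when P?)
  when-* x (yes _) = sym (*-identityʳ x)
  when-* x (no _)  = sym (zeroʳ x)

  sum-sum≡sumPairs : ∀ {n} (f : Fin n → Fin n → ℝ) →
    (sum λ u → sum λ v → f u v) ≡ sumPairs (λ u v → f u v + f v u) + (sum λ u → f u u)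
  sum-sum≡sumPairs f = begin
    (sum λ u → sum λ v → f u v)
      ≡⟨ sum-cong-≗ (λ u → trans (sum-cong-≗ (split u))
           (trans (∑-distrib-+ (λ v → below u v + above u v) (λ v → f u v when (u Fin.≟ v)))
             (cong₂ _+_ (∑-distrib-+ (below u) (above u)) (sum-when-≡ (f u) u)))) ⟩
    (sum λ u → sum (below u) + sum (above u) + f u u)
      ≡⟨ trans (∑-distrib-+ (λ u → sum (below u) + sum (above u)) (λ u → f u u))
           (cong (_+ sum (λ u → f u u)) (trans (∑-distrib-+ (sum ∘ below) (sum ∘ above))
             (cong (sum (sum ∘ below) +_) (∑-comm above)))) ⟩
    sum (sum ∘ below) + (sum λ v → sum λ u → above u v) + (sum λ u → f u u)
      ≡⟨ cong (_+ sum (λ u → f u u)) (sym (trans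
           (sum-cong-≗ λ u → trans (sum-cong-≗ λ v → when-+ (f u v) (f v u) (u Fin.<? v))
             (∑-distrib-+ (below u) (λ v → above v u)))
           (∑-distrib-+ (sum ∘ below) (λ u → sum λ v → above v u)))) ⟩
    sumPairs (λ u v → f u v + f v u) + (sum λ u → f u u) ∎
    where
    open ≡-Reasoning
    below above : Fin _ → Fin _ → ℝ
    below u v = f u v when (u Fin.<? v)
    above u v = f u v when (v Fin.<? u)
    when-+ : ∀ {P : Set} x y (P? : Dec P) → (x + y when P?) ≡ (x when P?) + (y when P?)
    when-+ x y (yes _) = refl
    when-+ x y (no _)  = sym (+-identityˡ 0#)
    split : ∀ u v → f u v ≡ below u v + above u v + (f u v when (u Fin.≟ v))
    split u v with Fin.<-cmp u v
    ... | tri< u<v u≢v u≯v = sym (trans (cong₂ _+_ (cong₂ _+_ (when-true (u Fin.<? v) u<v)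
            (when-false (v Fin.<? u) u≯v)) (when-false (u Fin.≟ v) u≢v))
            (trans (+-identityʳ _) (+-identityʳ _)))
    ... | tri≈ u≮v u≡v u≯v = sym (trans (cong₂ _+_ (cong₂ _+_ (when-false (u Fin.<? v) u≮v)
            (when-false (v Fin.<? u) u≯v)) (when-true (u Fin.≟ v) u≡v))
            (trans (cong (_+ f u v) (+-identityˡ 0#)) (+-identityˡ _)))
    ... | tri> u≮v u≢v u>v = sym (trans (cong₂ _+_ (cong₂ _+_ (when-false (u Fin.<? v) u≮v)
            (when-true (v Fin.<? u) u>v)) (when-false (u Fin.≟ v) u≢v))
            (trans (+-identityʳ _) (+-identityˡ _)))

  sumPairs-mono : ∀ {n} {f g : Fin n → Fin n → ℝ} → (∀ u v → f u v ≤ g u v) →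
                  sumPairs f ≤ sumPairs g
  sumPairs-mono {f = f} {g} f≤g = sum-mono λ u → sum-mono λ v → lemma u v (u Fin.<? v)
    where
    lemma : ∀ u v {P : Set} (P? : Dec P) → (f u v when P?) ≤ (g u v when P?)
    lemma u v (yes _) = f≤g u v
    lemma u v (no _)  = ≤-refl

  sumPairs-cong : ∀ {n} {f g : Fin n → Fin n → ℝ} → (∀ u v → f u v ≡ g u v) →
                  sumPairs f ≡ sumPairs g
  sumPairs-cong f≡g = sum-cong-≗ λ u → sum-cong-≗ λ v →
    cong (λ x → x when (u Fin.<? v)) (f≡g u v)

  sumPairs-nonneg : ∀ {n} {f : Fin n → Fin n → ℝ} → (∀ u v → 0# ≤ f u v) → 0# ≤ sumPairs f
  sumPairs-nonneg 0≤f = sum-nonneg λ u → sum-nonneg λ v → when-nonneg (u Fin.<? v) (λ _ → 0≤f u v)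

  *-distribˡ-sumPairs : ∀ {n} c (f : Fin n → Fin n → ℝ) →
                        c * sumPairs f ≡ sumPairs λ u v → c * f u v
  *-distribˡ-sumPairs c f = trans
    (*-distribˡ-sum c (λ u → sum λ v → f u v when (u Fin.<? v))) (sum-cong-≗ λ u →
    trans (*-distribˡ-sum c (λ v → f u v when (u Fin.<? v))) (sum-cong-≗ λ v →
    lemma (f u v) (u Fin.<? v)))
    where
    lemma : ∀ {P : Set} x (P? : Dec P) → c * (x when P?) ≡ (c * x when P?)
    lemma x (yes _) = refl
    lemma x (no _)  = zeroʳ c

  sumOver-mono : ∀ {n} {A : Subset n} {f g : Fin n → ℝ} → (∀ a → a ∈ A → f a ≤ g a) →
                 sumOver A f ≤ sumOver A g
  sumOver-mono {A = A} {f} {g} f≤g = sum-mono λ a → lemma a (a ∈? A)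
    where
    lemma : ∀ a (a∈A? : Dec (a ∈ A)) → (f a when a∈A?) ≤ (g a when a∈A?)
    lemma a (yes a∈A) = f≤g a a∈A
    lemma a (no _)    = ≤-refl

  sumOver-nonneg : ∀ {n} {A : Subset n} {f : Fin n → ℝ} → (∀ a → 0# ≤ f a) → 0# ≤ sumOver A f
  sumOver-nonneg {A = A} 0≤f = sum-nonneg λ a → when-nonneg (a ∈? A) (λ _ → 0≤f a)

  module _ {n} (𝒦 : Clustering n) where
    open Clustering 𝒦

    ∈block-does : ∀ u K → does (u ∈? block K) ≡ does (part u Fin.≟ K)
    ∈block-does u K = trans (does-∈? u (block K)) (lookup∘tabulate _ u)

    ∈block⇒part≡ : ∀ {u K} → u ∈ block K → part u ≡ K
    ∈block⇒part≡ {u} {K} u∈K with u ∈? block K | part u Fin.≟ K | ∈block-does u K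
    ... | _       | yes pu≡K | _ = pu≡K
    ... | no u∉K  | no _     | _ = contradiction u∈K u∉K

    sum-blocks : ∀ (f : Fin n → ℝ) → (sum λ K → sumOver (block K) f) ≡ sum f
    sum-blocks f = begin
      (sum λ K → sum λ u → f u when (u ∈? block K))
        ≡⟨ ∑-comm (λ K u → f u when (u ∈? block K)) ⟩
      (sum λ u → sum λ K → f u when (u ∈? block K))
        ≡⟨ sum-cong-≗ (λ u → trans
             (sum-cong-≗ λ K → when-cong (u ∈? block K) (part u Fin.≟ K) (∈block-does u K) refl)
             (sum-when-≡ (λ _ → f u) (part u))) ⟩
      sum f ∎
      where open ≡-Reasoning

    sum-blocks₂ : ∀ (f : Fin n → Fin n → ℝ) →
      (sum λ K → sum λ L → sumOver (block K) λ u → sumOver (block L) λ v → f u v) ≡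
        (sum λ u → sum λ v → f u v)
    sum-blocks₂ f = begin
      (sum λ K → sum λ L → sum λ u → (sumOver (block L) (f u)) when (u ∈? block K))
        ≡⟨ sum-cong-≗ (λ K → trans (∑-comm (λ L u → sumOver (block L) (f u) when (u ∈? block K)))
             (sum-cong-≗ λ u → trans (sum-when (u ∈? block K) (λ L → sumOver (block L) (f u)))
               (cong (λ x → x when (u ∈? block K)) (sum-blocks (f u))))) ⟩
      (sum λ K → sumOver (block K) λ u → sum (f u))
        ≡⟨ sum-blocks (λ u → sum (f u)) ⟩
      (sum λ u → sum λ v → f u v) ∎
      where
      open ≡-Reasoning
      sum-when : ∀ {P : Set} {k} (P? : Dec P) (g : Fin k → ℝ) →
                 (sum λ L → g L when P?) ≡ (sum g when P?)
      sum-when (yes _) g = refl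
      sum-when {k = k} (no _) g = sum-zero {k} (λ L → refl)

-- The random walk on the atoms and the weight of admissible pairs

module AdmissibleWeight (𝓡 : CompleteOrderedField) where
  open CompleteOrderedField 𝓡
  open CorrelationClustering 𝓡
  open RealArithmetic 𝓡
  open PairSums 𝓡

  module _ (I : Instance) (𝒦 : Clustering (Instance.n I)) where
    open Instance I
    open Clustering 𝒦
    open Admissible I 𝒦

    W⁺-nonneg : ∀ A B → 0# ≤ W⁺ A B
    W⁺-nonneg A B = sumOver-nonneg λ a → sumOver-nonneg λ b →
      when-nonneg (E⁺? a b) (λ _ → w-nonneg a b)

    E⁺-sym : ∀ u v → (w u v when E⁺? u v) ≡ (w v u when E⁺? v u)
    E⁺-sym u v = when-⇔ (E⁺? u v) (E⁺? v u)
      (λ (u≢v , pos) → ≢-sym u≢v , trans (positive-sym v u) pos)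
      (λ (v≢u , pos) → ≢-sym v≢u , trans (positive-sym u v) pos)
      (λ _ → w-sym u v)

    W⁺-sym : ∀ A B → W⁺ A B ≡ W⁺ B A
    W⁺-sym A B = begin
      (sum λ a → (sum λ b → g a b when (b ∈? B)) when (a ∈? A))
        ≡⟨ sum-cong-≗ (λ a → trans (when-* _ (a ∈? A))
             (*-distribʳ-sum (1# when (a ∈? A)) (λ b → g a b when (b ∈? B)))) ⟩
      (sum λ a → sum λ b → (g a b when (b ∈? B)) * (1# when (a ∈? A)))
        ≡⟨ ∑-comm (λ a b → (g a b when (b ∈? B)) * (1# when (a ∈? A))) ⟩
      (sum λ b → sum λ a → (g a b when (b ∈? B)) * (1# when (a ∈? A)))
        ≡⟨ sum-cong-≗ (λ b → trans (sum-cong-≗ λ a → trans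
             (cong₂ _*_ (trans (when-* _ (b ∈? B)) (cong (_* (1# when (b ∈? B))) (E⁺-sym a b))) refl)
             (trans (solve 3 (λ g p q → g :* p :* q := g :* q :* p) refl
                      (g b a) (1# when (b ∈? B)) (1# when (a ∈? A)))
               (cong (_* (1# when (b ∈? B))) (sym (when-* (g b a) (a ∈? A))))))
             (sym (trans (when-* _ (b ∈? B))
               (*-distribʳ-sum (1# when (b ∈? B)) (λ a → g b a when (a ∈? A)))))) ⟩
      (sum λ b → (sum λ a → g b a when (a ∈? A)) when (b ∈? B)) ∎
      where
      open ≡-Reasoning
      g : Fin n → Fin n → ℝ
      g u v = w u v when E⁺? u v

    -- The conductances of the walk `P`: a symmetric matrix with row sums `d`.
    C : Fin parts → Fin parts → ℝ
    C K L = W⁺ (block K) (block L) when ¬? (K Fin.≟ L)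

    C-nonneg : ∀ K L → 0# ≤ C K L
    C-nonneg K L = when-nonneg (¬? (K Fin.≟ L)) (λ _ → W⁺-nonneg (block K) (block L))

    C-sym : ∀ K L → C K L ≡ C L K
    C-sym K L = when-⇔ (¬? (K Fin.≟ L)) (¬? (L Fin.≟ K)) ≢-sym ≢-sym (λ _ → W⁺-sym (block K) (block L))

    d≡ΣC : ∀ K → d K ≡ sum (C K)
    d≡ΣC K = sum-cong-≗ λ L → when-⇔ (¬? (L Fin.≟ K)) (¬? (K Fin.≟ L)) ≢-sym ≢-sym (λ _ → refl)

    d-nonneg : ∀ K → 0# ≤ d K
    d-nonneg K = ≤-trans (sum-nonneg (C-nonneg K)) (≤-reflexive (sym (d≡ΣC K)))

    C-zero : ∀ K L → ¬ 0# < d K → C K L ≡ 0#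
    C-zero K L d≯0 = ≤-antisym
      (≤-trans (term≤sum (C-nonneg K) L) (≤-trans (≤-reflexive (sym (d≡ΣC K))) d≤0))
      (C-nonneg K L)
      where
      d≤0 : d K ≤ 0#
      d≤0 with d K ≤? 0#
      ... | yes d≤0 = d≤0
      ... | no d≰0  = contradiction (≰⇒> d≰0) d≯0

    P≡C/d : ∀ K L → P K L ≡ C K L * d K ⁻¹
    P≡C/d K L with K Fin.≟ L
    ... | yes _ = sym (zeroˡ _)
    ... | no _  = refl

    μ : Fin parts → ℝ
    μ K = 1# when InK₊? K

    -- Columns outside `𝒦₊` are zero, so restricting the sums to `𝒦₊` loses nothing.
    C-μʳ : ∀ K L → C K L * μ L ≡ C K L
    C-μʳ K L = lemma (InK₊? L)
      where
      lemma : (L₊? : Dec (0# < d L)) → C K L * (1# when L₊?) ≡ C K L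
      lemma (yes _)  = *-identityʳ _
      lemma (no d≯0) = trans (zeroʳ _) (sym (trans (C-sym K L) (C-zero L K d≯0)))

    μ-in : ∀ {K} → 0# < d K → μ K ≡ 1#
    μ-in {K} 0<d = when-true (InK₊? K) 0<d

    infixr 7 _⊙_

    _⊙_ : Matrix → (Fin parts → ℝ) → Fin parts → ℝ
    (A ⊙ x) K = sum λ J → A K J * x J * μ J

    -- Restricted to `𝒦₊`, outside which the diagonal entries `d J ⁻¹` have no determined sign.
    Nonneg : Matrix → Set
    Nonneg A = ∀ K L → 0# < d K → 0# < d L → 0# ≤ A K L

    ⊙-cong : ∀ A {x x′} → (∀ J → 0# < d J → x J ≡ x′ J) → ∀ K → (A ⊙ x) K ≡ (A ⊙ x′) K
    ⊙-cong A {x} {x′} x≡x′ K = sum-cong-≗ λ J → lemma J (InK₊? J)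
      where
      lemma : ∀ J (J₊? : Dec (0# < d J)) →
              A K J * x J * (1# when J₊?) ≡ A K J * x′ J * (1# when J₊?)
      lemma J (yes 0<d) = cong (λ z → A K J * z * 1#) (x≡x′ J 0<d)
      lemma J (no _)    = trans (zeroʳ _) (sym (zeroʳ _))

    ⊗-⊙ : ∀ A B x K → ((A ⊗ B) ⊙ x) K ≡ (A ⊙ (B ⊙ x)) K
    ⊗-⊙ A B x K = begin
      (sum λ J → (sum λ L → A K L * B L J when InK₊? L) * x J * μ J)
        ≡⟨ sum-cong-≗ (λ J → trans (*-assoc _ _ _)
             (*-distribʳ-sum (x J * μ J) (λ L → A K L * B L J when InK₊? L))) ⟩
      (sum λ J → sum λ L → (A K L * B L J when InK₊? L) * (x J * μ J))
        ≡⟨ ∑-comm (λ J L → (A K L * B L J when InK₊? L) * (x J * μ J)) ⟩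
      (sum λ L → sum λ J → (A K L * B L J when InK₊? L) * (x J * μ J))
        ≡⟨ sum-cong-≗ (λ L → trans (sum-cong-≗ λ J → trans
             (cong (_* (x J * μ J)) (when-* _ (InK₊? L)))
             (solve 5 (λ a b m x k → a :* b :* m :* (x :* k) := a :* m :* (b :* x :* k)) refl
               (A K L) (B L J) (μ L) (x J) (μ J)))
             (trans (sym (*-distribˡ-sum (A K L * μ L) (λ J → B L J * x J * μ J)))
               (solve 3 (λ a m b → a :* m :* b := a :* b :* m) refl (A K L) (μ L) ((B ⊙ x) L)))) ⟩
      (sum λ L → A K L * (B ⊙ x) L * μ L) ∎
      where open ≡-Reasoning

    ⊗ᵀ-⊙ : ∀ A B x K → (((A ⊗ B) ᵀ) ⊙ x) K ≡ ((B ᵀ) ⊙ ((A ᵀ) ⊙ x)) K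
    ⊗ᵀ-⊙ A B x K = trans
      (sum-cong-≗ λ J → cong (λ z → z * x J * μ J)
        (sum-cong-≗ λ L → cong (λ z → z when InK₊? L) (*-comm (A J L) (B L K))))
      (⊗-⊙ (B ᵀ) (A ᵀ) x K)

    diag-⊙ : ∀ f x K → 0# < d K → (diag f ⊙ x) K ≡ f K * x K
    diag-⊙ f x K 0<d = begin
      (sum λ J → (f K when (K Fin.≟ J)) * x J * μ J)
        ≡⟨ sum-cong-≗ (λ J → lemma J (K Fin.≟ J)) ⟩
      (sum λ J → f K * x J * μ J when (K Fin.≟ J))
        ≡⟨ sum-when-≡ (λ J → f K * x J * μ J) K ⟩
      f K * x K * μ K
        ≡⟨ trans (cong (f K * x K *_) (μ-in 0<d)) (*-identityʳ _) ⟩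
      f K * x K ∎
      where
      open ≡-Reasoning
      lemma : ∀ J {Q : Set} (Q? : Dec Q) → (f K when Q?) * x J * μ J ≡ (f K * x J * μ J when Q?)
      lemma J (yes _) = refl
      lemma J (no _)  = trans (cong (_* μ J) (zeroˡ _)) (zeroˡ _)

    𝟏 : Fin parts → ℝ
    𝟏 _ = 1#

    -- For `𝟏` this says that the rows of `A` sum to one; for `A ᵀ` and `d`, that `d` is a
    -- stationary measure. Both properties survive products and halved sums, and so pass from `P` to
    -- `Q`.
    Fixes : Matrix → (Fin parts → ℝ) → Set
    Fixes A x = ∀ K → 0# < d K → (A ⊙ x) K ≡ x K

    P-fixes-𝟏 : Fixes P 𝟏
    P-fixes-𝟏 K 0<d = begin
      (sum λ L → P K L * 1# * μ L)
        ≡⟨ sum-cong-≗ (λ L → trans (cong (λ p → p * 1# * μ L) (P≡C/d K L)) (trans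
             (trans (cong (_* μ L) (*-identityʳ _))
               (solve 3 (λ c i m → c :* i :* m := c :* m :* i) refl (C K L) (d K ⁻¹) (μ L)))
             (cong (_* d K ⁻¹) (C-μʳ K L)))) ⟩
      (sum λ L → C K L * d K ⁻¹)
        ≡⟨ *-distribʳ-sum (d K ⁻¹) (C K) ⟨
      sum (C K) * d K ⁻¹
        ≡⟨ cong (_* d K ⁻¹) (d≡ΣC K) ⟨
      d K * d K ⁻¹
        ≡⟨ *-inverse (>⇒≢0 0<d) ⟩
      1# ∎
      where open ≡-Reasoning

    -- Reversibility: `P K L * d K` is the conductance `C K L`, which is symmetric, so summing over
    -- `K` gives the degree of `L`.
    Pᵀ-fixes-d : Fixes (P ᵀ) d
    Pᵀ-fixes-d L _ = trans (sum-cong-≗ λ K → lemma K (InK₊? K)) (sym (d≡ΣC L))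
      where
      lemma : ∀ K (K₊? : Dec (0# < d K)) → P K L * d K * (1# when K₊?) ≡ C L K
      lemma K (no d≯0)  = trans (zeroʳ _) (sym (trans (C-sym L K) (C-zero K L d≯0)))
      lemma K (yes 0<d) = begin
        P K L * d K * 1#            ≡⟨ *-identityʳ _ ⟩
        P K L * d K                 ≡⟨ cong (_* d K) (P≡C/d K L) ⟩
        C K L * d K ⁻¹ * d K        ≡⟨ *-assoc _ _ _ ⟩
        C K L * (d K ⁻¹ * d K)      ≡⟨ cong (C K L *_) (*-inverseˡ (>⇒≢0 0<d)) ⟩
        C K L * 1#                  ≡⟨ *-identityʳ _ ⟩
        C K L                       ≡⟨ C-sym K L ⟩
        C L K                       ∎
        where open ≡-Reasoning

    lazy : Matrix → Matrix
    lazy A K L = (𝕀 K L + A K L) / ι 2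

    𝕀-fixes : ∀ x → Fixes 𝕀 x
    𝕀-fixes x K 0<d = trans (diag-⊙ 𝟏 x K 0<d) (*-identityˡ (x K))

    𝕀ᵀ-fixes : ∀ x → Fixes (𝕀 ᵀ) x
    𝕀ᵀ-fixes x K 0<d = trans
      (sum-cong-≗ λ J → cong (λ i → i * x J * μ J)
        (when-⇔ (J Fin.≟ K) (K Fin.≟ J) sym sym (λ _ → refl)))
      (𝕀-fixes x K 0<d)

    half-fixes : ∀ {A B x} → Fixes A x → Fixes B x → Fixes (λ K L → (A K L + B K L) / ι 2) x
    half-fixes {A} {B} {x} A-fixes B-fixes K 0<d = begin
      (sum λ L → (A K L + B K L) * ι 2 ⁻¹ * x L * μ L)
        ≡⟨ sum-cong-≗ (λ L → solve 5 (λ a b h x m →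
             (a :+ b) :* h :* x :* m := (a :* x :* m :+ b :* x :* m) :* h) refl
             (A K L) (B K L) (ι 2 ⁻¹) (x L) (μ L)) ⟩
      (sum λ L → (A K L * x L * μ L + B K L * x L * μ L) * ι 2 ⁻¹)
        ≡⟨ *-distribʳ-sum (ι 2 ⁻¹) (λ L → A K L * x L * μ L + B K L * x L * μ L) ⟨
      (sum λ L → A K L * x L * μ L + B K L * x L * μ L) * ι 2 ⁻¹
        ≡⟨ cong (_* ι 2 ⁻¹) (∑-distrib-+ (λ L → A K L * x L * μ L) (λ L → B K L * x L * μ L)) ⟩
      ((A ⊙ x) K + (B ⊙ x) K) * ι 2 ⁻¹
        ≡⟨ cong₂ (λ a b → (a + b) * ι 2 ⁻¹) (A-fixes K 0<d) (B-fixes K 0<d) ⟩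
      (x K + x K) * ι 2 ⁻¹
        ≡⟨ cong (_* ι 2 ⁻¹) (solve 1 (λ x → x :+ x := x :* con (ℤ.+ 2)) refl (x K)) ⟩
      x K * ι 2 * ι 2 ⁻¹
        ≡⟨ trans (*-assoc _ _ _) (trans (cong (x K *_) (*-inverse (>⇒≢0 (0<ι 1)))) (*-identityʳ _)) ⟩
      x K ∎
      where open ≡-Reasoning

    ⊗-fixes : ∀ {A B x} → Fixes A x → Fixes B x → Fixes (A ⊗ B) x
    ⊗-fixes {A} {B} {x} A-fixes B-fixes K 0<d =
      trans (⊗-⊙ A B x K) (trans (⊙-cong A B-fixes K) (A-fixes K 0<d))

    ⊗ᵀ-fixes : ∀ {A B x} → Fixes (A ᵀ) x → Fixes (B ᵀ) x → Fixes ((A ⊗ B) ᵀ) x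
    ⊗ᵀ-fixes {A} {B} {x} A-fixes B-fixes K 0<d =
      trans (⊗ᵀ-⊙ A B x K) (trans (⊙-cong (B ᵀ) A-fixes K) (B-fixes K 0<d))

    power-fixes : ∀ {A x} → Fixes A x → ∀ t → Fixes (power A t) x
    power-fixes A-fixes zero    = 𝕀-fixes _
    power-fixes {A} A-fixes (suc t) = ⊗-fixes {A} {power A t} A-fixes (power-fixes A-fixes t)

    powerᵀ-fixes : ∀ {A x} → Fixes (A ᵀ) x → ∀ t → Fixes ((power A t) ᵀ) x
    powerᵀ-fixes A-fixes zero    = 𝕀ᵀ-fixes _
    powerᵀ-fixes {A} A-fixes (suc t) = ⊗ᵀ-fixes {A} {power A t} A-fixes (powerᵀ-fixes A-fixes t)

    Q-fixes-𝟏 : ∀ t → Fixes (Q t) 𝟏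
    Q-fixes-𝟏 t = ⊗-fixes {P} {power (lazy P) t} P-fixes-𝟏
      (power-fixes (half-fixes {𝕀} {P} (𝕀-fixes 𝟏) P-fixes-𝟏) t)

    Qᵀ-fixes-d : ∀ t → Fixes ((Q t) ᵀ) d
    Qᵀ-fixes-d t = ⊗ᵀ-fixes {P} {power (lazy P) t} Pᵀ-fixes-d
      (powerᵀ-fixes (half-fixes {𝕀 ᵀ} {P ᵀ} (𝕀ᵀ-fixes d) Pᵀ-fixes-d) t)

    ⊗-nonneg : ∀ {A B} → Nonneg A → Nonneg B → Nonneg (A ⊗ B)
    ⊗-nonneg 0≤A 0≤B K L K₊ L₊ = sum-nonneg λ J →
      when-nonneg (InK₊? J) (λ J₊ → *-nonneg (0≤A K J K₊ J₊) (0≤B J L J₊ L₊))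

    diag-nonneg : ∀ f → (∀ K → 0# < d K → 0# ≤ f K) → Nonneg (diag f)
    diag-nonneg f 0≤f K L K₊ _ = when-nonneg (K Fin.≟ L) (λ _ → 0≤f K K₊)

    P-nonneg : Nonneg P
    P-nonneg K L K₊ _ = ≤-trans (*-nonneg (C-nonneg K L) (⁻¹-nonneg K₊))
      (≤-reflexive (sym (P≡C/d K L)))

    power-nonneg : ∀ {A} → Nonneg A → ∀ t → Nonneg (power A t)
    power-nonneg 0≤A zero    = diag-nonneg 𝟏 (λ _ _ → 0≤1)
    power-nonneg {A} 0≤A (suc t) = ⊗-nonneg {A} {power A t} 0≤A (power-nonneg 0≤A t)

    Q-nonneg : ∀ t → Nonneg (Q t)
    Q-nonneg t = ⊗-nonneg {P} {power (lazy P) t} P-nonneg (power-nonneg lazy-nonneg t)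
      where
      lazy-nonneg : Nonneg (lazy P)
      lazy-nonneg K L K₊ L₊ = *-nonneg
        (+-nonneg (diag-nonneg 𝟏 (λ _ _ → 0≤1) K L K₊ L₊) (P-nonneg K L K₊ L₊))
        (⁻¹-nonneg (0<ι 1))

    module _ (t : ℕ) where
      private
        d⁻¹ : Fin parts → ℝ
        d⁻¹ J = d J ⁻¹
        Γ₁ Γ₂ Γ₃ Γ₄ : Matrix
        Γ₁ = diag d ⊗ Q t
        Γ₂ = Γ₁ ⊗ diag d⁻¹
        Γ₃ = Γ₂ ⊗ (Q t) ᵀ
        Γ₄ = Γ₃ ⊗ diag d

      Γ-nonneg : ∀ K L → 0# ≤ Γ t K L
      Γ-nonneg K L = when-nonneg (InK₊? K ×-dec InK₊? L) λ (K₊ , L₊) →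
        ⊗-nonneg {Γ₃} {diag d}
          (⊗-nonneg {Γ₂} {(Q t) ᵀ}
            (⊗-nonneg {Γ₁} {diag d⁻¹}
              (⊗-nonneg {diag d} {Q t} 0≤diag-d (Q-nonneg t))
              (diag-nonneg d⁻¹ (λ K K₊ → ⁻¹-nonneg K₊)))
            (λ K L K₊ L₊ → Q-nonneg t L K L₊ K₊))
          0≤diag-d K L K₊ L₊
        where
        0≤diag-d : Nonneg (diag d)
        0≤diag-d = diag-nonneg d (λ K _ → d-nonneg K)

      -- D Q D⁻¹ Qᵀ D 𝟏 = D 𝟏, since Qᵀ fixes d = D 𝟏 and Q fixes 𝟏.
      Γ-row : ∀ K → 0# < d K → (Γ₄ ⊙ 𝟏) K ≡ d K
      Γ-row K K₊ = begin
        (Γ₄ ⊙ 𝟏) K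
          ≡⟨ ⊗-⊙ Γ₃ (diag d) 𝟏 K ⟩
        (Γ₃ ⊙ diag d ⊙ 𝟏) K
          ≡⟨ ⊙-cong Γ₃ (λ J J₊ → trans (diag-⊙ d 𝟏 J J₊) (*-identityʳ _)) K ⟩
        (Γ₃ ⊙ d) K
          ≡⟨ ⊗-⊙ Γ₂ ((Q t) ᵀ) d K ⟩
        (Γ₂ ⊙ (Q t) ᵀ ⊙ d) K
          ≡⟨ ⊙-cong Γ₂ (Qᵀ-fixes-d t) K ⟩
        (Γ₂ ⊙ d) K
          ≡⟨ ⊗-⊙ Γ₁ (diag d⁻¹) d K ⟩
        (Γ₁ ⊙ diag d⁻¹ ⊙ d) K
          ≡⟨ ⊙-cong Γ₁ (λ J J₊ → trans (diag-⊙ d⁻¹ d J J₊) (*-inverseˡ (>⇒≢0 J₊))) K ⟩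
        (Γ₁ ⊙ 𝟏) K
          ≡⟨ ⊗-⊙ (diag d) (Q t) 𝟏 K ⟩
        (diag d ⊙ Q t ⊙ 𝟏) K
          ≡⟨ ⊙-cong (diag d) (Q-fixes-𝟏 t) K ⟩
        (diag d ⊙ 𝟏) K
          ≡⟨ trans (diag-⊙ d 𝟏 K K₊) (*-identityʳ _) ⟩
        d K ∎
        where open ≡-Reasoning

      Γ-total : (sum λ K → sum λ L → Γ t K L) ≤ sum d
      Γ-total = sum-mono λ K → row K (InK₊? K)
        where
        row : ∀ K → (K₊? : Dec (0# < d K)) →
              (sum λ L → Γ₄ K L when (K₊? ×-dec InK₊? L)) ≤ d K
        row K (no _)   = ≤-trans (≤-reflexive (sum-zero {parts} (λ L → refl))) (d-nonneg K)
        row K (yes K₊) = ≤-reflexive (trans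
          (sum-cong-≗ λ L → trans (when-cong (yes K₊ ×-dec InK₊? L) (InK₊? L) refl
            (sym (*-identityʳ (Γ₄ K L)))) (when-* (Γ₄ K L * 1#) (InK₊? L)))
          (Γ-row K K₊))

    obj-nonneg : 0# ≤ obj I 𝒦
    obj-nonneg = +-nonneg
      (sumPairs-nonneg λ u v →
        when-nonneg (E⁺? u v ×-dec ¬? (part u Fin.≟ part v)) (λ _ → w-nonneg u v))
      (sumPairs-nonneg λ u v →
        when-nonneg (E⁻? u v ×-dec (part u Fin.≟ part v)) (λ _ → w-nonneg u v))

    -- Every positive pair separated by `𝒦` is seen by `d` from both of its atoms, and such pairs
    -- are one of the two nonnegative parts of the objective.
    Σd≤2obj : sum d ≤ ι 2 * obj I 𝒦
    Σd≤2obj = begin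
      sum d
        ≡⟨ sum-cong-≗ d≡ΣC ⟩
      (sum λ K → sum λ L → C K L)
        ≤⟨ sum-mono (λ K → sum-mono λ L → block-cut K L) ⟩
      (sum λ K → sum λ L → sumOver (block K) λ u → sumOver (block L) λ v → cut u v)
        ≡⟨ sum-blocks₂ 𝒦 cut ⟩
      (sum λ u → sum λ v → cut u v)
        ≡⟨ sum-sum≡sumPairs cut ⟩
      sumPairs (λ u v → cut u v + cut v u) + (sum λ u → cut u u)
        ≡⟨ cong₂ _+_ (sumPairs-cong λ u v → trans (cong (cut u v +_) (cut-sym v u))
             (solve 1 (λ x → x :+ x := con (ℤ.+ 2) :* x) refl (cut u v)))
             (sum-zero λ u → when-false (E⁺? u u ×-dec ¬? (part u Fin.≟ part u))
               (λ (_ , pu≢pu) → pu≢pu refl)) ⟩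
      sumPairs (λ u v → ι 2 * cut u v) + 0#
        ≡⟨ trans (+-identityʳ _) (sym (*-distribˡ-sumPairs (ι 2) cut)) ⟩
      ι 2 * sumPairs cut
        ≤⟨ *-monoˡ (ι 2) (ι-nonneg 2) (≤-trans (≤-reflexive (sym (+-identityʳ _)))
             (+-monoʳ (sumPairs cut) (sumPairs-nonneg λ u v →
               when-nonneg (E⁻? u v ×-dec (part u Fin.≟ part v)) (λ _ → w-nonneg u v)))) ⟩
      ι 2 * obj I 𝒦 ∎
      where
      open ≤-Reasoning
      cut : Fin n → Fin n → ℝ
      cut u v = w u v when (E⁺? u v ×-dec ¬? (part u Fin.≟ part v))
      cut-nonneg : ∀ u v → 0# ≤ cut u v
      cut-nonneg u v = when-nonneg (E⁺? u v ×-dec ¬? (part u Fin.≟ part v)) (λ _ → w-nonneg u v)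
      cut-≢ : ∀ u v → part u ≢ part v → cut u v ≡ (w u v when E⁺? u v)
      cut-≢ u v pu≢pv = when-⇔ (E⁺? u v ×-dec ¬? (part u Fin.≟ part v)) (E⁺? u v)
        proj₁ (_, pu≢pv) (λ _ → refl)
      cut-sym : ∀ u v → cut u v ≡ cut v u
      cut-sym u v = when-⇔ (E⁺? u v ×-dec ¬? (part u Fin.≟ part v))
        (E⁺? v u ×-dec ¬? (part v Fin.≟ part u))
        (λ ((u≢v , pos) , pu≢pv) → (≢-sym u≢v , trans (positive-sym v u) pos) , ≢-sym pu≢pv)
        (λ ((v≢u , pos) , pv≢pu) → (≢-sym v≢u , trans (positive-sym u v) pos) , ≢-sym pv≢pu)
        (λ _ → w-sym u v)
      block-cut : ∀ K L → C K L ≤ (sumOver (block K) λ u → sumOver (block L) λ v → cut u v)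
      block-cut K L = when-≤ (¬? (K Fin.≟ L))
        (λ K≢L → sumOver-mono λ u u∈K → sumOver-mono λ v v∈L → ≤-reflexive (sym (cut-≢ u v
          (λ pu≡pv → K≢L (trans (sym (∈block⇒part≡ 𝒦 u∈K)) (trans pu≡pv (∈block⇒part≡ 𝒦 v∈L)))))))
        (sumOver-nonneg λ u → sumOver-nonneg λ v → cut-nonneg u v)

    -- Admissibility read at the level of atoms, with the number of steps and the threshold left as
    -- variables.
    Heavy : ℕ → ℝ → Fin parts → Fin parts → Set
    Heavy t c K L = K ≢ L × W (block K) (block L) < c * Γ t K L

    Heavy? : ∀ t c K L → Dec (Heavy t c K L)
    Heavy? t c K L = ¬? (K Fin.≟ L) ×-dec (W (block K) (block L) <? c * Γ t K L)

    -- Block by block: a heavy pair of atoms contributes at most `W (block K) (block L)`, which is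
    -- below `c * Γ t K L`; any other pair contributes zero, and the entries of `Γ` are nonnegative.
    Σ-Heavy-≤ : ∀ t {c} → 0# ≤ c →
      (sum λ u → sum λ v → w u v when Heavy? t c (part u) (part v)) ≤ c * (ι 2 * obj I 𝒦)
    Σ-Heavy-≤ t {c} 0≤c = begin
      (sum λ u → sum λ v → heavy u v)
        ≡⟨ sum-blocks₂ 𝒦 heavy ⟨
      (sum λ K → sum λ L → sumOver (block K) λ u → sumOver (block L) λ v → heavy u v)
        ≤⟨ sum-mono (λ K → sum-mono λ L → block-heavy K L (Heavy? t c K L)) ⟩
      (sum λ K → sum λ L → c * Γ t K L)
        ≡⟨ trans (sum-cong-≗ λ K → sym (*-distribˡ-sum c (Γ t K)))
             (sym (*-distribˡ-sum c (λ K → sum (Γ t K)))) ⟩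
      c * (sum λ K → sum λ L → Γ t K L)
        ≤⟨ *-monoˡ c 0≤c (≤-trans (Γ-total t) Σd≤2obj) ⟩
      c * (ι 2 * obj I 𝒦) ∎
      where
      open ≤-Reasoning
      heavy : Fin n → Fin n → ℝ
      heavy u v = w u v when Heavy? t c (part u) (part v)
      when-zero : ∀ {P : Set} {x} (P? : Dec P) → (P → x ≡ 0#) → (x when P?) ≡ 0#
      when-zero (yes p) x≡0 = x≡0 p
      when-zero (no _)  x≡0 = refl
      block-heavy : ∀ K L → Dec (Heavy t c K L) →
        (sumOver (block K) λ u → sumOver (block L) λ v → heavy u v) ≤ c * Γ t K L
      block-heavy K L (yes (_ , W<cΓ)) = ≤-trans
        (sumOver-mono λ u _ → sumOver-mono λ v _ →
          when-≤ (Heavy? t c (part u) (part v)) (λ _ → ≤-refl) (w-nonneg u v))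
        (proj₁ W<cΓ)
      block-heavy K L (no ¬heavy) = ≤-trans
        (≤-reflexive (sum-zero λ u → when-zero (u ∈? block K) λ u∈K →
          sum-zero λ v → when-zero (v ∈? block L) λ v∈L →
          when-false (Heavy? t c (part u) (part v)) λ h → ¬heavy
            (subst (λ L → Heavy t c K L) (∈block⇒part≡ 𝒦 v∈L)
              (subst (λ K → Heavy t c K (part v)) (∈block⇒part≡ 𝒦 u∈K) h))))
        (*-nonneg 0≤c (Γ-nonneg t K L))

    module _ (α ε : ℝ) (1≤α : 1# ≤ α) (0<ε : 0# < ε) where
      private
        τ : ℝ
        τ = ε / (ι 2 * α)

        threshold : ℕ → ℝ
        threshold N = ι 64 * (τ ^ N) ⁻¹

        0<2α : 0# < ι 2 * α
        0<2α = *-pos (0<ι 1) (<-≤-trans 0<1 1≤α)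

        0<τ : 0# < τ
        0<τ = *-pos 0<ε (⁻¹-pos 0<2α)

        τ-inverse : τ * (ι 2 * α / ε) ≡ 1#
        τ-inverse = trans
          (solve 4 (λ e i a j → e :* i :* (a :* j) := a :* i :* (e :* j)) refl
            ε ((ι 2 * α) ⁻¹) (ι 2 * α) (ε ⁻¹))
          (trans (cong₂ _*_ (*-inverse (>⇒≢0 0<2α)) (*-inverse (>⇒≢0 0<ε))) (*-identityˡ 1#))

        ^-inverse : ∀ N → τ ^ N * (ι 2 * α / ε) ^ N ≡ 1#
        ^-inverse zero    = *-identityˡ 1#
        ^-inverse (suc N) = trans
          (solve 4 (λ a b c d → a :* b :* (c :* d) := a :* c :* (b :* d)) refl _ _ _ _)
          (trans (cong₂ _*_ τ-inverse (^-inverse N)) (*-identityˡ 1#))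

        -- The origin of the third term of `R`: the threshold `64 τ^(-N)` times the bound `2 α OPT`
        -- on the sum of all `d K`, where `τ` is the inverse of `2α/ε`.
        threshold-* : ∀ N x → threshold N * (ι 2 * (α * x)) ≡ ι 128 * α * (ι 2 * α / ε) ^ N * x
        threshold-* N x = begin
          ι 64 * (τ ^ N) ⁻¹ * (ι 2 * (α * x))
            ≡⟨ cong (λ z → ι 64 * z * (ι 2 * (α * x))) (*-cancelˡ-≡ (τ ^ N) (>⇒≢0 (^-pos N 0<τ))
                 (trans (*-inverse (>⇒≢0 (^-pos N 0<τ))) (sym (^-inverse N)))) ⟩
          ι 64 * z * (ι 2 * (α * x))
            ≡⟨ solve 5 (λ k z t a x → k :* z :* (t :* (a :* x)) := k :* t :* a :* z :* x) refl
                 (ι 64) z (ι 2) α x ⟩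
          ι 64 * ι 2 * α * z * x
            ≡⟨ cong (λ k → k * α * z * x) (×1-homo-* 64 2) ⟨
          ι 128 * α * z * x ∎
          where
          open ≡-Reasoning
          z = (ι 2 * α / ε) ^ N

      Adm? : ∀ u v → Dec (Adm α ε u v)
      Adm? u v = Heavy? t₀ (threshold (2 ℕ.* t₀ ℕ.+ 1)) (part u) (part v)

      -- The sum runs over ordered pairs, as it must: the charging to single vertices gives every
      -- `x` its own sum over `u`.
      Σ-Adm-≤ : ∀ {OPT} → 0# ≤ OPT → obj I 𝒦 ≤ α * OPT →
        (sum λ u → sum λ v → w u v when Adm? u v) ≤ R α ε * OPT
      Σ-Adm-≤ {OPT} 0≤OPT obj≤αOPT = ≤-trans (Σ-Heavy-≤ t₀ 0≤c)
        (≤-trans (*-monoˡ _ 0≤c (*-monoˡ (ι 2) (ι-nonneg 2) obj≤αOPT))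
        (≤-trans (≤-reflexive (threshold-* (2 ℕ.* t₀ ℕ.+ 1) OPT))
        (*-monoʳ OPT 0≤OPT (x≤y⊔x (1# ⊔ α) (ι 128 * α * (ι 2 * α / ε) ^ (2 ℕ.* t₀ ℕ.+ 1))))))
        where
        0≤c : 0# ≤ threshold (2 ℕ.* t₀ ℕ.+ 1)
        0≤c = *-nonneg (ι-nonneg 64) (⁻¹-nonneg (^-pos (2 ℕ.* t₀ ℕ.+ 1) 0<τ))

-- A lower bound for ln 2 and the number of rounds

module SampleSize (𝓡 : CompleteOrderedField) where
  open CompleteOrderedField 𝓡
  open CorrelationClustering 𝓡 using (R; t₀)
  open RealArithmetic 𝓡

  ¼ : ℝ
  ¼ = ι 4 ⁻¹

  0<¼ : 0# < ¼
  0<¼ = ⁻¹-pos (0<ι 3)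

  4¼≡1 : ι 4 * ¼ ≡ 1#
  4¼≡1 = *-inverse (>⇒≢0 (0<ι 3))

  -- `(a - x)(b + y) + (a + x)(b - y) = 2ab - 2xy`, and all four factors are nonnegative; no case
  -- split on signs arises.
  2xy≤2ab : ∀ {x y a b} → x ≤ a → - x ≤ a → y ≤ b → - y ≤ b → ι 2 * (x * y) ≤ ι 2 * (a * b)
  2xy≤2ab {x} {y} {a} {b} x≤a -x≤a y≤b -y≤b = 0≤y-x⇒x≤y (≤-trans
    (+-nonneg (*-nonneg (x≤y⇒0≤y-x x≤a) (x≤y⇒0≤y-x -y≤b))
              (*-nonneg (x≤y⇒0≤y-x -x≤a) (x≤y⇒0≤y-x y≤b)))
    (≤-reflexive (solve 4 (λ x y a b → (a :- x) :* (b :- :- y) :+ (a :- :- x) :* (b :- y) :=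
      con (ℤ.+ 2) :* (a :* b) :- con (ℤ.+ 2) :* (x :* y)) refl x y a b)))

  abs-*-mono : ∀ {x y a b} → abs x ≤ a → abs y ≤ b → abs (x * y) ≤ a * b
  abs-*-mono {x} {y} ∣x∣≤a ∣y∣≤b = abs-≤
    (*-cancelˡ-≤ (ι 2) (0<ι 1) (2xy≤2ab x≤a -x≤a y≤b -y≤b))
    (*-cancelˡ-≤ (ι 2) (0<ι 1) (≤-trans
      (≤-reflexive (cong (ι 2 *_) (-‿distribˡ-* x y)))
      (2xy≤2ab -x≤a (≤-trans (≤-reflexive (-‿involutive x)) x≤a) y≤b -y≤b)))
    where
    x≤a  = ≤-trans (x≤abs x) ∣x∣≤a
    -x≤a = ≤-trans (-x≤abs x) ∣x∣≤a
    y≤b  = ≤-trans (x≤abs y) ∣y∣≤b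
    -y≤b = ≤-trans (-x≤abs y) ∣y∣≤b

  abs-^-≤ : ∀ {x q} k → abs x ≤ q → abs (x ^ k) ≤ q ^ k
  abs-^-≤ zero    ∣x∣≤q = abs-≤ ≤-refl
    (≤-trans (neg-mono 0≤1) (≤-trans (≤-reflexive -0#≈0#) 0≤1))
  abs-^-≤ (suc k) ∣x∣≤q = abs-*-mono ∣x∣≤q (abs-^-≤ k ∣x∣≤q)

  -- Horner's rule: the partial sums satisfy `S′ = 1 + q S`, and `b` is a supersolution of this
  -- recursion.
  geometric-≤ : ∀ {q b} → 0# ≤ q → 0# ≤ b → 1# + q * b ≤ b → ∀ m → (sum {m} λ k → q ^ toℕ k) ≤ b
  geometric-≤ 0≤q 0≤b 1+qb≤b zero    = 0≤b
  geometric-≤ {q} 0≤q 0≤b 1+qb≤b (suc m) = ≤-trans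
    (+-monoʳ 1# (≤-trans (≤-reflexive (sym (*-distribˡ-sum {m} q (λ k → q ^ toℕ k))))
      (*-monoˡ q 0≤q (geometric-≤ 0≤q 0≤b 1+qb≤b m))))
    1+qb≤b

  -- The terms are dominated by the geometric series of ratio `1/4`, whose sum `4/3` lies below
  -- `7/4`. The bound `7/4` is chosen to keep the partial sums at distance `1/4` from 2.
  exp-partial-≤ : ∀ {x} → abs x ≤ ¼ → ∀ m → (sum {m} λ k → x ^ toℕ k / ι (toℕ k !)) ≤ ι 2 - ¼
  exp-partial-≤ {x} ∣x∣≤¼ m = ≤-trans (sum-mono {m} (λ k → term (toℕ k)))
    (geometric-≤ (proj₁ 0<¼) 0≤b 1+¼b≤b m)
    where
    open ≤-Reasoning
    term : ∀ k → x ^ k / ι (k !) ≤ ¼ ^ k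
    term k = begin
      x ^ k * ι (k !) ⁻¹          ≤⟨ *-monoʳ _ (⁻¹-nonneg 0<k!)
                                       (≤-trans (x≤abs (x ^ k)) (abs-^-≤ k ∣x∣≤¼)) ⟩
      ¼ ^ k * ι (k !) ⁻¹          ≡⟨ cong (_* ι (k !) ⁻¹) (*-identityʳ (¼ ^ k)) ⟨
      ¼ ^ k * 1# * ι (k !) ⁻¹     ≤⟨ *-monoʳ _ (⁻¹-nonneg 0<k!)
                                       (*-monoˡ (¼ ^ k) (^-nonneg k (proj₁ 0<¼)) 1≤k!) ⟩
      ¼ ^ k * ι (k !) * ι (k !) ⁻¹
        ≡⟨ trans (*-assoc _ _ _) (trans (cong (¼ ^ k *_) (*-inverse (>⇒≢0 0<k!))) (*-identityʳ _)) ⟩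
      ¼ ^ k                       ∎
      where
      1≤k! : 1# ≤ ι (k !)
      1≤k! = ≤-trans (≤-reflexive (sym ι1≡1)) (ι-mono {1} {k !} (ℕ.1≤n! k))
      0<k! : 0# < ι (k !)
      0<k! = <-≤-trans 0<1 1≤k!
    ≤-by-difference : ∀ {x y z} → 0# ≤ z → z ≡ y - x → x ≤ y
    ≤-by-difference 0≤z z≡y-x = 0≤y-x⇒x≤y (≤-trans 0≤z (≤-reflexive z≡y-x))
    0≤b : 0# ≤ ι 2 - ¼
    0≤b = ≤-trans (*-nonneg (ι-nonneg 7) (proj₁ 0<¼))
      (≤-reflexive (trans
        (solve 1 (λ q → con (ℤ.+ 7) :* q := con (ℤ.+ 2) :* (con (ℤ.+ 4) :* q) :- q) refl ¼)
        (cong (_- ¼) (trans (cong (ι 2 *_) 4¼≡1) (*-identityʳ (ι 2))))))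
    1+¼b≤b : 1# + ¼ * (ι 2 - ¼) ≤ ι 2 - ¼
    1+¼b≤b = ≤-by-difference (+-nonneg (proj₁ 0<¼) (square-nonneg ¼)) (begin-equality
      ¼ + ¼ * ¼
        ≡⟨ solve 1 (λ q → q :+ q :* q := (con (ℤ.+ 2) :- q) :-
             (con (ℤ.+ 2) :- con (ℤ.+ 4) :* q :+ q :* (con (ℤ.+ 2) :- q))) refl ¼ ⟩
      (ι 2 - ¼) - (ι 2 - ι 4 * ¼ + ¼ * (ι 2 - ¼))
        ≡⟨ cong (λ o → (ι 2 - ¼) - (ι 2 - o + ¼ * (ι 2 - ¼))) 4¼≡1 ⟩
      (ι 2 - ¼) - (ι 2 - 1# + ¼ * (ι 2 - ¼))
        ≡⟨ cong (λ o → (ι 2 - ¼) - (o + ¼ * (ι 2 - ¼))) (trans (cong (λ o → ι 2 - o) (sym ι1≡1))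
             (trans (solve 0 (con (ℤ.+ 2) :- con (ℤ.+ 1) := con (ℤ.+ 1)) refl) ι1≡1)) ⟩
      (ι 2 - ¼) - (1# + ¼ * (ι 2 - ¼)) ∎)

  -- `IsLn` gives only convergence of the exponential series to 2. Testing it with the tolerance
  -- `1/4` contradicts the distance just found.
  ln2-not-small : ∀ {x} → IsLn (ι 2) x → ¬ abs x ≤ ¼
  ln2-not-small {x} converges ∣x∣≤¼ with converges ¼ 0<¼
  ... | N , close = <⇒≱ (close N ℕ.≤-refl) (begin
    ¼                ≡⟨ solve 1 (λ q → q := con (ℤ.+ 2) :- (con (ℤ.+ 2) :- q)) refl ¼ ⟩
    ι 2 - (ι 2 - ¼)  ≤⟨ +-monoʳ (ι 2) (neg-mono (exp-partial-≤ ∣x∣≤¼ N)) ⟩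
    ι 2 - S          ≡⟨ solve 2 (λ t s → t :- s := :- (s :- t)) refl (ι 2) S ⟩
    - (S - ι 2)      ≤⟨ -x≤abs (S - ι 2) ⟩
    abs (S - ι 2)    ∎)
    where
    open ≤-Reasoning
    S : ℝ
    S = sum {N} λ k → x ^ toℕ k / ι (toℕ k !)

  module _ {α ε : ℝ} (1≤α : 1# ≤ α) (0<ε : 0# < ε) (ε≤1 : ε ≤ 1#) where

    2≤128αz^N : ∀ {z} N → 1# ≤ z → ι 2 ≤ ι 128 * α * z ^ N
    2≤128αz^N {z} N 1≤z = begin
      ι 2                  ≤⟨ ι-mono {2} {128} (ℕ.s≤s (ℕ.s≤s ℕ.z≤n)) ⟩
      ι 128                ≡⟨ trans (cong (_* 1#) (*-identityʳ _)) (*-identityʳ _) ⟨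
      ι 128 * 1# * 1#      ≤⟨ *-mono (*-nonneg (ι-nonneg 128) 0≤1) 0≤1
                                (*-monoˡ (ι 128) (ι-nonneg 128) 1≤α) (1≤^ N 1≤z) ⟩
      ι 128 * α * z ^ N    ∎
      where open ≤-Reasoning

    1≤2α/ε : 1# ≤ ι 2 * α / ε
    1≤2α/ε = *-cancelˡ-≤ ε 0<ε (begin
      ε * 1#             ≡⟨ *-identityʳ ε ⟩
      ε                  ≤⟨ ε≤1 ⟩
      1#                 ≡⟨ *-identityˡ 1# ⟨
      1# * 1#            ≤⟨ *-mono 0≤1 0≤1 (1≤ι 1) 1≤α ⟩
      ι 2 * α            ≡⟨ *-identityʳ _ ⟨
      ι 2 * α * 1#       ≡⟨ cong (ι 2 * α *_) (*-inverse (>⇒≢0 0<ε)) ⟨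
      ι 2 * α * (ε * ε ⁻¹)
        ≡⟨ solve 3 (λ a e i → a :* (e :* i) := e :* (a :* i)) refl (ι 2 * α) ε (ε ⁻¹) ⟩
      ε * (ι 2 * α / ε)  ∎)
      where open ≤-Reasoning

    -- A crude bound that serves twice: it makes `R` positive, and it makes `θ` at least 2, which
    -- excludes candidates for ln 2 below `-1/4`.
    2≤R : ι 2 ≤ R α ε
    2≤R = ≤-trans (2≤128αz^N (2 ℕ.* t₀ ℕ.+ 1) 1≤2α/ε) (x≤y⊔x (1# ⊔ α) _)

    module _ {r ln2 : ℝ} {c : ℕ} (2≤r : ι 2 ≤ r) (isLn : IsLn (ι 2) ln2)
             (isCeiling : IsCeiling (ι 2 * ln2 * r ^ 2 / ε ^ 2) c) where

      -- Here `r` stands for the real number `R α ε`; the size bound of the LP is `2 + c`.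
      θ : ℝ
      θ = r / ε

      0<r : 0# < r
      0<r = <-≤-trans (0<ι 1) 2≤r

      0<θ : 0# < θ
      0<θ = *-pos 0<r (⁻¹-pos 0<ε)

      2≤θ : ι 2 ≤ θ
      2≤θ = *-cancelˡ-≤ ε 0<ε (begin
        ε * ι 2           ≤⟨ *-monoʳ (ι 2) (ι-nonneg 2) ε≤1 ⟩
        1# * ι 2          ≡⟨ *-identityˡ _ ⟩
        ι 2               ≤⟨ 2≤r ⟩
        r                 ≡⟨ *-identityʳ r ⟨
        r * 1#            ≡⟨ cong (r *_) (*-inverse (>⇒≢0 0<ε)) ⟨
        r * (ε * ε ⁻¹)    ≡⟨ solve 3 (λ a e i → a :* (e :* i) := e :* (a :* i)) refl r ε (ε ⁻¹) ⟩
        ε * θ             ∎)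
        where open ≤-Reasoning

      size≡ : ι 2 * ln2 * r ^ 2 / ε ^ 2 ≡ ι 2 * ln2 * (θ * θ)
      size≡ = *-cancelˡ-≡ (ε ^ 2) (>⇒≢0 0<ε²) (begin
        ε ^ 2 * (ι 2 * ln2 * r ^ 2 * (ε ^ 2) ⁻¹)
          ≡⟨ solve 3 (λ e x i → e :* (x :* i) := x :* (e :* i)) refl (ε ^ 2) _ ((ε ^ 2) ⁻¹) ⟩
        ι 2 * ln2 * r ^ 2 * (ε ^ 2 * (ε ^ 2) ⁻¹)
          ≡⟨ trans (cong (ι 2 * ln2 * r ^ 2 *_) (*-inverse (>⇒≢0 0<ε²))) (*-identityʳ _) ⟩
        ι 2 * ln2 * (r * (r * 1#))
          ≡⟨ cong (λ z → ι 2 * ln2 * (r * z)) (*-identityʳ r) ⟩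
        ι 2 * ln2 * (r * r)
          ≡⟨ trans (cong (ι 2 * ln2 * (r * r) *_) (trans
               (cong₂ _*_ εi≡1 εi≡1) (*-identityˡ 1#))) (*-identityʳ _) ⟨
        ι 2 * ln2 * (r * r) * (ε * ε ⁻¹ * (ε * ε ⁻¹))
          ≡⟨ solve 4 (λ l r e i → l :* (r :* r) :* (e :* i :* (e :* i)) :=
               e :* e :* (l :* (r :* i :* (r :* i)))) refl (ι 2 * ln2) r ε (ε ⁻¹) ⟩
        ε * ε * (ι 2 * ln2 * (θ * θ))
          ≡⟨ cong (λ z → ε * z * (ι 2 * ln2 * (θ * θ))) (*-identityʳ ε) ⟨
        ε ^ 2 * (ι 2 * ln2 * (θ * θ)) ∎)
        where
        open ≡-Reasoning
        0<ε² : 0# < ε ^ 2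
        0<ε² = ^-pos 2 0<ε
        εi≡1 : ε * ε ⁻¹ ≡ 1#
        εi≡1 = *-inverse (>⇒≢0 0<ε)

      -- A negative candidate below -¼ would make the argument of the ceiling at most -1.
      ¼≤ln2 : ¼ ≤ ln2
      ¼≤ln2 = ≰⇒≥ λ ln2≤¼ → ln2-not-small isLn (abs-≤ ln2≤¼ (≰⇒≥ λ ¼≤-ln2 →
        <⇒≱ (proj₂ isCeiling) (≤-trans (≤-trans
          (+-mono-≤ 1# (≤-trans (≤-reflexive size≡) (below ¼≤-ln2)))
          (≤-reflexive (-‿inverseˡ 1#))) (ι-nonneg c))))
        where
        open ≤-Reasoning
        below : ¼ ≤ - ln2 → ι 2 * ln2 * (θ * θ) ≤ - 1#
        below ¼≤-ln2 = begin
          ι 2 * ln2 * (θ * θ)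
            ≡⟨ solve 2 (λ l t → con (ℤ.+ 2) :* l :* t := :- (con (ℤ.+ 2) :* (:- l) :* t))
                 refl ln2 (θ * θ) ⟩
          - (ι 2 * (- ln2) * (θ * θ))
            ≤⟨ neg-mono (*-mono (*-nonneg (ι-nonneg 2) (proj₁ 0<¼)) (*-nonneg (ι-nonneg 2) (ι-nonneg 1))
                 (*-monoˡ (ι 2) (ι-nonneg 2) ¼≤-ln2)
                 (*-mono (ι-nonneg 2) (ι-nonneg 1) 2≤θ (≤-trans (ι-mono {1} {2} (ℕ.s≤s ℕ.z≤n)) 2≤θ))) ⟩
          - (ι 2 * ¼ * (ι 2 * ι 1))
            ≡⟨ cong -_ (trans (solve 1 (λ q → con (ℤ.+ 2) :* q :* (con (ℤ.+ 2) :* con (ℤ.+ 1)) :=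
                 con (ℤ.+ 4) :* q) refl ¼) 4¼≡1) ⟩
          - 1# ∎

      -- `1 ≤ 4 ln 2`, and `4 ln 2 θ²` is twice the quantity rounded up to `c`.
      θ²≤2c : θ * θ ≤ ι 2 * ι c
      θ²≤2c = begin
        θ * θ                       ≡⟨ *-identityˡ _ ⟨
        1# * (θ * θ)                ≡⟨ cong (_* (θ * θ)) 4¼≡1 ⟨
        ι 4 * ¼ * (θ * θ)           ≤⟨ *-monoʳ (θ * θ) (proj₁ (*-pos 0<θ 0<θ))
                                         (*-monoˡ (ι 4) (ι-nonneg 4) ¼≤ln2) ⟩
        ι 4 * ln2 * (θ * θ)         ≡⟨ solve 2 (λ l t → con (ℤ.+ 4) :* l :* t :=
                                         con (ℤ.+ 2) :* (con (ℤ.+ 2) :* l :* t)) refl ln2 (θ * θ) ⟩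
        ι 2 * (ι 2 * ln2 * (θ * θ)) ≤⟨ *-monoˡ (ι 2) (ι-nonneg 2)
                                         (≤-trans (≤-reflexive (sym size≡)) (proj₁ isCeiling)) ⟩
        ι 2 * ι c                   ∎
        where open ≤-Reasoning

      -- The number of pivots is uniform on `{1, ..., c}`, so its weights `1/c` have to make sense.
      c-positive : 0 ℕ.< c
      c-positive = ℕ.n≢0⇒n>0 λ c≡0 → <⇒≱ (*-pos 0<θ 0<θ)
        (≤-trans θ²≤2c (≤-reflexive (trans (cong (λ c → ι 2 * ι c) c≡0) (zeroʳ (ι 2)))))

      η : ℝ
      η = ε / r * ¼

      4θη≡1 : ι 4 * θ * η ≡ 1#
      4θη≡1 = trans
        (solve 6 (λ k r i e j q → k :* (r :* i) :* (e :* j :* q) :=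
          k :* q :* ((r :* j) :* (e :* i))) refl (ι 4) r (ε ⁻¹) ε (r ⁻¹) ¼)
        (trans (cong₂ _*_ 4¼≡1 (cong₂ _*_ (*-inverse (>⇒≢0 0<r)) (*-inverse (>⇒≢0 0<ε))))
          (trans (*-identityˡ _) (*-identityˡ 1#)))

      -- In units of `g = ε/r = 1/θ`: `θ²≤2c` gives `θ/4 ≤ cg/2`, and `cη = cg/4`, so a quarter of
      -- `cg` is to spare.
      potential-≤ : θ * ¼ + ι c * η ≤ ι c * (ε / r)
      potential-≤ = *-cancelˡ-≤ (ι 4) (0<ι 3) (begin
        ι 4 * (θ * ¼ + ι c * (g * ¼))
          ≡⟨ solve 5 (λ k t q c g → k :* (t :* q :+ c :* (g :* q)) := k :* q :* (t :+ c :* g))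
               refl (ι 4) θ ¼ (ι c) g ⟩
        ι 4 * ¼ * (θ + ι c * g)
          ≡⟨ trans (cong (_* (θ + ι c * g)) 4¼≡1) (*-identityˡ _) ⟩
        θ + ι c * g
          ≤⟨ +-mono-≤ (ι c * g) θ≤2cg ⟩
        ι 2 * ι c * g + ι c * g
          ≡⟨ +-identityˡ _ ⟨
        0# + (ι 2 * ι c * g + ι c * g)
          ≤⟨ +-mono-≤ _ (*-nonneg (ι-nonneg c) 0≤g) ⟩
        ι c * g + (ι 2 * ι c * g + ι c * g)
          ≡⟨ solve 2 (λ c g → c :* g :+ (con (ℤ.+ 2) :* c :* g :+ c :* g) :=
               con (ℤ.+ 4) :* (c :* g)) refl (ι c) g ⟩
        ι 4 * (ι c * g) ∎)
        where
        open ≤-Reasoning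
        g : ℝ
        g = ε / r
        0≤g : 0# ≤ g
        0≤g = *-nonneg (proj₁ 0<ε) (⁻¹-nonneg 0<r)
        θg≡1 : θ * g ≡ 1#
        θg≡1 = trans
          (solve 4 (λ r i e j → (r :* i) :* (e :* j) := (r :* j) :* (e :* i)) refl r (ε ⁻¹) ε (r ⁻¹))
          (trans (cong₂ _*_ (*-inverse (>⇒≢0 0<r)) (*-inverse (>⇒≢0 0<ε))) (*-identityˡ 1#))
        θ≤2cg : θ ≤ ι 2 * ι c * g
        θ≤2cg = begin
          θ              ≡⟨ *-identityʳ θ ⟨
          θ * 1#         ≡⟨ cong (θ *_) θg≡1 ⟨
          θ * (θ * g)    ≡⟨ *-assoc θ θ g ⟨
          θ * θ * g      ≤⟨ *-monoʳ g 0≤g θ²≤2c ⟩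
          ι 2 * ι c * g  ∎

-- The error of the rounding procedure

module Rounding (𝓡 : CompleteOrderedField) where
  open CompleteOrderedField 𝓡
  open CorrelationClustering 𝓡
  open RealArithmetic 𝓡
  open Expectation 𝓡
  open PairSums 𝓡

  share : ∀ {n} → Fin n → ℝ
  share s = 1# / ι (size s)

  share-nonneg : ∀ {n} (s : Fin n) → 0# ≤ share s
  share-nonneg s = *-nonneg 0≤1 (⁻¹-nonneg (0<ι (toℕ s)))

  -- The local consequences of feasibility on which the error analysis rests, with admissibility
  -- abstracted to a relation `Adj`.
  record LocallyConsistent {n} (𝒦 : Clustering n) (Adj : Fin n → Fin n → Set) (r : ℕ)
                           (y : LPVars n) : Set where
    open Clustering 𝒦
    field
      singleton  : ∀ u → total y ⁅ u ⁆ ≡ 1#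
      averages   : ∀ s S → ∣ S ∣ ℕ.< r → share s * (sum λ x → y s (S ∪ ⁅ x ⁆)) ≡ y s S
      nonneg     : ∀ s S → ∣ S ∣ ℕ.≤ r → 0# ≤ y s S
      shrinks    : ∀ s S x → ∣ S ∪ ⁅ x ⁆ ∣ ℕ.≤ r → y s (S ∪ ⁅ x ⁆) ≤ y s S
      atom-equal : ∀ s {u v S} → part u ≡ part v → u ∈ S → ∣ S ∪ ⁅ v ⁆ ∣ ℕ.≤ r →
                   y s (S ∪ ⁅ v ⁆) ≡ y s S
      non-adj    : ∀ s {u v S} → part u ≢ part v → ¬ Adj u v → u ∈ S → v ∈ S → ∣ S ∣ ℕ.≤ r →
                   y s S ≡ 0#

  module _ (I : Instance) (𝒦 : Clustering (Instance.n I))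
           {Adj : Fin (Instance.n I) → Fin (Instance.n I) → Set} (Adj? : ∀ u v → Dec (Adj u v))
           (c : ℕ) (y : LPVars (Instance.n I))
           (consistent : LocallyConsistent 𝒦 Adj (2 ℕ.+ c) y) where
    open Instance I
    open Clustering 𝒦
    open Sampling 𝒦 y
    open LocallyConsistent consistent

    private
      r : ℕ
      r = 2 ℕ.+ c

    together? : ∀ u v (C : Subset n) → Dec _
    together? u v C = (u ∈? C) ×-dec (v ∈? C)

    indicator : Fin n → Fin n → Subset n → ℝ
    indicator u v C = 1# when together? u v C

    adjacentWeight : Fin n → Fin n → ℝ
    adjacentWeight x u = w u x when Adj? u x

    adjacentWeight-nonneg : ∀ x u → 0# ≤ adjacentWeight x u
    adjacentWeight-nonneg x u = when-nonneg (Adj? u x) (λ _ → w-nonneg u x)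

    module _ (s : Fin n) where
      open Averaging 𝓡 {n} (share s) (share-nonneg s)
      open Conditioning 𝓡 {n} (share s) (share-nonneg s)

      disc : Fin n → Fin n → Subset n → ℝ
      disc = discrepancy r (y s) (nonneg s) (shrinks s) (averages s)

      inclusion : Fin n → Fin n → Subset n → ℝ
      inclusion u v U = 𝔼 (indicator u v) (includeAtoms s U)

      private
        z : Subset n → ℝ
        z = y s

        ∣∪∣≤r : ∀ (U : Subset n) u → suc ∣ U ∣ ℕ.≤ r → ∣ U ∪ ⁅ u ⁆ ∣ ℕ.≤ r
        ∣∪∣≤r U u = ℕ.≤-trans (∣p∪⁅x⁆∣≤1+∣p∣ U u)

        ∣∪∪∣≤r : ∀ (U : Subset n) u v → 2 ℕ.+ ∣ U ∣ ℕ.≤ r → ∣ (U ∪ ⁅ u ⁆) ∪ ⁅ v ⁆ ∣ ℕ.≤ r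
        ∣∪∪∣≤r U u v 2+∣U∣≤r = ∣∪∣≤r (U ∪ ⁅ u ⁆) v
          (ℕ.≤-trans (ℕ.s≤s (∣p∪⁅x⁆∣≤1+∣p∣ U u)) 2+∣U∣≤r)

        z-zero-∪ : ∀ U u → suc ∣ U ∣ ℕ.≤ r → z U ≡ 0# → z (U ∪ ⁅ u ⁆) ≡ 0#
        z-zero-∪ U u 1+∣U∣≤r = z-zero r z (nonneg s) (shrinks s) (averages s) U u
          (∣∪∣≤r U u 1+∣U∣≤r)

      abs-0 : ∀ {a b} → a ≡ b → abs (a - b) ≡ 0#
      abs-0 {a} refl = ≤-antisym
        (abs-≤ (≤-reflexive (-‿inverseʳ a))
               (≤-reflexive (trans (cong -_ (-‿inverseʳ a)) -0#≈0#)))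
        (abs-nonneg _)

      disc-zero : ∀ {U x u} v → 2 ℕ.+ ∣ U ∣ ℕ.≤ r → x ∈ U → ¬ Adj u x → disc u v U ≡ 0#
      disc-zero {U} {x} {u} v 2+∣U∣≤r x∈U ¬adj with part u Fin.≟ part x
      -- Same atom as the pivot: `u` is certain, so the joint probability is that of `v`.
      ... | yes pu≡px = abs-0 (begin
        z (U ∪ ⁅ u ⁆) * z (U ∪ ⁅ v ⁆) * z U ⁻¹
          ≡⟨ cong (λ a → a * z (U ∪ ⁅ v ⁆) * z U ⁻¹)
               (atom-equal s (sym pu≡px) x∈U (∣∪∣≤r U u 1+∣U∣≤r)) ⟩
        z U * z (U ∪ ⁅ v ⁆) * z U ⁻¹
          ≡⟨ cancel (z U ≟ 0#) ⟩
        z (U ∪ ⁅ v ⁆)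
          ≡⟨ atom-equal s (sym pu≡px) (p⊆p∪q ⁅ v ⁆ x∈U)
               (subst (λ S → ∣ S ∣ ℕ.≤ r) (∪-swap U ⁅ u ⁆ ⁅ v ⁆) (∣∪∪∣≤r U u v 2+∣U∣≤r)) ⟨
        z ((U ∪ ⁅ v ⁆) ∪ ⁅ u ⁆)
          ≡⟨ cong z (∪-swap U ⁅ v ⁆ ⁅ u ⁆) ⟩
        z ((U ∪ ⁅ u ⁆) ∪ ⁅ v ⁆) ∎)
        where
        open ≡-Reasoning
        1+∣U∣≤r : suc ∣ U ∣ ℕ.≤ r
        1+∣U∣≤r = ℕ.<⇒≤ 2+∣U∣≤r
        cancel : Dec (z U ≡ 0#) → z U * z (U ∪ ⁅ v ⁆) * z U ⁻¹ ≡ z (U ∪ ⁅ v ⁆)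
        cancel (no zU≢0)  = trans (solve 3 (λ a b i → a :* b :* i := b :* (a :* i)) refl _ _ _)
          (trans (cong (z (U ∪ ⁅ v ⁆) *_) (*-inverse zU≢0)) (*-identityʳ _))
        cancel (yes zU≡0) = trans (cong (λ b → z U * b * z U ⁻¹) zUv≡0)
          (trans (cong (_* z U ⁻¹) (zeroʳ _)) (trans (zeroˡ _) (sym zUv≡0)))
          where zUv≡0 = z-zero-∪ U v 1+∣U∣≤r zU≡0
      -- Different atom and not adjacent: `u` is impossible, and every set containing both `u` and
      -- `x` has value zero.
      ... | no pu≢px = abs-0 (trans
        (trans (cong (λ a → a * z (U ∪ ⁅ v ⁆) * z U ⁻¹) (zero-at (∣∪∣≤r U u (ℕ.<⇒≤ 2+∣U∣≤r)) here′))
          (trans (cong (_* z U ⁻¹) (zeroˡ _)) (zeroˡ _)))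
        (sym (zero-at (∣∪∪∣≤r U u v 2+∣U∣≤r)
          (p⊆p∪q {p = U ∪ ⁅ u ⁆} ⁅ v ⁆ (proj₁ here′) , p⊆p∪q {p = U ∪ ⁅ u ⁆} ⁅ v ⁆ (proj₂ here′)))))
        where
        here′ : u ∈ (U ∪ ⁅ u ⁆) × x ∈ (U ∪ ⁅ u ⁆)
        here′ = q⊆p∪q U ⁅ u ⁆ (x∈⁅x⁆ u) , p⊆p∪q ⁅ u ⁆ x∈U
        zero-at : ∀ {S} → ∣ S ∣ ℕ.≤ r → u ∈ S × x ∈ S → z S ≡ 0#
        zero-at ∣S∣≤r (u∈S , x∈S) = non-adj s pu≢px ¬adj u∈S x∈S ∣S∣≤r

      disc-nonneg : ∀ u v U → 0# ≤ disc u v U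
      disc-nonneg u v U = abs-nonneg _

      -- By the triangle inequality through the pivot x.
      weighted-disc-≤ : ∀ {U x} → 2 ℕ.+ ∣ U ∣ ℕ.≤ r → x ∈ U →
        sumPairs (λ u v → w u v * disc u v U) ≤
          (sum λ u → adjacentWeight x u * (sum λ v → disc u v U))
      weighted-disc-≤ {U} {x} 2+∣U∣≤r x∈U = begin
        sumPairs (λ u v → w u v * disc u v U)
          ≤⟨ sumPairs-mono triangle ⟩
        sumPairs (λ u v → G u v + G v u)
          ≡⟨ +-identityʳ _ ⟨
        sumPairs (λ u v → G u v + G v u) + 0#
          ≤⟨ +-monoʳ _ (sum-nonneg λ u → *-nonneg (w-nonneg u x) (disc-nonneg u u U)) ⟩
        sumPairs (λ u v → G u v + G v u) + (sum λ u → G u u)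
          ≡⟨ sum-sum≡sumPairs G ⟨
        (sum λ u → sum λ v → G u v)
          ≡⟨ sum-cong-≗ (λ u → trans (sym (*-distribˡ-sum (w u x) (λ v → disc u v U)))
               (restrict u (Adj? u x))) ⟩
        (sum λ u → adjacentWeight x u * (sum λ v → disc u v U)) ∎
        where
        open ≤-Reasoning
        G : Fin n → Fin n → ℝ
        G u v = w u x * disc u v U
        triangle : ∀ u v → w u v * disc u v U ≤ G u v + G v u
        triangle u v = begin
          w u v * disc u v U
            ≤⟨ *-monoʳ _ (disc-nonneg u v U) (w-triangle u v x) ⟩
          (w u x + w x v) * disc u v U
            ≡⟨ distribʳ _ _ _ ⟩
          w u x * disc u v U + w x v * disc u v U
            ≡⟨ cong₂ (λ a b → G u v + a * b) (w-sym x v)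
                 (discrepancy-sym r z (nonneg s) (shrinks s) (averages s) u v U) ⟩
          G u v + G v u ∎
        restrict : ∀ u (adj? : Dec (Adj u x)) →
          w u x * (sum λ v → disc u v U) ≡ (w u x when adj?) * (sum λ v → disc u v U)
        restrict u (yes _)   = refl
        restrict u (no ¬adj) = trans (cong (w u x *_) Σ≡0) (trans (zeroʳ _) (sym (zeroˡ _)))
          where
          Σ≡0 : (sum λ v → disc u v U) ≡ 0#
          Σ≡0 = sum-zero λ v → disc-zero v 2+∣U∣≤r x∈U ¬adj

      -- Both values equal the one at the set that contains `u` and the representative. The detour
      -- accounts for the two free places above `∣ U ∣`.
      z-rep : ∀ U u → 2 ℕ.+ ∣ U ∣ ℕ.≤ r → z (U ∪ ⁅ rep (part u) ⁆) ≡ z (U ∪ ⁅ u ⁆)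
      z-rep U u 2+∣U∣≤r = begin
        z (U ∪ ⁅ ρ ⁆)
          ≡⟨ atom-equal s pρ≡pu (q⊆p∪q U ⁅ ρ ⁆ (x∈⁅x⁆ ρ)) (∣∪∪∣≤r U ρ u 2+∣U∣≤r) ⟨
        z ((U ∪ ⁅ ρ ⁆) ∪ ⁅ u ⁆)
          ≡⟨ cong z (∪-swap U ⁅ ρ ⁆ ⁅ u ⁆) ⟩
        z ((U ∪ ⁅ u ⁆) ∪ ⁅ ρ ⁆)
          ≡⟨ atom-equal s (sym pρ≡pu) (q⊆p∪q U ⁅ u ⁆ (x∈⁅x⁆ u)) (∣∪∪∣≤r U u ρ 2+∣U∣≤r) ⟩
        z (U ∪ ⁅ u ⁆) ∎
        where
        open ≡-Reasoning
        ρ : Fin n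
        ρ = rep (part u)
        pρ≡pu : part ρ ≡ part u
        pρ≡pu = proj₂ (part-onto (part u))

      -- Where `z U` vanishes, both terms do. For one atom the single coin is exact. For two atoms
      -- the coins are independent, so the product of the conditional probabilities replaces the
      -- joint one, and the error is exactly the discrepancy.
      inclusion-error : ∀ u v U → 2 ℕ.+ ∣ U ∣ ℕ.≤ r →
        abs (z U * inclusion u v U - z ((U ∪ ⁅ u ⁆) ∪ ⁅ v ⁆)) ≤ disc u v U
      inclusion-error u v U 2+∣U∣≤r with part u Fin.≟ part v | z U ≟ 0#
      ... | _ | yes zU≡0 = ≤-trans (≤-reflexive (abs-0 (trans
        (trans (cong (_* inclusion u v U) zU≡0) (zeroˡ _))
        (sym (≤-antisym (≤-trans (shrinks s (U ∪ ⁅ u ⁆) v (∣∪∪∣≤r U u v 2+∣U∣≤r))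
          (≤-reflexive (z-zero-∪ U u (ℕ.<⇒≤ 2+∣U∣≤r) zU≡0)))
          (nonneg s _ (∣∪∪∣≤r U u v 2+∣U∣≤r))))))) (disc-nonneg u v U)
      ... | yes pu≡pv | no zU≢0 = ≤-trans (≤-reflexive (abs-0 (begin
        z U * inclusion u v U
          ≡⟨ cong (z U *_) (ℙ-includeAtoms-≡ 𝒦 y s U u v pu≡pv) ⟩
        z U * (z (U ∪ ⁅ rep (part u) ⁆) * z U ⁻¹)
          ≡⟨ cong (λ a → z U * (a * z U ⁻¹)) (z-rep U u 2+∣U∣≤r) ⟩
        z U * (z (U ∪ ⁅ u ⁆) * z U ⁻¹)
          ≡⟨ solve 3 (λ a b i → a :* (b :* i) := b :* (a :* i)) refl _ _ _ ⟩
        z (U ∪ ⁅ u ⁆) * (z U * z U ⁻¹)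
          ≡⟨ trans (cong (z (U ∪ ⁅ u ⁆) *_) (*-inverse zU≢0)) (*-identityʳ _) ⟩
        z (U ∪ ⁅ u ⁆)
          ≡⟨ atom-equal s pu≡pv (q⊆p∪q U ⁅ u ⁆ (x∈⁅x⁆ u)) (∣∪∪∣≤r U u v 2+∣U∣≤r) ⟨
        z ((U ∪ ⁅ u ⁆) ∪ ⁅ v ⁆) ∎))) (disc-nonneg u v U)
        where open ≡-Reasoning
      ... | no pu≢pv | no zU≢0 = ≤-reflexive (cong (λ a → abs (a - z ((U ∪ ⁅ u ⁆) ∪ ⁅ v ⁆))) (begin
        z U * inclusion u v U
          ≡⟨ cong (z U *_) (ℙ-includeAtoms-≢ 𝒦 y s U u v pu≢pv) ⟩
        z U * (z (U ∪ ⁅ rep (part u) ⁆) * z U ⁻¹ * (z (U ∪ ⁅ rep (part v) ⁆) * z U ⁻¹))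
          ≡⟨ cong₂ (λ a b → z U * (a * z U ⁻¹ * (b * z U ⁻¹)))
               (z-rep U u 2+∣U∣≤r) (z-rep U v 2+∣U∣≤r) ⟩
        z U * (z (U ∪ ⁅ u ⁆) * z U ⁻¹ * (z (U ∪ ⁅ v ⁆) * z U ⁻¹))
          ≡⟨ solve 4 (λ c a b i → c :* (a :* i :* (b :* i)) := (c :* i) :* (a :* b :* i)) refl _ _ _ _ ⟩
        z U * z U ⁻¹ * (z (U ∪ ⁅ u ⁆) * z (U ∪ ⁅ v ⁆) * z U ⁻¹)
          ≡⟨ trans (cong (_* (z (U ∪ ⁅ u ⁆) * z (U ∪ ⁅ v ⁆) * z U ⁻¹)) (*-inverse zU≢0)) (*-identityˡ _) ⟩
        z (U ∪ ⁅ u ⁆) * z (U ∪ ⁅ v ⁆) * z U ⁻¹ ∎))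
        where open ≡-Reasoning

      -- Multiplying by y s U clears the normalisations, also where they divide by zero.
      grow-avg^ : ∀ (f : Subset n → ℝ) t U → ∣ U ∣ ℕ.+ t ℕ.≤ r →
        z U * 𝔼 f (grow s t U) ≡ avg^ t (λ V → z V * f V) U
      grow-avg^ f zero    U ∣U∣≤r = refl
      grow-avg^ f (suc t) U ∣U∣+1+t≤r = begin
        z U * (sum λ x → z (U ∪ ⁅ x ⁆) / (ι (size s) * z U) * 𝔼 f (grow s t (U ∪ ⁅ x ⁆)))
          ≡⟨ *-distribˡ-sum (z U)
               (λ x → z (U ∪ ⁅ x ⁆) / (ι (size s) * z U) * 𝔼 f (grow s t (U ∪ ⁅ x ⁆))) ⟩
        (sum λ x → z U * (z (U ∪ ⁅ x ⁆) / (ι (size s) * z U) * 𝔼 f (grow s t (U ∪ ⁅ x ⁆))))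
          ≡⟨ sum-cong-≗ (λ x → clear (𝔼 f (grow s t (U ∪ ⁅ x ⁆))) x (z U ≟ 0#)) ⟩
        (sum λ x → share s * (z (U ∪ ⁅ x ⁆) * 𝔼 f (grow s t (U ∪ ⁅ x ⁆))))
          ≡⟨ sum-cong-≗ (λ x → cong (share s *_)
               (grow-avg^ f t (U ∪ ⁅ x ⁆) (grown-size {U} x ∣U∣+1+t≤r))) ⟩
        (sum λ x → share s * avg^ t (λ V → z V * f V) (U ∪ ⁅ x ⁆))
          ≡⟨ *-distribˡ-sum (share s) (λ x → avg^ t (λ V → z V * f V) (U ∪ ⁅ x ⁆)) ⟨
        avg^ (suc t) (λ V → z V * f V) U ∎
        where
        open ≡-Reasoning
        ∣U∣<r : suc ∣ U ∣ ℕ.≤ r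
        ∣U∣<r = ℕ.≤-trans (ℕ.s≤s (ℕ.m≤m+n ∣ U ∣ t))
          (ℕ.≤-trans (ℕ.≤-reflexive (sym (ℕ.+-suc ∣ U ∣ t))) ∣U∣+1+t≤r)
        k≢0 : ι (size s) ≢ 0#
        k≢0 = >⇒≢0 (0<ι (toℕ s))
        inverse : z U ≢ 0# → z U * (ι (size s) * z U) ⁻¹ ≡ share s
        inverse zU≢0 = *-cancelˡ-≡ (ι (size s)) k≢0 (begin
          ι (size s) * (z U * (ι (size s) * z U) ⁻¹)
            ≡⟨ *-assoc _ _ _ ⟨
          ι (size s) * z U * (ι (size s) * z U) ⁻¹
            ≡⟨ *-inverse (λ kz≡0 → zU≢0 (*-cancelˡ-≡ (ι (size s)) k≢0 (trans kz≡0 (sym (zeroʳ _))))) ⟩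
          1#
            ≡⟨ *-inverse k≢0 ⟨
          ι (size s) * ι (size s) ⁻¹
            ≡⟨ cong (ι (size s) *_) (*-identityˡ _) ⟨
          ι (size s) * share s ∎)
        clear : ∀ e x → Dec (z U ≡ 0#) →
          z U * (z (U ∪ ⁅ x ⁆) / (ι (size s) * z U) * e) ≡ share s * (z (U ∪ ⁅ x ⁆) * e)
        clear e x (no zU≢0) = trans
          (solve 4 (λ c a i e → c :* (a :* i :* e) := (c :* i) :* (a :* e)) refl _ _ _ _)
          (cong (_* (z (U ∪ ⁅ x ⁆) * e)) (inverse zU≢0))
        clear e x (yes zU≡0) = trans
          (trans (cong (_* (z (U ∪ ⁅ x ⁆) / (ι (size s) * z U) * e)) zU≡0) (zeroˡ _))
          (sym (trans (cong (λ a → share s * (a * e)) (z-zero-∪ U x ∣U∣<r zU≡0))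
          (trans (cong (share s *_) (zeroˡ e)) (zeroʳ _))))

      ∣⊥∣+1+i≤c : ∀ (i : Fin c) → ∣ ⊥ {n} ∣ ℕ.+ suc (toℕ i) ℕ.≤ c
      ∣⊥∣+1+i≤c i = ℕ.≤-trans (ℕ.≤-reflexive (cong (ℕ._+ suc (toℕ i)) (∣⊥∣≡0 n))) (Fin.toℕ<n i)

      sampled : Fin n → Fin n → Fin c → ℝ
      sampled u v i = z ⊥ * 𝔼 (indicator u v) (grow s (suc (toℕ i)) ⊥ >>= includeAtoms s)

      -- The LP value at the pair is itself the average of `z ((V ∪ ⁅ u ⁆) ∪ ⁅ v ⁆)` over the final
      -- pivot sets `V`, so the two quantities can be compared set by set.
      sampling-error : ∀ u v i →
        abs (sampled u v i - z (⁅ u ⁆ ∪ ⁅ v ⁆)) ≤ avg^ (suc (toℕ i)) (disc u v) ⊥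
      sampling-error u v i = ≤-trans
        (≤-reflexive (cong₂ (λ a b → abs (a - b)) grown fixed))
        (avg^-abs-≤ {⊥} {c}
          (λ V _ ∣V∣≤c → inclusion-error u v V (ℕ.s≤s (ℕ.s≤s ∣V∣≤c)))
          (suc (toℕ i)) ⊥ ⊆-refl (∣⊥∣+1+i≤c i))
        where
        grown : sampled u v i ≡ avg^ (suc (toℕ i)) (λ V → z V * inclusion u v V) ⊥
        grown = trans
          (cong (z ⊥ *_) (𝔼->>= (indicator u v) (grow s (suc (toℕ i)) ⊥) (includeAtoms s)))
          (grow-avg^ (inclusion u v) (suc (toℕ i)) ⊥ (ℕ.≤-trans (∣⊥∣+1+i≤c i) (ℕ.m≤n+m c 2)))
        fixed : z (⁅ u ⁆ ∪ ⁅ v ⁆) ≡ avg^ (suc (toℕ i)) (λ V → z ((V ∪ ⁅ u ⁆) ∪ ⁅ v ⁆)) ⊥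
        fixed = sym (trans
          (avg^-fixed {c}
            (λ V ∣V∣<c → averages-∪∪ r z (nonneg s) (shrinks s) (averages s) u v V
              (ℕ.s≤s (ℕ.s≤s ∣V∣<c)))
            (suc (toℕ i)) ⊥ (∣⊥∣+1+i≤c i))
          (cong (λ S → z (S ∪ ⁅ v ⁆)) (∪-identityˡ ⁅ u ⁆)))

      module _ {θ η : ℝ} (0<θ : 0# < θ) (4θη≡1 : ι 4 * θ * η ≡ 1#) where

        potential : ℝ
        potential = θ * ι 4 ⁻¹ + ι c * η

        -- Of `suc (toℕ i)` rounds the first draws `x`, and `toℕ i` remain; summed over `i`, this is
        -- the telescoping sum started at `⁅ x ⁆`.
        total-error-≤ :
          (sum {c} λ i → sumPairs λ u v → w u v * avg^ (suc (toℕ i)) (disc u v) ⊥) ≤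
            (sum λ x → sum λ u → adjacentWeight x u * (potential * z ⁅ x ⁆))
        total-error-≤ = begin
          (sum {c} λ i → sumPairs λ u v → w u v * avg^ (suc (toℕ i)) (disc u v) ⊥)
            ≡⟨ sum-cong-≗ {c} (λ i → trans
                 (sumPairs-cong λ u v → sym (avg^-* (suc (toℕ i)) (w u v) (disc u v) ⊥))
                 (sym (avg^-sumPairs (suc (toℕ i)) (λ u v U → w u v * disc u v U) ⊥))) ⟩
          (sum {c} λ i → share s * (sum λ x → avg^ (toℕ i) weighted (⊥ ∪ ⁅ x ⁆)))
            ≤⟨ sum-mono {c} (λ i → *-monoˡ (share s) (share-nonneg s) (sum-mono λ x → pivot i x)) ⟩
          (sum {c} λ i → share s * (sum λ x → sum λ u →
             adjacentWeight x u * avg^ (toℕ i) (λ U → sum λ v → disc u v U) (⊥ ∪ ⁅ x ⁆)))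
            ≡⟨ sum-cong-≗ {c} (λ i → trans (*-distribˡ-sum (share s) (λ x → sum λ u → term i x u))
                 (sum-cong-≗ λ x → *-distribˡ-sum (share s) (λ u → term i x u))) ⟩
          (sum {c} λ i → sum λ x → sum λ u → share s * term i x u)
            ≡⟨ trans (∑-comm {c} (λ i x → sum λ u → share s * term i x u))
                 (sum-cong-≗ λ x → ∑-comm {c} (λ i u → share s * term i x u)) ⟩
          (sum λ x → sum λ u → sum {c} λ i → share s * term i x u)
            -- The factor `share s` of the first round moves inward and becomes the normalisation of
            -- the mean over `v`.
            ≡⟨ sum-cong-≗ (λ x → sum-cong-≗ λ u → trans
                 (sum-cong-≗ {c} λ i → trans
                   (solve 3 (λ a b e → a :* (b :* e) := b :* (a :* e)) refl
                     (share s) (adjacentWeight x u) (raw i x u))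
                   (cong (adjacentWeight x u *_)
                     (sym (avg^-* (toℕ i) (share s) (λ U → sum λ v → disc u v U) (⊥ ∪ ⁅ x ⁆)))))
                 (sym (*-distribˡ-sum {c} (adjacentWeight x u) (λ i → mean i x u)))) ⟩
          (sum λ x → sum λ u → adjacentWeight x u * (sum {c} λ i → mean i x u))
            ≤⟨ sum-mono (λ x → sum-mono λ u → *-monoˡ _ (adjacentWeight-nonneg x u) (bound x u)) ⟩
          (sum λ x → sum λ u → adjacentWeight x u * (potential * z ⁅ x ⁆)) ∎
          where
          open ≤-Reasoning
          weighted : Subset n → ℝ
          weighted U = sumPairs λ u v → w u v * disc u v U
          raw term mean : Fin c → Fin n → Fin n → ℝ
          raw i x u = avg^ (toℕ i) (λ U → sum λ v → disc u v U) (⊥ ∪ ⁅ x ⁆)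
          term i x u = adjacentWeight x u * raw i x u
          mean i x u = avg^ (toℕ i) (λ U → share s * (sum λ v → disc u v U)) (⊥ ∪ ⁅ x ⁆)
          ∣⊥∪x∣≤1 : ∀ x → ∣ ⊥ ∪ ⁅ x ⁆ ∣ ℕ.≤ 1
          ∣⊥∪x∣≤1 x = ℕ.≤-reflexive (trans (cong ∣_∣ (∪-identityˡ ⁅ x ⁆)) (∣⁅x⁆∣≡1 x))
          pivot : ∀ i x → avg^ (toℕ i) weighted (⊥ ∪ ⁅ x ⁆) ≤ (sum λ u → term i x u)
          pivot i x = ≤-trans
            (avg^-mono {⊥ ∪ ⁅ x ⁆} {c}
              (λ V x⊆V ∣V∣≤c → weighted-disc-≤ {V} {x} (ℕ.s≤s (ℕ.s≤s ∣V∣≤c))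
                (x⊆V (q⊆p∪q ⊥ ⁅ x ⁆ (x∈⁅x⁆ x))))
              (toℕ i) (⊥ ∪ ⁅ x ⁆) ⊆-refl
              (ℕ.≤-trans (ℕ.+-monoˡ-≤ (toℕ i) (∣⊥∪x∣≤1 x)) (Fin.toℕ<n i)))
            (≤-reflexive (trans
              (avg^-sum (toℕ i) (λ u U → adjacentWeight x u * (sum λ v → disc u v U)) (⊥ ∪ ⁅ x ⁆))
              (sum-cong-≗ λ u →
                avg^-* (toℕ i) (adjacentWeight x u) (λ U → sum λ v → disc u v U) (⊥ ∪ ⁅ x ⁆))))
          bound : ∀ x u → (sum {c} λ i → mean i x u) ≤ potential * z ⁅ x ⁆
          bound x u = ≤-trans
            -- With `m = b = c` the budget is tight: the first pivot and `c` further rounds make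
            -- `1 + c` elements, and `u` fills the last place.
            (total-discrepancy-≤ r z (nonneg s) (shrinks s) (averages s) 0<θ 4θη≡1
              {⊥ ∪ ⁅ x ⁆} u c c (ℕ.+-monoˡ-≤ c (∣⊥∪x∣≤1 x)) ℕ.≤-refl)
            (≤-reflexive (cong (λ S → potential * z S) (∪-identityˡ ⁅ x ⁆)))

    module _ (c>0 : 0# < ι c) (u₀ : Fin n) where

      -- The empty set dominates the singleton `⁅ u₀ ⁆`, whose total is one.
      0<total-⊥ : 0# < total y ⊥
      0<total-⊥ = <-≤-trans 0<1 (≤-trans (≤-reflexive (sym (singleton u₀)))
        (sum-mono λ s → ≤-trans (≤-reflexive (cong (y s) (sym (∪-identityˡ ⁅ u₀ ⁆))))
          (shrinks s ⊥ u₀ (ℕ.≤-trans (∣p∪⁅x⁆∣≤1+∣p∣ ⊥ u₀)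
            (ℕ.≤-trans (ℕ.≤-reflexive (cong suc (∣⊥∣≡0 n))) (ℕ.m≤m+n 1 (suc c)))))))

      normaliser : ℝ
      normaliser = total y ⊥ ⁻¹ * (1# / ι c)

      normaliser-nonneg : 0# ≤ normaliser
      normaliser-nonneg = *-nonneg (⁻¹-nonneg 0<total-⊥) (*-nonneg 0≤1 (⁻¹-nonneg c>0))

      ℙ-together : ∀ u v → ℙ (together? u v) (sampleOneCluster r) ≡
        normaliser * (sum λ s → sum {c} λ i → sampled s u v i)
      ℙ-together u v = begin
        ℙ (together? u v) (sampleOneCluster r)
          ≡⟨ ℙ≡𝔼 (together? u v) (sampleOneCluster r) ⟩
        (sum λ s → y s ⊥ * total y ⊥ ⁻¹ * (sum {c} λ i → 1# / ι c * e s i))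
          ≡⟨ sum-cong-≗ (λ s → trans
               (cong (y s ⊥ * total y ⊥ ⁻¹ *_) (sym (*-distribˡ-sum {c} (1# / ι c) (e s))))
               (trans (solve 4 (λ a i k t → a :* i :* (k :* t) := i :* k :* (a :* t)) refl
                 (y s ⊥) (total y ⊥ ⁻¹) (1# / ι c) (sum (e s)))
               (cong (normaliser *_) (*-distribˡ-sum {c} (y s ⊥) (e s))))) ⟩
        (sum λ s → normaliser * (sum {c} λ i → sampled s u v i))
          ≡⟨ *-distribˡ-sum normaliser (λ s → sum {c} λ i → sampled s u v i) ⟨
        normaliser * (sum λ s → sum {c} λ i → sampled s u v i) ∎
        where
        open ≡-Reasoning
        e : Fin n → Fin c → ℝ
        e s i = 𝔼 (indicator u v) (grow s (suc (toℕ i)) ⊥ >>= includeAtoms s)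

      -- The LP value does not depend on the round; it is repeated `c` times so that it meets the
      -- sampled values term by term.
      total-pair : ∀ u v → total y (⁅ u ⁆ ∪ ⁅ v ⁆) / total y ⊥ ≡
        normaliser * (sum λ s → sum {c} λ i → y s (⁅ u ⁆ ∪ ⁅ v ⁆))
      total-pair u v = begin
        T * total y ⊥ ⁻¹
          ≡⟨ *-identityˡ _ ⟨
        1# * (T * total y ⊥ ⁻¹)
          ≡⟨ cong (_* (T * total y ⊥ ⁻¹)) (*-inverse (>⇒≢0 c>0)) ⟨
        ι c * ι c ⁻¹ * (T * total y ⊥ ⁻¹)
          ≡⟨ solve 4 (λ c i t j → c :* i :* (t :* j) := j :* i :* (c :* t)) refl
               (ι c) (ι c ⁻¹) T (total y ⊥ ⁻¹) ⟩
        total y ⊥ ⁻¹ * ι c ⁻¹ * (ι c * T)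
          ≡⟨ cong₂ (λ a b → total y ⊥ ⁻¹ * a * b) (sym (*-identityˡ _)) (trans
               (*-distribˡ-sum (ι c) (λ s → y s (⁅ u ⁆ ∪ ⁅ v ⁆)))
               (sum-cong-≗ λ s → sym (sum-const c (y s (⁅ u ⁆ ∪ ⁅ v ⁆))))) ⟩
        normaliser * (sum λ s → sum {c} λ i → y s (⁅ u ⁆ ∪ ⁅ v ⁆)) ∎
        where
        open ≡-Reasoning
        T = total y (⁅ u ⁆ ∪ ⁅ v ⁆)

      error : Fin n → Fin n → Fin n → Fin c → ℝ
      error u v s i = Averaging.avg^ 𝓡 (share s) (share-nonneg s) (suc (toℕ i)) (disc s u v) ⊥

      pair-error-≤ : ∀ u v →
        abs (ℙ (together? u v) (sampleOneCluster r) - total y (⁅ u ⁆ ∪ ⁅ v ⁆) / total y ⊥) ≤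
          normaliser * (sum λ s → sum {c} λ i → error u v s i)
      pair-error-≤ u v = ≤-trans
        (≤-reflexive (cong abs (trans
          (cong₂ _-_ (ℙ-together u v) (total-pair u v))
          (trans (solve 3 (λ k a b → k :* a :- k :* b := k :* (a :- b)) refl normaliser _ _)
            (cong (normaliser *_) (sym (trans
              (sum-cong-≗ λ s → sum-sub {c} (sampled s u v) (λ i → y s (⁅ u ⁆ ∪ ⁅ v ⁆)))
              (sum-sub (λ s → sum (sampled s u v)) (λ s → sum {c} λ i → y s (⁅ u ⁆ ∪ ⁅ v ⁆))))))))))
        (abs-*-≤ _ normaliser-nonneg (abs-sum-≤ λ s → abs-sum-≤ {c} λ i → sampling-error s u v i))

      weighted-error-≤ : ∀ {θ η} → 0# < θ → ι 4 * θ * η ≡ 1# →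
        sumPairs (λ u v → w u v *
          abs (ℙ (together? u v) (sampleOneCluster r) - total y (⁅ u ⁆ ∪ ⁅ v ⁆) / total y ⊥)) ≤
        normaliser * ((θ * ι 4 ⁻¹ + ι c * η) * (sum λ u → sum λ v → w u v when Adj? u v))
      weighted-error-≤ {θ} {η} 0<θ 4θη≡1 = begin
        sumPairs (λ u v → w u v *
          abs (ℙ (together? u v) (sampleOneCluster r) - total y (⁅ u ⁆ ∪ ⁅ v ⁆) / total y ⊥))
          ≤⟨ sumPairs-mono (λ u v → *-monoˡ (w u v) (w-nonneg u v) (pair-error-≤ u v)) ⟩
        sumPairs (λ u v → w u v * (normaliser * (sum λ s → sum {c} λ i → error u v s i)))
          ≡⟨ trans (sumPairs-cong λ u v →
               solve 3 (λ a b e → a :* (b :* e) := b :* (a :* e)) refl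
                 (w u v) normaliser (sum λ s → sum {c} λ i → error u v s i))
               (sym (*-distribˡ-sumPairs normaliser
                 (λ u v → w u v * (sum λ s → sum {c} λ i → error u v s i)))) ⟩
        normaliser * sumPairs (λ u v → w u v * (sum λ s → sum {c} λ i → error u v s i))
          ≤⟨ *-monoˡ normaliser normaliser-nonneg (begin
               sumPairs (λ u v → w u v * (sum λ s → sum {c} λ i → error u v s i))
                 ≡⟨ exchange ⟩
               (sum λ s → sum {c} λ i → sumPairs λ u v → w u v * error u v s i)
                 ≤⟨ sum-mono (λ s → total-error-≤ s 0<θ 4θη≡1) ⟩
               (sum λ s → sum λ x → sum λ u → adjacentWeight x u * (p * y s ⁅ x ⁆))
                 ≡⟨ collect ⟩
               p * (sum λ u → sum λ v → w u v when Adj? u v) ∎) ⟩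
        normaliser * (p * (sum λ u → sum λ v → w u v when Adj? u v)) ∎
        where
        open ≤-Reasoning
        p : ℝ
        p = θ * ι 4 ⁻¹ + ι c * η
        sumPairs-sum : ∀ {k} (f : Fin n → Fin n → Fin k → ℝ) →
          sumPairs (λ u v → sum (f u v)) ≡ sum λ i → sumPairs λ u v → f u v i
        sumPairs-sum f = trans
          (sum-cong-≗ λ u → trans (sum-cong-≗ λ v → when-sum (f u v) (u Fin.<? v))
            (∑-comm (λ v i → f u v i when (u Fin.<? v))))
          (∑-comm (λ u i → sum λ v → f u v i when (u Fin.<? v)))
          where
          when-sum : ∀ {k} {P : Set} (g : Fin k → ℝ) (P? : Dec P) →
                     (sum g when P?) ≡ (sum λ i → g i when P?)
          when-sum g (yes _) = refl
          when-sum {k} g (no _) = sym (sum-zero {k} λ i → refl)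
        exchange : sumPairs (λ u v → w u v * (sum λ s → sum {c} λ i → error u v s i)) ≡
                   (sum λ s → sum {c} λ i → sumPairs λ u v → w u v * error u v s i)
        exchange = trans
          (sumPairs-cong λ u v → trans (*-distribˡ-sum (w u v) (λ s → sum (error u v s)))
            (sum-cong-≗ λ s → *-distribˡ-sum {c} (w u v) (error u v s)))
          (trans (sumPairs-sum (λ u v s → sum {c} λ i → w u v * error u v s i))
            (sum-cong-≗ λ s → sumPairs-sum {c} (λ u v i → w u v * error u v s i)))
        -- Here the bare sum over the first pivot is normalised: the values `y s ⁅ x ⁆` add up to
        -- one over `s`, which leaves the weight of the adjacent pairs.
        collect : (sum λ s → sum λ x → sum λ u → adjacentWeight x u * (p * y s ⁅ x ⁆)) ≡
                  p * (sum λ u → sum λ v → w u v when Adj? u v)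
        collect = begin-equality
          (sum λ s → sum λ x → sum λ u → adjacentWeight x u * (p * y s ⁅ x ⁆))
            ≡⟨ trans (∑-comm (λ s x → sum λ u → adjacentWeight x u * (p * y s ⁅ x ⁆)))
                 (sum-cong-≗ λ x → ∑-comm (λ s u → adjacentWeight x u * (p * y s ⁅ x ⁆))) ⟩
          (sum λ x → sum λ u → sum λ s → adjacentWeight x u * (p * y s ⁅ x ⁆))
            ≡⟨ sum-cong-≗ (λ x → sum-cong-≗ λ u → trans
                 (sum-cong-≗ λ s → solve 3 (λ a p z → a :* (p :* z) := p :* a :* z) refl
                   (adjacentWeight x u) p (y s ⁅ x ⁆))
                 (trans (sym (*-distribˡ-sum (p * adjacentWeight x u) (λ s → y s ⁅ x ⁆)))
                   (trans (cong (p * adjacentWeight x u *_) (singleton x)) (*-identityʳ _)))) ⟩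
          (sum λ x → sum λ u → p * adjacentWeight x u)
            ≡⟨ ∑-comm (λ x u → p * adjacentWeight x u) ⟩
          (sum λ u → sum λ x → p * (w u x when Adj? u x))
            ≡⟨ trans (sum-cong-≗ λ u → sym (*-distribˡ-sum p (λ x → w u x when Adj? u x)))
                 (sym (*-distribˡ-sum p (λ u → sum λ x → w u x when Adj? u x))) ⟩
          p * (sum λ u → sum λ v → w u v when Adj? u v) ∎

-- The error bound for an optimal LP solution

lemma5p4 :
    (𝓡 : CompleteOrderedField) →
    let open CompleteOrderedField 𝓡
        open CorrelationClustering 𝓡
    in
    (√7 ln2 : ℝ) → IsSqrt (ι 7) √7 → IsLn (ι 2) ln2 →
    (β : ℝ) → 0# < β → β ≤ (ι 2 * √7 - ι 5) / ι 6 →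
    (α : ℝ) → 1# ≤ α → IsAtomConstant β α →
    (ε : ℝ) → 0# < ε → ε ≤ 1# →
    (I : Instance) →
    let open Instance I in
    (OPT : ℝ) → IsOPT I OPT →
    (𝒞⁰ : Clustering n) → obj I 𝒞⁰ ≤ ι 20 / ι 3 * OPT →
    (𝒦 : Clustering n) → IsAtomPartition I β 𝒞⁰ 𝒦 →
    (c r : ℕ) → IsCeiling (ι 2 * ln2 * R α ε ^ 2 / ε ^ 2) c → r ≡ 2 ℕ.+ c →
    (y : LPVars n) → LP.IsOptimal I 𝒦 α ε r y →
    sumPairs (λ u v →
      w u v * abs (ℙ (λ C → (u ∈? C) ×-dec (v ∈? C)) (Sampling.sampleOneCluster 𝒦 y r)
                   - total y (⁅ u ⁆ ∪ ⁅ v ⁆) / total y ⊥))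
    ≤ ε * OPT / total y ⊥
lemma5p4 𝓡 √7 ln2 _ isLn β _ _ α 1≤α isAtomConstant ε 0<ε ε≤1 I OPT isOPT 𝒞⁰ obj≤ 𝒦 isAtoms
         c _ isCeiling refl y (feasible , _) =
  ≤-trans (weighted-error-≤ I 𝒦 adm? c y consistent 0<c
            vertex (0<θ 1≤α 0<ε ε≤1 {c = c} 2≤ρ isLn isCeiling)
            (4θη≡1 1≤α 0<ε ε≤1 {c = c} 2≤ρ isLn isCeiling))
    (final (potential-≤ 1≤α 0<ε ε≤1 {c = c} 2≤ρ isLn isCeiling)
      (sum-nonneg λ u → sum-nonneg λ v → when-nonneg (adm? u v) (λ _ → Instance.w-nonneg I u v))
      (Σ-Adm-≤ I 𝒦 α ε 1≤α 0<ε 0≤OPT (isAtomConstant I 𝒞⁰ 𝒦 OPT isOPT obj≤ isAtoms)))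
  where
  open CompleteOrderedField 𝓡
  open CorrelationClustering 𝓡
  open RealArithmetic 𝓡
  open AdmissibleWeight 𝓡
  open FeasibleSolution 𝓡
  open SampleSize 𝓡
  open Rounding 𝓡
  open Instance I using (n; 2≤n)

  adm? : ∀ u v → Dec (Admissible.Adm I 𝒦 α ε u v)
  adm? = Adm? I 𝒦 α ε 1≤α 0<ε

  2≤ρ : ι 2 ≤ R α ε
  2≤ρ = 2≤R 1≤α 0<ε ε≤1

  0<c : 0# < ι c
  0<c = <-≤-trans 0<1 (≤-trans (≤-reflexive (sym ι1≡1))
    (ι-mono {1} {c} (c-positive 1≤α 0<ε ε≤1 {c = c} 2≤ρ isLn isCeiling)))

  0≤OPT : 0# ≤ OPT
  0≤OPT with proj₁ isOPT
  ... | 𝒞 , obj≡OPT = ≤-trans (obj-nonneg I 𝒞) (≤-reflexive obj≡OPT)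

  consistent : LocallyConsistent 𝒦 (Admissible.Adm I 𝒦 α ε) (2 ℕ.+ c) y
  consistent = record
    { singleton  = LP.Feasible.singleton feasible
    ; averages   = LP.Feasible.size-s feasible
    ; nonneg     = LP.Feasible.nonneg feasible
    ; shrinks    = ∪⁅⁆-≤ I 𝒦 α ε _ y feasible (ℕ.m≤m+n 2 c)
    ; atom-equal = same-atom I 𝒦 α ε _ y feasible (ℕ.m≤m+n 2 c)
    ; non-adj    = non-adm-zero I 𝒦 α ε _ y feasible (ℕ.m≤m+n 2 c)
    }

  Y : ℝ
  Y = total y ⊥

  vertex : Fin n
  -- `2≤n` is read as `1 < n`; one vertex suffices to show that `Y` is positive.
  vertex = fromℕ< 2≤n

  -- The `c` of the mean over rounds cancels the `c` of the potential bound, and the `R` of the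
  -- accuracy `ε/R` cancels that of the admissible weight.
  final : ∀ {p A} → p ≤ ι c * (ε / R α ε) → 0# ≤ A → A ≤ R α ε * OPT →
          Y ⁻¹ * (1# / ι c) * (p * A) ≤ ε * OPT / Y
  final {p} {A} p≤ 0≤A A≤ = begin
    Y ⁻¹ * (1# / ι c) * (p * A)
      ≤⟨ *-monoˡ _ (normaliser-nonneg I 𝒦 adm? c y consistent 0<c vertex)
           (≤-trans (*-monoʳ A 0≤A p≤) (*-monoˡ _ 0≤cg A≤)) ⟩
    Y ⁻¹ * (1# * ι c ⁻¹) * (ι c * (ε * ρ ⁻¹) * (ρ * OPT))
      ≡⟨ cong (λ k → Y ⁻¹ * k * (ι c * (ε * ρ ⁻¹) * (ρ * OPT))) (*-identityˡ _) ⟩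
    Y ⁻¹ * ι c ⁻¹ * (ι c * (ε * ρ ⁻¹) * (ρ * OPT))
      ≡⟨ solve 7 (λ i j k e l m o → i :* j :* (k :* (e :* l) :* (m :* o)) :=
           k :* j :* (m :* l) :* (e :* o :* i)) refl (Y ⁻¹) (ι c ⁻¹) (ι c) ε (ρ ⁻¹) ρ OPT ⟩
    ι c * ι c ⁻¹ * (ρ * ρ ⁻¹) * (ε * OPT * Y ⁻¹)
      ≡⟨ cong (_* (ε * OPT * Y ⁻¹)) (trans
           (cong₂ _*_ (*-inverse (>⇒≢0 0<c)) (*-inverse (>⇒≢0 0<ρ))) (*-identityˡ 1#)) ⟩
    1# * (ε * OPT * Y ⁻¹)
      ≡⟨ *-identityˡ _ ⟩
    ε * OPT / Y ∎
    where
    open ≤-Reasoning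
    ρ : ℝ
    ρ = R α ε
    0<ρ : 0# < ρ
    0<ρ = <-≤-trans (0<ι 1) 2≤ρ
    0≤cg : 0# ≤ ι c * (ε / ρ)
    0≤cg = *-nonneg (proj₁ 0<c) (*-nonneg (proj₁ 0<ε) (⁻¹-nonneg 0<ρ))
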